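{- Let $t,r\ge 3$ be integers and let $L=\{\ell_1,\ell_2,\ldots,\ell_s\}$ be a set of integers with $0\le \ell_1<\ell_2<\cdots<\ell_s\le r-1$ and $s\notin\{1,r\}$. If the sequence $\ell_1,\ell_2,\ldots,\ell_s,r$ forms an arithmetic progression, then, as $n\to\infty$ (with $r,t,L$ fixed), $$\Psi_r(n,L,t)=(1+o(1))\left(\frac{n-\ell_1}{r-\ell_1}\right)^{s}.$$
   Context: All graphs are finite and simple. For a graph $G$ and an integer $r$, the associated $r$-graph of $G$ is $\mathcal{H}_G^r=\{S\in\binom{V(G)}{r}: G[S]\cong K_r\}$, the family of vertex sets of $r$-cliques of $G$; thus $N(K_r,G)=|\mathcal{H}_G^r|$ is the number of copies of $K_r$ in $G$. For a set $L$ of nonnegative integers and an integer $t\ge 2$, a family $\mathcal{F}$ of finite sets is $t$-wise $L$-intersecting if $|F_1\cap\cdots\cap F_t|\in L$ for any $t$ distinct members $F_1,\ldots,F_t$ of $\mathcal{F}$ (vacuous if $|\mathcal{F}|<t$). A graph $G$ is $t$-wise $(K_r,L)$-intersecting if $\mathcal{H}_G^r$ is $t$-wise $L$-intersecting. Finally, $\Psi_r(n,L,t)$ denotes the maximum of $N(K_r,G)$ over all $n$-vertex $t$-wise $(K_r,L)$-intersecting graphs $G$. -}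

module Defs where

open import Data.Bool using (Bool; true; false; _∧_; _∨_; not)
import Data.Bool.Properties as 𝔹
open import Data.Empty using (⊥-elim)
open import Data.Fin using (Fin)
import Data.Fin.Properties as 𝔽
open import Data.Fin.Subset using (Subset; _∈_; ⋂; ∣_∣; ⁅_⁆)
import Data.Fin.Subset.Properties as 𝕊
open import Data.Integer using (ℤ; +_)
import Data.Integer as ℤ
open import Data.List using (List; []; _∷_; length; map; filter; cartesianProductWith)
open import Data.List.Extrema.Nat using (max; xs≤max; argmax-sel)
import Data.List.Properties as 𝕃
import Data.List.Membership.Propositional as List∈
open import Data.List.Membership.Propositional.Properties using (∈-map⁺; ∈-map⁻; ∈-filter⁺; ∈-filter⁻; ∈-cartesianProductWith⁺; ∈-cartesianProductWith⁻)
import Data.Nat.Properties as ℕ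
open import Data.List.Membership.DecPropositional ℕ._≟_ using (_∈?_)
import Data.List.Relation.Unary.All as LAll
import Data.List.Relation.Unary.AllPairs as LAllPairs
open import Data.List.Relation.Unary.Any using (here; there)
open import Data.List.Relation.Unary.Linked using (Linked)
import Data.List.Relation.Unary.Unique.Propositional as LUnique
import Data.List.Relation.Unary.Unique.Propositional.Properties as LUnique
open import Data.Nat using (ℕ; zero; suc; _∸_; _≤_; _<_; NonZero; >-nonZero; z≤n)
open import Data.Product using (∃; _×_; _,_; proj₂)
open import Data.Rational using (ℚ; 0ℚ; 1ℚ)
import Data.Rational as ℚ
open import Data.Sum using (inj₁; inj₂)
open import Data.Vec using (Vec; []; _∷_; toList; lookup; tabulate)
import Data.Vec.Properties as 𝕍
import Data.Vec.Relation.Unary.All as VAll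
import Data.Vec.Relation.Unary.AllPairs as VAllPairs
open import Data.Vec.Relation.Unary.Unique.Propositional using (Unique)
open import Function using (_∘_; mk⇔)
open import Relation.Binary.PropositionalEquality
open import Relation.Nullary using (Dec; yes; no; ¬_; does; ¬?)
open import Relation.Nullary.Decidable using (map′; _×-dec_; _→-dec_; does-⇔)

private
  variable
    A : Set
    n : ℕ

record Graph (n : ℕ) : Set where
  field
    adj        : Fin n → Fin n → Bool
    adj-sym    : ∀ u v → adj u v ≡ adj v u
    adj-irrefl : ∀ v → adj v v ≡ false

open Graph using (adj)

IsClique : Graph n → Subset n → Set
IsClique G S = ∀ u v → u ∈ S → v ∈ S → u ≢ v → adj G u v ≡ true

-- For ∣ S ∣ ≡ r, G[S] ≅ Kᵣ says exactly that S is pairwise adjacent.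
IsKᵣ : ℕ → Graph n → Subset n → Set
IsKᵣ r G S = ∣ S ∣ ≡ r × IsClique G S

isKᵣ? : ∀ r (G : Graph n) S → Dec (IsKᵣ r G S)
isKᵣ? r G S = (∣ S ∣ ℕ.≟ r) ×-dec
  𝔽.all? λ u → 𝔽.all? λ v →
    (u 𝕊.∈? S) →-dec ((v 𝕊.∈? S) →-dec (¬? (u 𝔽.≟ v) →-dec (adj G u v 𝔹.≟ true)))

-- All length-n vectors with entries from the given list.
vecs : List A → ∀ n → List (Vec A n)
vecs xs zero    = [] ∷ []
vecs xs (suc n) = cartesianProductWith _∷_ xs (vecs xs n)

bools : List Bool
bools = true ∷ false ∷ []

subsets : ∀ n → List (Subset n)
subsets = vecs bools

cliques : ℕ → Graph n → List (Subset n)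
cliques {n} r G = filter (isKᵣ? r G) (subsets n)

#Kᵣ : ℕ → Graph n → ℕ
#Kᵣ r G = length (cliques r G)

IsWiseIntersecting : ℕ → List ℕ → List (Subset n) → Set
IsWiseIntersecting {n} t L 𝓕 =
  (F : Vec (Subset n) t) → Unique F → VAll.All (List∈._∈ 𝓕) F →
  ∣ ⋂ (toList F) ∣ List∈.∈ L

IsKᵣIntersecting : ℕ → List ℕ → ℕ → Graph n → Set
IsKᵣIntersecting r L t G = IsWiseIntersecting t L (cliques r G)

vecs-complete : ∀ {xs : List A} (v : Vec A n) → VAll.All (List∈._∈ xs) v → v List∈.∈ vecs xs n
vecs-complete []      VAll.[]         = here refl
vecs-complete (x ∷ v) (x∈ VAll.∷ v∈) = ∈-cartesianProductWith⁺ _∷_ x∈ (vecs-complete v v∈)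

vecs-sound : ∀ {xs : List A} (v : Vec A n) → v List∈.∈ vecs xs n → VAll.All (List∈._∈ xs) v
vecs-sound []      _ = VAll.[]
vecs-sound {n = suc n} {xs = xs} v v∈
  with ∈-cartesianProductWith⁻ _∷_ xs (vecs xs n) v∈
... | x , w , x∈ , w∈ , refl = x∈ VAll.∷ vecs-sound w w∈

vecs-unique : ∀ {xs : List A} → LUnique.Unique xs → ∀ n → LUnique.Unique (vecs xs n)
vecs-unique u zero    = LAll.[] LAllPairs.∷ LAllPairs.[]
vecs-unique u (suc n) =
  LUnique.cartesianProductWith⁺ _∷_ 𝕍.∷-injective u (vecs-unique u n)

∈-bools : ∀ b → b List∈.∈ bools
∈-bools true  = here refl
∈-bools false = there (here refl)

subsets-complete : (S : Subset n) → S List∈.∈ subsets n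
subsets-complete S = vecs-complete S (VAll.universal ∈-bools S)

subsets-unique : ∀ n → LUnique.Unique (subsets n)
subsets-unique = vecs-unique (((λ ()) LAll.∷ LAll.[]) LAllPairs.∷ LAll.[] LAllPairs.∷ LAllPairs.[])

isWiseIntersecting? : ∀ t L (𝓕 : List (Subset n)) → Dec (IsWiseIntersecting t L 𝓕)
isWiseIntersecting? t L 𝓕 = map′
  (λ all F u F∈ → LAll.lookup all (vecs-complete F F∈) u)
  (λ int → LAll.tabulate λ {F} F∈ u → int F u (vecs-sound F F∈))
  (LAll.all? (λ F → unique? F →-dec (∣ ⋂ (toList F) ∣ ∈? L)) (vecs 𝓕 t))
  where
  unique? : (F : Vec (Subset n) t) → Dec (Unique F)
  unique? = VAllPairs.allPairs? λ S T → ¬? (𝕍.≡-dec 𝔹._≟_ S T)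

-- Symmetrise an arbitrary Boolean matrix and clear its diagonal.
fromMatrix : Vec (Vec Bool n) n → Graph n
fromMatrix {n} M = record { adj = e ; adj-sym = e-sym ; adj-irrefl = e-irrefl }
  where
  m : Fin n → Fin n → Bool
  m u v = lookup (lookup M u) v
  e : Fin n → Fin n → Bool
  e u v = not (does (u 𝔽.≟ v)) ∧ (m u v ∨ m v u)
  e-sym : ∀ u v → e u v ≡ e v u
  e-sym u v = cong₂ _∧_
    (cong not (does-⇔ (mk⇔ sym sym) (u 𝔽.≟ v) (v 𝔽.≟ u)))
    (𝔹.∨-comm (m u v) (m v u))
  e-irrefl : ∀ v → e v v ≡ false
  e-irrefl v with v 𝔽.≟ v
  ... | yes _  = refl
  ... | no v≢v = ⊥-elim (v≢v refl)

graphs : ∀ n → List (Graph n)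
graphs n = map fromMatrix (vecs (vecs bools n) n)

-- The default 0 is harmless for r ≥ 2 and t ≥ 1, because the edgeless graph then qualifies
-- (see Ψ-attained).
Ψ : (r n : ℕ) (L : List ℕ) (t : ℕ) → ℕ
Ψ r n L t =
  max 0 (map (#Kᵣ r) (filter (λ G → isWiseIntersecting? t L (cliques r G)) (graphs n)))

cliques-cong : ∀ r (G H : Graph n) → (∀ u v → adj G u v ≡ adj H u v) → cliques r G ≡ cliques r H
cliques-cong {n} r G H G≗H = 𝕃.filter-≐ (isKᵣ? r G) (isKᵣ? r H)
  ( (λ (c , k) → c , λ u v u∈ v∈ u≢v → trans (sym (G≗H u v)) (k u v u∈ v∈ u≢v))
  , (λ (c , k) → c , λ u v u∈ v∈ u≢v → trans (G≗H u v) (k u v u∈ v∈ u≢v)) )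
  (subsets n)

-- Up to pointwise equality of adjacency, which is the best possible without function
-- extensionality.
graphs-complete : (G : Graph n) →
  ∃ λ H → H List∈.∈ graphs n × (∀ u v → adj G u v ≡ adj H u v)
graphs-complete {n} G = fromMatrix M , ∈-map⁺ fromMatrix M∈ , agree
  where
  M : Vec (Vec Bool n) n
  M = tabulate λ u → tabulate (adj G u)
  M∈ : M List∈.∈ vecs (vecs bools n) n
  M∈ = vecs-complete M (VAll.universal subsets-complete M)
  entry : ∀ u v → lookup (lookup M u) v ≡ adj G u v
  entry u v = trans (cong (λ w → lookup w v) (𝕍.lookup∘tabulate _ u)) (𝕍.lookup∘tabulate _ v)
  agree : ∀ u v → adj G u v ≡ adj (fromMatrix M) u v
  agree u v with u 𝔽.≟ v
  ... | yes refl = Graph.adj-irrefl G u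
  ... | no _     = sym (trans
    (cong₂ _∨_ (entry u v) (trans (entry v u) (Graph.adj-sym G v u))) (𝔹.∨-idem _))

Ψ-upper : ∀ r L t (G : Graph n) → IsKᵣIntersecting r L t G → #Kᵣ r G ≤ Ψ r n L t
Ψ-upper r L t G int with graphs-complete G
... | H , H∈ , G≗H rewrite cliques-cong r G H G≗H =
  LAll.lookup (xs≤max 0 _) (∈-map⁺ (#Kᵣ r) (∈-filter⁺ _ H∈ int))

edgeless : ∀ n → Graph n
edgeless n = record { adj = λ _ _ → false ; adj-sym = λ _ _ → refl ; adj-irrefl = λ _ → refl }

edgeless-noKᵣ : ∀ {r} → 2 ≤ r → cliques r (edgeless n) ≡ []
edgeless-noKᵣ {n} {r} 2≤r = 𝕃.filter-none (isKᵣ? r (edgeless n)) {subsets n} (LAll.tabulate λ {S} _ → none S)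
  where
  none : ∀ S → ¬ IsKᵣ r (edgeless n) S
  none S (∣S∣≡r , clique) with 𝕊.nonempty? S
  ... | no ∅ = ℕ.<⇒≱ 2≤r (subst (_≤ 1)
    (trans (sym (trans (cong ∣_∣ (𝕊.Empty-unique ∅)) (𝕊.∣⊥∣≡0 n))) ∣S∣≡r) z≤n)
  ... | yes (x , x∈S) = ℕ.<⇒≱ 2≤r (subst₂ _≤_ ∣S∣≡r (𝕊.∣⁅x⁆∣≡1 x) (𝕊.p⊆q⇒∣p∣≤∣q∣ S⊆x))
    where
    S⊆x : ∀ {y} → y ∈ S → y ∈ ⁅ x ⁆
    S⊆x {y} y∈S with x 𝔽.≟ y
    ... | yes refl = 𝕊.x∈⁅x⁆ x
    ... | no x≢y with () ← clique x y x∈S y∈S x≢y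

Ψ-attained : ∀ {r t} L → 2 ≤ r → 1 ≤ t →
  ∃ λ (G : Graph n) → IsKᵣIntersecting r L t G × #Kᵣ r G ≡ Ψ r n L t
Ψ-attained {n} {r} {suc t} L 2≤r _
  with argmax-sel (λ k → k) 0
    (map (#Kᵣ r) (filter (λ G → isWiseIntersecting? (suc t) L (cliques r G)) (graphs n)))
... | inj₁ Ψ≡0 = edgeless n , vacuous , trans (cong length none) (sym Ψ≡0)
  where
  none = edgeless-noKᵣ {n} 2≤r
  vacuous : IsKᵣIntersecting r L (suc t) (edgeless n)
  vacuous (S ∷ _) _ (S∈ VAll.∷ _) with () ← subst (S List∈.∈_) none S∈
... | inj₂ Ψ∈ with ∈-map⁻ (#Kᵣ r) Ψ∈
... | G , G∈ , Ψ≡ = G , proj₂ (∈-filter⁻ _ {xs = graphs n} G∈) , sym Ψ≡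

IsArithmeticProgression : List ℕ → Set
IsArithmeticProgression xs = ∃ λ (d : ℤ) → Linked (λ x y → + y ℤ.- + x ≡ d) xs

TendsToZero : (ℕ → ℚ) → Set
TendsToZero h = ∀ ε → 0ℚ ℚ.< ε → ∃ λ N → ∀ n → N ≤ n → ℚ.∣ h n ∣ ℚ.< ε

-- f = (1 + o(1)) g as n → ∞.
infix 4 _≡⟨1+o⟩_
_≡⟨1+o⟩_ : (f g : ℕ → ℚ) → Set
f ≡⟨1+o⟩ g = ∃ λ h → TendsToZero h ×
  ∃ λ N → ∀ n → N ≤ n → f n ≡ (1ℚ ℚ.+ h n) ℚ.* g n

∸-nonZero : ∀ {m n} → m < n → NonZero (n ∸ m)
∸-nonZero m<n = >-nonZero (ℕ.m<n⇒0<n∸m m<n)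

module Submission where

-- Write L = {ℓ + k d : k < s} and r = ℓ + s d, and let H be the family of r-cliques of the graph.
-- Call K a kernel if, given boundedly many members of H, some member of H contains K and meets the
-- given ones only inside K; intersections of kernels with kernels or members then have sizes in L.
-- A delta-system argument à la Füredi shows that all but O(n^(s-1)) members F contain kernels
-- A of size ℓ and A ∪ B of size ℓ + d, where the blocks B partition F ∖ A. By the size constraints
-- A is common to all such F, distinct blocks are disjoint, and no s + 1 blocks pairwise lie in
-- common members: exchanging one vertex in the clique spanned by s of them would give an r-clique
-- meeting a kernel in a forbidden size, provided that d ≥ 2 or ℓ ≥ 1 (that is, s ≠ r). A
-- Turán-type count over the blocks bounds the number of such F by ((n - ℓ) / (s d))^s. The join of K_ℓ
-- with s disjoint unions of copies of K_d matches this bound.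

-- Füredi's method is usually run on an r-partite subfamily. Here members are enumerated
-- increasingly and compared position by position, while avoidance is required across all pairs of
-- positions, so no partition has to be chosen. The core of the argument is a dichotomy on a large
-- subfamily: each set of positions is either robust for every member (and then yields kernels) or
-- is never the exact agreement set of two members. Robust sets are closed under intersection and
-- have sizes in the progression, which makes them behave like flats with a rank: `c < s`
-- independent positions close up to exactly `ℓ + c * d` positions. Rank 0 is the core, rank 1 gives
-- the blocks. In the upper bound, the fact that the family consists of all r-cliques of a graph
-- enters only in the exchange step, and this is the step that needs `s ≢ r`. For `s = r` the set L
-- is {0, ..., r - 1} and restricts nothing: the complete graph qualifies, and its roughly n^r / r!
-- cliques exceed (n / r)^r.

open import Defs

-- From integer estimates to rational asymptotics

module Asymptotics where

  open import Data.Integer as ℤ using (+_; +[1+_]; -[1+_])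
  import Data.Integer.Properties as ℤ
  import Data.Integer.Tactic.RingSolver as ℤ-Solver
  open import Data.Nat using (ℕ; zero; suc; _+_; _*_; _∸_; _^_; _≤_; _<_; z≤n; s≤s; NonZero)
  import Data.Nat as Nat
  import Data.Nat.Properties as ℕ
  open import Data.Product using (∃; _×_; _,_)
  open import Data.Rational as ℚ using (ℚ; mkℚ; 0ℚ; 1ℚ; ↧ₙ_; toℚᵘ)
  import Data.Rational.Properties as ℚ
  open import Data.Rational.Unnormalised as ℚᵘ using (mkℚᵘ; *≡*; *<*)
  import Data.Rational.Unnormalised.Properties as ℚᵘ
  open import Data.Sum using ([_,_]′)
  open import Relation.Binary.PropositionalEquality
  import Algebra.Definitions.RawSemiring ℚ.+-*-rawSemiring as ℚ^

  toℚᵘ-/ : ∀ p d .{{_ : NonZero d}} → toℚᵘ (p ℚ./ d) ℚᵘ.≃ p ℚᵘ./ d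
  toℚᵘ-/ p (suc d) = ℚ.toℚᵘ-fromℚᵘ (mkℚᵘ p d)

  /-^ : ∀ m D .{{_ : NonZero D}} k → toℚᵘ ((+ m ℚ./ D) ℚ^.^ k) ℚᵘ.≃ ((+ (m ^ k)) ℚᵘ./ (D ^ k)) {{ℕ.m^n≢0 D k}}
  /-^ m D zero = *≡* refl
  /-^ m D@(suc _) (suc k) = begin-equality
    toℚᵘ ((+ m ℚ./ D) ℚ.* ((+ m ℚ./ D) ℚ^.^ k))              ≃⟨ ℚ.toℚᵘ-homo-* (+ m ℚ./ D) _ ⟩
    toℚᵘ (+ m ℚ./ D) ℚᵘ.* toℚᵘ ((+ m ℚ./ D) ℚ^.^ k)          ≃⟨ ℚᵘ.*-cong (toℚᵘ-/ (+ m) D) (/-^ m D k) ⟩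
    (+ m ℚᵘ./ D) ℚᵘ.* ((+ (m ^ k)) ℚᵘ./ (D ^ k)) {{ℕ.m^n≢0 D k}} ≃⟨ product (+ m) (+ (m ^ k)) D (D ^ k) {{_}} {{ℕ.m^n≢0 D k}} {{ℕ.m^n≢0 D (suc k)}} ⟩
    ((+ m ℤ.* + (m ^ k)) ℚᵘ./ (D * D ^ k)) {{ℕ.m^n≢0 D (suc k)}}      ≡⟨ cong (λ z → (z ℚᵘ./ (D * D ^ k)) {{ℕ.m^n≢0 D (suc k)}}) (ℤ.pos-* m (m ^ k)) ⟨
    ((+ (m * m ^ k)) ℚᵘ./ (D * D ^ k)) {{ℕ.m^n≢0 D (suc k)}} ∎
    where
    open ℚᵘ.≤-Reasoning
    product : ∀ p q a b .{{_ : NonZero a}} .{{_ : NonZero b}} .{{_ : NonZero (a * b)}} →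
      (p ℚᵘ./ a) ℚᵘ.* (q ℚᵘ./ b) ℚᵘ.≃ (p ℤ.* q) ℚᵘ./ (a * b)
    product p q (suc a) (suc b) = ℚᵘ.≃-refl

  -- The error function is chosen as the exact quotient, so that `(1 + h) * g` reproduces `f` with
  -- no further approximation. The value at `b = 0` is a filler: with `b = (n ∸ ℓ) ^ suc k` it
  -- occurs only for `n ≤ ℓ`, below the threshold `suc ℓ` used in `asymptotic`.
  relativeError : ℕ → ℕ → ℚ
  relativeError a zero = 0ℚ
  relativeError a b@(suc _) = (+ a ℤ.- + b) ℚ./ b

  relativeError-correct : ∀ x m D s .{{_ : NonZero m}} .{{_ : NonZero D}} →
    + x ℚ./ 1 ≡ (1ℚ ℚ.+ relativeError (D ^ s * x) (m ^ s)) ℚ.* ((+ m ℚ./ D) ℚ^.^ s)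
  relativeError-correct x m D s = go (m ^ s) (D ^ s) {{ℕ.m^n≢0 m s}} {{ℕ.m^n≢0 D s}} (/-^ m D s)
    where
    identity : ∀ x b c → x ℤ.* (ℤ.1ℤ ℤ.* b ℤ.* c) ≡ (ℤ.1ℤ ℤ.* b ℤ.+ (c ℤ.* x ℤ.- b) ℤ.* ℤ.1ℤ) ℤ.* b ℤ.* ℤ.1ℤ
    identity = ℤ-Solver.solve-∀
    go : ∀ b c .{{_ : NonZero b}} .{{_ : NonZero c}} {g} → toℚᵘ g ℚᵘ.≃ + b ℚᵘ./ c →
      + x ℚ./ 1 ≡ (1ℚ ℚ.+ relativeError (c * x) b) ℚ.* g
    go b@(suc b-1) c@(suc c-1) {g} g≃ = ℚ.toℚᵘ-injective (begin-equality
      toℚᵘ (+ x ℚ./ 1)                                       ≃⟨ toℚᵘ-/ (+ x) 1 ⟩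
      mkℚᵘ (+ x) 0                                           ≃⟨ *≡* (trans (identity (+ x) (+ b) (+ c)) (cong (λ z → (ℤ.1ℤ ℤ.* + b ℤ.+ (z ℤ.- + b) ℤ.* ℤ.1ℤ) ℤ.* + b ℤ.* ℤ.1ℤ) (sym (ℤ.pos-* c x)))) ⟩
      (ℚᵘ.1ℚᵘ ℚᵘ.+ mkℚᵘ (+ (c * x) ℤ.- + b) b-1) ℚᵘ.* mkℚᵘ (+ b) c-1
        ≃⟨ ℚᵘ.*-cong (ℚᵘ.+-congʳ ℚᵘ.1ℚᵘ (toℚᵘ-/ (+ (c * x) ℤ.- + b) b)) g≃ ⟨
      (ℚᵘ.1ℚᵘ ℚᵘ.+ toℚᵘ (relativeError (c * x) b)) ℚᵘ.* toℚᵘ g ≃⟨ ℚᵘ.*-congʳ (ℚ.toℚᵘ-homo-+ 1ℚ (relativeError (c * x) b)) ⟨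
      toℚᵘ (1ℚ ℚ.+ relativeError (c * x) b) ℚᵘ.* toℚᵘ g      ≃⟨ ℚ.toℚᵘ-homo-* (1ℚ ℚ.+ relativeError (c * x) b) g ⟨
      toℚᵘ ((1ℚ ℚ.+ relativeError (c * x) b) ℚ.* g)          ∎)
      where open ℚᵘ.≤-Reasoning

  ∣∣-within : ∀ {a b e} → a ≤ b + e → b ≤ a + e → ℤ.∣ + a ℤ.- + b ∣ ≤ e
  ∣∣-within {a} {b} {e} a≤ b≤ = subst (_≤ e) (cong ℤ.∣_∣ (sym (ℤ.[+m]-[+n]≡m⊖n a b)))
    ([ (λ a≤b → subst (_≤ e) (sym (ℤ.∣⊖∣-≤ a≤b)) (ℕ.m≤n+o⇒m∸n≤o b a b≤))
     , (λ b≤a → subst (_≤ e) (trans (sym (ℤ.∣⊖∣-≤ b≤a)) (ℤ.∣m⊖n∣≡∣n⊖m∣ b a)) (ℕ.m≤n+o⇒m∸n≤o a b a≤))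
     ]′ (ℕ.≤-total a b))

  -- For `ε = p / q` with `p ≥ 1` it suffices that |a - b| / b ≤ e / b < 1 / q, so only the
  -- denominator of `ε` has to be compared with `b`.
  relativeError-small : ∀ {a b e} ε → 0ℚ ℚ.< ε → a ≤ b + e → b ≤ a + e → e * ↧ₙ ε < b → ℚ.∣ relativeError a b ∣ ℚ.< ε
  relativeError-small {b = zero} ε 0<ε a≤ b≤ ()
  relativeError-small {a} {b@(suc b-1)} {e} ε@(mkℚ +[1+ p ] q _) 0<ε a≤ b≤ small =
    ℚ.toℚᵘ-cancel-< (ℚᵘ.<-respˡ-≃ (ℚᵘ.≃-sym abs≃) (*<* (subst₂ ℤ._<_ (ℤ.pos-* ℤ.∣ num ∣ (suc q)) (ℤ.pos-* (suc p) b) (ℤ.+<+ (begin-strict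
      ℤ.∣ num ∣ * suc q ≤⟨ ℕ.*-monoˡ-≤ (suc q) (∣∣-within {a} {b} a≤ b≤) ⟩
      e * suc q         <⟨ small ⟩
      b                 ≤⟨ ℕ.m≤m+n b (p * b) ⟩
      suc p * b         ∎)))))
    where
    open ℕ.≤-Reasoning
    num = + a ℤ.- + b
    toℚᵘ-∣∣ : ∀ x → toℚᵘ ℚ.∣ x ∣ ≡ ℚᵘ.∣ toℚᵘ x ∣
    toℚᵘ-∣∣ (mkℚ _ _ _) = refl
    abs≃ : toℚᵘ ℚ.∣ num ℚ./ b ∣ ℚᵘ.≃ ℚᵘ.∣ mkℚᵘ num b-1 ∣
    abs≃ = ℚᵘ.≃-trans (ℚᵘ.≃-reflexive (toℚᵘ-∣∣ (num ℚ./ b))) (ℚᵘ.∣-∣-cong (toℚᵘ-/ num b))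
  relativeError-small (mkℚ (+ 0) q _) (ℚ.*<* (ℤ.+<+ ())) a≤ b≤ small
  relativeError-small (mkℚ -[1+ p ] q _) (ℚ.*<* ()) a≤ b≤ small

  -- Both estimates leave an error one power of `n ∸ ℓ` below the main term, hence a relative error
  -- of order `1 / (n ∸ ℓ)`.
  asymptotic : (f : ℕ → ℕ) (ℓ D k E N : ℕ) .{{_ : NonZero D}} →
    (∀ n → N ≤ n → D ^ suc k * f n ≤ (n ∸ ℓ) ^ suc k + E * (n ∸ ℓ) ^ k) →
    (∀ n → N ≤ n → (n ∸ ℓ) ^ suc k ≤ D ^ suc k * f n + E * (n ∸ ℓ) ^ k) →
    (λ n → + f n ℚ./ 1) ≡⟨1+o⟩ (λ n → ((+ n ℤ.- + ℓ) ℚ./ D) ℚ^.^ suc k)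
  asymptotic f ℓ D k E N upper lower =
    (λ n → relativeError (D ^ suc k * f n) ((n ∸ ℓ) ^ suc k)) , small , suc ℓ , equal
    where
    small : TendsToZero (λ n → relativeError (D ^ suc k * f n) ((n ∸ ℓ) ^ suc k))
    -- Past this threshold `n ∸ ℓ` exceeds `E * ↧ₙ ε`, so a single factor of the leading power
    -- absorbs the constant and the denominator.
    small ε 0<ε = N + (suc (E * ↧ₙ ε) + ℓ) , λ n N≤n →
      let n≥N = ℕ.≤-trans (ℕ.m≤m+n N _) N≤n
          m>  = ℕ.m+n≤o⇒m≤o∸n (suc (E * ↧ₙ ε)) {ℓ} {n} (ℕ.≤-trans (ℕ.m≤n+m (suc (E * ↧ₙ ε) + ℓ) N) N≤n)
      in relativeError-small ε 0<ε (upper n n≥N) (lower n n≥N) (begin-strict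
        E * (n ∸ ℓ) ^ k * ↧ₙ ε     ≡⟨ trans (ℕ.*-assoc E _ _) (trans (cong (E *_) (ℕ.*-comm ((n ∸ ℓ) ^ k) (↧ₙ ε))) (sym (ℕ.*-assoc E _ _))) ⟩
        E * ↧ₙ ε * (n ∸ ℓ) ^ k     <⟨ ℕ.*-monoˡ-< ((n ∸ ℓ) ^ k) {{ℕ.m^n≢0 (n ∸ ℓ) k {{Nat.>-nonZero (ℕ.≤-trans (s≤s z≤n) m>)}}}} m> ⟩
        (n ∸ ℓ) * (n ∸ ℓ) ^ k      ∎)
      where open ℕ.≤-Reasoning
    equal : ∀ n → suc ℓ ≤ n → + f n ℚ./ 1 ≡
      (1ℚ ℚ.+ relativeError (D ^ suc k * f n) ((n ∸ ℓ) ^ suc k)) ℚ.* (((+ n ℤ.- + ℓ) ℚ./ D) ℚ^.^ suc k)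
    equal n ℓ<n = subst (λ z → + f n ℚ./ 1 ≡ (1ℚ ℚ.+ relativeError (D ^ suc k * f n) ((n ∸ ℓ) ^ suc k)) ℚ.* ((z ℚ./ D) ℚ^.^ suc k))
      (sym (trans (ℤ.[+m]-[+n]≡m⊖n n ℓ) (ℤ.⊖-≥ (ℕ.<⇒≤ ℓ<n))))
      (relativeError-correct (f n) (n ∸ ℓ) D (suc k) {{Nat.>-nonZero (ℕ.m<n⇒0<n∸m ℓ<n)}})

module CliqueCounting where

  open Asymptotics using (asymptotic)
  open import Data.Bool using (true; false; if_then_else_)
  import Data.Bool.Properties as 𝔹
  open import Data.Empty using (⊥; ⊥-elim)
  import Data.Fin as Fin
  open import Data.Fin using (Fin; zero; suc)
  import Data.Fin.Properties as 𝔽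
  import Data.Fin.Subset as Subset
  open import Data.Fin.Subset using (Subset; _∈_; _∉_; _⊆_; _∩_; _∪_; _─_; ∁; ⋂; ⁅_⁆; ∣_∣)
  import Data.Fin.Subset.Properties as 𝕊
  open import Data.Integer as ℤ using () renaming (+_ to pos)
  import Data.Integer.Properties as ℤ
  import Data.Integer.Tactic.RingSolver as ℤ-Solver
  import Data.List as List
  open import Data.List using (List; []; _∷_; _++_; length; map; filter; allFin; cartesianProductWith; cartesianProduct)
  import Data.List.Membership.Propositional as List∈
  open import Data.List.Membership.Propositional.Properties using (∈-map⁺; ∈-map⁻; ∈-filter⁺; ∈-filter⁻; ∈-++⁺ˡ; ∈-++⁺ʳ; ∈-++⁻; ∈-∃++; ∈-allFin; ∈-lookup; ∈-upTo⁺; ∈-upTo⁻; ∈-cartesianProduct⁺; ∈-cartesianProduct⁻)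
  import Data.List.Properties as 𝕃
  open import Data.List.Relation.Binary.Permutation.Propositional using (_↭_; refl; prep; swap; ↭-sym)
  import Data.List.Relation.Binary.Permutation.Propositional.Properties as Perm
  open import Data.List.Relation.Unary.All as All using (All; []; _∷_)
  import Data.List.Relation.Unary.All.Properties as All
  open import Data.List.Relation.Unary.AllPairs as AllPairs using ([]; _∷_)
  import Data.List.Relation.Unary.AllPairs.Properties as AllPairs
  open import Data.List.Relation.Unary.Any as Any using (here; there)
  import Data.List.Relation.Unary.Any.Properties as Any
  open import Data.List.Relation.Unary.Linked as Linked using (Linked; _∷_)
  import Data.List.Relation.Unary.Unique.Propositional as ListU
  import Data.List.Relation.Unary.Unique.Propositional.Properties as ListU
  import Data.Nat as Nat
  open import Data.Nat using (ℕ; zero; suc; _+_; _*_; _∸_; _^_; _≤_; _<_; z≤n; s≤s)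
  open import Data.Nat.DivMod using (_/_; _%_; _mod_; m≡m%n+[m/n]*n; m%n<n; [m+kn]%n≡m%n; m<n⇒m%n≡m; +-distrib-/-∣ˡ; m<n⇒m/n≡0; m*n/n≡m)
  open import Data.Nat.Divisibility using (divides-refl)
  open import Data.Nat.ListAction using (sum)
  import Data.Nat.Properties as ℕ
  open import Data.Nat.Tactic.RingSolver using (solve-∀)
  open import Data.Product using (∃; ∃₂; _×_; _,_; proj₁; proj₂)
  import Data.Product.Properties as Product
  import Data.Rational as ℚ
  import Data.Rational.Properties as ℚ
  open import Data.Sum using (_⊎_; inj₁; inj₂; [_,_]′)
  import Data.Vec as Vec
  open import Data.Vec using (Vec; []; _∷_; lookup; tabulate; toList)
  import Data.Vec.Properties as 𝕍
  open import Data.Vec.Relation.Unary.All as VAll using ([]; _∷_)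
  import Data.Vec.Relation.Unary.All.Properties as VAll
  open import Data.Vec.Relation.Unary.AllPairs as VAllPairs using ([]; _∷_)
  import Data.Vec.Relation.Unary.AllPairs.Properties as VAllPairs
  import Data.Vec.Relation.Unary.Unique.Propositional as VecU
  open import Function using (_∘_; id; mk⇔)
  open import Relation.Binary.PropositionalEquality
  open import Relation.Nullary using (Dec; yes; no; ¬_; does; ¬?)
  open import Relation.Nullary.Decidable using (_×-dec_; _⊎-dec_; _→-dec_; decidable-stable; toSum; does-⇔; dec-true; dec-false)
  open import Relation.Unary using (Decidable)
  open List∈ using () renaming (_∈_ to _∈ˡ_)
  import Algebra.Definitions.RawSemiring ℚ.+-*-rawSemiring as ℚ^
  open import Algebra.Properties.CommutativeSemigroup ℕ.+-commutativeSemigroup using (x∙yz≈y∙xz)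

  private variable
    A B C : Set
    m n : ℕ

  -- Counting in lists

  length-⊆ : {xs ys : List A} → ListU.Unique xs → (∀ {x} → x ∈ˡ xs → x ∈ˡ ys) → length xs ≤ length ys
  length-⊆ [] _ = z≤n
  length-⊆ {xs = x ∷ xs} (x∉ ∷ u) sub with ∈-∃++ (sub (here refl))
  ... | as , bs , refl = subst (suc (length xs) ≤_) (sym (trans (𝕃.length-++ as) (trans (ℕ.+-suc _ _) (cong suc (sym (𝕃.length-++ as))))))
    (s≤s (length-⊆ u λ y∈ → move y∈ (∈-++⁻ as (sub (there y∈)))))
    where
    move : ∀ {y} → y ∈ˡ xs → y ∈ˡ as ⊎ y ∈ˡ (x ∷ bs) → y ∈ˡ as ++ bs
    move y∈ (inj₁ y∈as) = ∈-++⁺ˡ y∈as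
    move y∈ (inj₂ (here refl)) = ⊥-elim (All.lookup x∉ y∈ refl)
    move y∈ (inj₂ (there y∈bs)) = ∈-++⁺ʳ as y∈bs

  nonempty-∈ : (xs : List A) → 0 < length xs → ∃ (_∈ˡ xs)
  nonempty-∈ (x ∷ xs) _ = x , here refl

  length-pos : ∀ {x : A} {xs} → x ∈ˡ xs → 0 < length xs
  length-pos (here _) = s≤s z≤n
  length-pos (there _) = s≤s z≤n

  sum-≥ : ∀ (f : A → ℕ) k xs → (∀ {x} → x ∈ˡ xs → k ≤ f x) → length xs * k ≤ sum (map f xs)
  sum-≥ f k [] _ = z≤n
  sum-≥ f k (x ∷ xs) b = ℕ.+-mono-≤ (b (here refl)) (sum-≥ f k xs (b ∘ there))

  sum-≤ : ∀ (f : A → ℕ) k xs → (∀ {x} → x ∈ˡ xs → f x ≤ k) → sum (map f xs) ≤ length xs * k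
  sum-≤ f k [] _ = z≤n
  sum-≤ f k (x ∷ xs) b = ℕ.+-mono-≤ (b (here refl)) (sum-≤ f k xs (b ∘ there))

  module _ {R : A → B → Set} (R? : ∀ x y → Dec (R x y)) where

    private
      fibre : List A → B → ℕ
      fibre xs y = length (filter (λ x → R? x y) xs)

      fibre-∷ : ∀ x xs ys → sum (map (fibre (x ∷ xs)) ys) ≡ length (filter (R? x) ys) + sum (map (fibre xs) ys)
      fibre-∷ x xs [] = refl
      fibre-∷ x xs (y ∷ ys) with does (R? x y) | trans (cong (fibre xs y +_) (fibre-∷ x xs ys)) (x∙yz≈y∙xz (fibre xs y) (length (filter (R? x) ys)) (sum (map (fibre xs) ys)))
      ... | false | eq = eq
      ... | true  | eq = cong suc eq

    double-count : ∀ xs ys →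
      sum (map (λ x → length (filter (R? x) ys)) xs) ≡
      sum (map (λ y → length (filter (λ x → R? x y) xs)) ys)
    double-count [] [] = refl
    double-count [] (y ∷ ys) = double-count [] ys
    double-count (x ∷ xs) ys = trans (cong (length (filter (R? x) ys) +_) (double-count xs ys)) (sym (fibre-∷ x xs ys))

  pigeonhole : (_≟_ : ∀ (c c′ : C) → Dec (c ≡ c′)) (f : A → C) (cs : List C) (xs : List A) (k : ℕ) →
    (∀ {x} → x ∈ˡ xs → f x ∈ˡ cs) → length cs * k < length xs →
    ∃ λ c → c ∈ˡ cs × k < length (filter (λ x → f x ≟ c) xs)
  pigeonhole _≟_ f cs xs k f∈ big with Any.any? (λ c → suc k ℕ.≤? length (filter (λ x → f x ≟ c) xs)) cs
  ... | yes p = _ , proj₁ (proj₂ (List∈.find p)) , proj₂ (proj₂ (List∈.find p))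
  ... | no ¬p = ⊥-elim (ℕ.<⇒≱ big (begin
    length xs ≡⟨ ℕ.*-identityʳ _ ⟨
    length xs * 1 ≤⟨ sum-≥ _ 1 xs (λ x∈ → length-pos (∈-filter⁺ (λ c → f _ ≟ c) (f∈ x∈) refl)) ⟩
    sum (map (λ x → length (filter (λ c → f x ≟ c) cs)) xs) ≡⟨ double-count (λ x c → f x ≟ c) xs cs ⟩
    sum (map (λ c → length (filter (λ x → f x ≟ c) xs)) cs) ≤⟨ sum-≤ _ k cs (λ c∈ → ℕ.≮⇒≥ (All.lookup (All.¬Any⇒All¬ cs ¬p) c∈)) ⟩
    length cs * k ∎))
    where
    open ℕ.≤-Reasoning

  length-cartesianProductWith : (f : A → B → C) (xs : List A) (ys : List B) →
    length (cartesianProductWith f xs ys) ≡ length xs * length ys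
  length-cartesianProductWith f [] ys = refl
  length-cartesianProductWith f (x ∷ xs) ys = trans (𝕃.length-++ (map (f x) ys))
    (cong₂ _+_ (𝕃.length-map (f x) ys) (length-cartesianProductWith f xs ys))

  length-vecs : (xs : List A) → ∀ k → length (vecs xs k) ≡ length xs ^ k
  length-vecs xs zero = refl
  length-vecs xs (suc k) = trans (length-cartesianProductWith _∷_ xs (vecs xs k)) (cong (length xs *_) (length-vecs xs k))

  -- Finite subsets

  elements : Subset n → List (Fin n)
  elements [] = []
  elements (true ∷ p) = zero ∷ map suc (elements p)
  elements (false ∷ p) = map suc (elements p)

  length-elements : (p : Subset n) → length (elements p) ≡ ∣ p ∣
  length-elements [] = refl
  length-elements (true ∷ p) = cong suc (trans (𝕃.length-map suc (elements p)) (length-elements p))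
  length-elements (false ∷ p) = trans (𝕃.length-map suc (elements p)) (length-elements p)

  ∈-elements⁺ : ∀ {x} {p : Subset n} → x ∈ p → x ∈ˡ elements p
  ∈-elements⁺ {p = true ∷ p} Vec.here = here refl
  ∈-elements⁺ {p = true ∷ p} (Vec.there x∈) = there (∈-map⁺ suc (∈-elements⁺ x∈))
  ∈-elements⁺ {p = false ∷ p} (Vec.there x∈) = ∈-map⁺ suc (∈-elements⁺ x∈)

  ∈-elements⁻ : ∀ {x} (p : Subset n) → x ∈ˡ elements p → x ∈ p
  ∈-elements⁻ (true ∷ p) (here refl) = Vec.here
  ∈-elements⁻ (true ∷ p) (there x∈) with ∈-map⁻ suc x∈
  ... | _ , y∈ , refl = Vec.there (∈-elements⁻ p y∈)
  ∈-elements⁻ (false ∷ p) x∈ with ∈-map⁻ suc x∈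
  ... | _ , y∈ , refl = Vec.there (∈-elements⁻ p y∈)

  elements-unique : (p : Subset n) → ListU.Unique (elements p)
  elements-unique [] = []
  elements-unique (true ∷ p) = All.map⁺ (All.universal (λ _ ()) _) ∷ ListU.map⁺ 𝔽.suc-injective (elements-unique p)
  elements-unique (false ∷ p) = ListU.map⁺ 𝔽.suc-injective (elements-unique p)

  card-≤-surj : {p : Subset m} {q : Subset n} (f : Fin m → Fin n) →
    (∀ {y} → y ∈ q → ∃ λ x → x ∈ p × f x ≡ y) → ∣ q ∣ ≤ ∣ p ∣
  card-≤-surj {p = p} {q} f onto = subst₂ _≤_ (length-elements q)
    (trans (𝕃.length-map f (elements p)) (length-elements p))
    (length-⊆ (elements-unique q) λ y∈ → let x , x∈ , eq = onto (∈-elements⁻ q y∈) in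
      subst (_∈ˡ map f (elements p)) eq (∈-map⁺ f (∈-elements⁺ x∈)))

  card-≤-inj : {p : Subset m} {q : Subset n} (f : Fin m → Fin n) → (∀ {x y} → f x ≡ f y → x ≡ y) →
    (∀ {x} → x ∈ p → f x ∈ q) → ∣ p ∣ ≤ ∣ q ∣
  card-≤-inj {p = p} {q} f inj into = subst₂ _≤_
    (trans (𝕃.length-map f (elements p)) (length-elements p)) (length-elements q)
    (length-⊆ (ListU.map⁺ inj (elements-unique p)) λ y∈ → let x , x∈ , eq = ∈-map⁻ f y∈ in
      subst (_∈ˡ elements q) (sym eq) (∈-elements⁺ (into (∈-elements⁻ p x∈))))

  card-split : (p q : Subset n) → ∣ p ∣ ≡ ∣ p ∩ q ∣ + ∣ p ─ q ∣
  card-split [] [] = refl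
  card-split (true ∷ p) (true ∷ q) = cong suc (card-split p q)
  card-split (true ∷ p) (false ∷ q) = trans (cong suc (card-split p q)) (sym (ℕ.+-suc _ _))
  card-split (false ∷ p) (true ∷ q) = card-split p q
  card-split (false ∷ p) (false ∷ q) = card-split p q

  card-disjoint-∪ : (p q : Subset n) → (∀ {x} → x ∈ p → x ∈ q → ⊥) → ∣ p ∪ q ∣ ≡ ∣ p ∣ + ∣ q ∣
  card-disjoint-∪ [] [] _ = refl
  card-disjoint-∪ (true ∷ p) (true ∷ q) dis = ⊥-elim (dis Vec.here Vec.here)
  card-disjoint-∪ (true ∷ p) (false ∷ q) dis = cong suc (card-disjoint-∪ p q λ x∈ y∈ → dis (Vec.there x∈) (Vec.there y∈))
  card-disjoint-∪ (false ∷ p) (true ∷ q) dis = trans (cong suc (card-disjoint-∪ p q λ x∈ y∈ → dis (Vec.there x∈) (Vec.there y∈))) (sym (ℕ.+-suc _ _))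
  card-disjoint-∪ (false ∷ p) (false ∷ q) dis = card-disjoint-∪ p q λ x∈ y∈ → dis (Vec.there x∈) (Vec.there y∈)

  x∈p─q⁻ : ∀ {x} (p q : Subset n) → x ∈ p ─ q → x ∈ p × x ∉ q
  x∈p─q⁻ p q x∈ = 𝕊.p─q⊆p p q x∈ , not-in p q x∈
    where
    not-in : ∀ {n x} (p q : Subset n) → x ∈ p ─ q → x ∉ q
    not-in (_ ∷ p) (false ∷ q) (Vec.there x∈) (Vec.there x∈q) = not-in p q x∈ x∈q
    not-in (_ ∷ p) (true ∷ q) (Vec.there x∈) (Vec.there x∈q) = not-in p q x∈ x∈q

  card-─ : {p q : Subset n} → q ⊆ p → ∣ p ∣ ≡ ∣ q ∣ + ∣ p ─ q ∣
  card-─ {p = p} {q} q⊆p = trans (card-split p q) (cong (λ s → ∣ s ∣ + ∣ p ─ q ∣)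
    (𝕊.⊆-antisym (𝕊.p∩q⊆q p q) λ x∈ → 𝕊.x∈p∩q⁺ (q⊆p x∈ , x∈)))

  ⊆-card-≥ : {p q : Subset n} → p ⊆ q → ∣ q ∣ ≤ ∣ p ∣ → q ⊆ p
  ⊆-card-≥ {p = p} p⊆q q≤p {x} x∈q with x 𝕊.∈? p
  ... | yes x∈p = x∈p
  ... | no x∉p = ⊥-elim (ℕ.<⇒≱ (𝕊.p⊂q⇒∣p∣<∣q∣ (p⊆q , x , x∈q , x∉p)) q≤p)

  card-pos : ∀ {x} {p : Subset n} → x ∈ p → 1 ≤ ∣ p ∣
  card-pos {x = x} {p} x∈ = subst (_≤ ∣ p ∣) (𝕊.∣⁅x⁆∣≡1 x)
    (𝕊.p⊆q⇒∣p∣≤∣q∣ λ y∈ → subst (_∈ p) (sym (𝕊.x∈⁅y⁆⇒x≡y x y∈)) x∈)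

  card-pos⁻ : ∀ {n} (p : Subset n) → 1 ≤ ∣ p ∣ → ∃ (_∈ p)
  card-pos⁻ {n} p 0<p with 𝕊.nonempty? p
  ... | yes ne = ne
  ... | no e = ⊥-elim (ℕ.<⇒≱ 0<p (ℕ.≤-reflexive (trans (cong ∣_∣ (𝕊.Empty-unique e)) (𝕊.∣⊥∣≡0 n))))

  ⟪_⟫ : {P : Fin n → Set} → Decidable P → Subset n
  ⟪ P? ⟫ = tabulate (does ∘ P?)

  ∈⟪⟫⁺ : {P : Fin n → Set} (P? : Decidable P) → ∀ {x} → P x → x ∈ ⟪ P? ⟫
  ∈⟪⟫⁺ P? {x} px = 𝕍.lookup⇒[]= x _ (trans (𝕍.lookup∘tabulate _ x) (yes-true (P? x)))
    where
    yes-true : (d : Dec _) → does d ≡ true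
    yes-true (yes _) = refl
    yes-true (no ¬p) = ⊥-elim (¬p px)

  ∈⟪⟫⁻ : {P : Fin n → Set} (P? : Decidable P) → ∀ {x} → x ∈ ⟪ P? ⟫ → P x
  ∈⟪⟫⁻ P? {x} x∈ = true-yes (P? x) (trans (sym (𝕍.lookup∘tabulate _ x)) (𝕍.[]=⇒lookup x∈))
    where
    true-yes : (d : Dec _) → does d ≡ true → _
    true-yes (yes p) _ = p
    true-yes (no _) ()

  ∈⋂⁺ : ∀ {x} (ps : List (Subset n)) → (∀ {p} → p ∈ˡ ps → x ∈ p) → x ∈ ⋂ ps
  ∈⋂⁺ [] _ = 𝕊.∈⊤
  ∈⋂⁺ (p ∷ ps) h = 𝕊.x∈p∩q⁺ (h (here refl) , ∈⋂⁺ ps (h ∘ there))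

  ∈⋂⁻ : ∀ {x} (ps : List (Subset n)) → x ∈ ⋂ ps → ∀ {p} → p ∈ˡ ps → x ∈ p
  ∈⋂⁻ (q ∷ ps) x∈ (here refl) = 𝕊.p∩q⊆p q (⋂ ps) x∈
  ∈⋂⁻ (q ∷ ps) x∈ (there p∈) = ∈⋂⁻ ps (𝕊.p∩q⊆q q (⋂ ps) x∈) p∈

  unique-↭ : {xs ys : List A} → xs ↭ ys → ListU.Unique xs → ListU.Unique ys
  unique-↭ refl u = u
  unique-↭ (prep x p) (x∉ ∷ u) = Perm.All-resp-↭ p x∉ ∷ unique-↭ p u
  unique-↭ (swap x y p) ((x≢y ∷ x∉) ∷ y∉ ∷ u) =
    ((x≢y ∘ sym) ∷ Perm.All-resp-↭ p y∉) ∷ Perm.All-resp-↭ p x∉ ∷ unique-↭ p u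
  unique-↭ (_↭_.trans p q) u = unique-↭ q (unique-↭ p u)

  unique-++⁻ : (xs : List A) {ys : List A} → ListU.Unique (xs ++ ys) → ListU.Unique xs × ListU.Unique ys
  unique-++⁻ [] u = [] , u
  unique-++⁻ (x ∷ xs) (x∉ ∷ u) = (All.++⁻ˡ xs x∉ ∷ proj₁ (unique-++⁻ xs u)) , proj₂ (unique-++⁻ xs u)

  ∈-extract : ∀ {x : A} {xs} → x ∈ˡ xs → ∃ λ ys → xs ↭ x ∷ ys
  ∈-extract x∈ with ∈-∃++ x∈
  ... | as , bs , refl = as ++ bs , Perm.shift _ as bs

  -- Homogeneous subfamilies

  -- With `suc u` undecided sets there are `suc u * (r * (t * r))` colours. A family of more than
  -- `κ r t (suc u) * B` members therefore keeps more than `B` of them after pruning, or has a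
  -- colour class of more than `κ r t u * B` deleted ones.
  κ : ℕ → ℕ → ℕ → ℕ
  κ r t zero = 1
  κ r t (suc u) = 1 + suc u * (r * (t * r)) * κ r t u

  module Homogeneous {X : Set} {r n : ℕ} (e : X → Fin r → Fin n) (t : ℕ) (H : List X) where

    Agree : X → X → Subset r → Set
    Agree f g I = ∀ i → i ∈ I → e f i ≡ e g i

    -- The entry of `g` is compared with every entry `j` of the members of `W`, not only with the
    -- one at position `i`: avoiding hits must control the intersections of the underlying vertex
    -- sets.
    Hit : Vec X t → X → Subset r → Set
    Hit W g I = ∃ λ i → i ∉ I × ∃ λ m → ∃ λ j → e g i ≡ e (lookup W m) j

    -- The witness is taken from `𝓕`, but `W` ranges over the whole family `H`. Robustness in a
    -- small subfamily thus still gives kernels relative to `H`.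
    Robust : List X → X → Subset r → Set
    Robust 𝓕 f I = (W : Vec X t) → VAll.All (_∈ˡ H) W → ∃ λ g → g ∈ˡ 𝓕 × Agree f g I × ¬ Hit W g I

    -- Equivalently, no two members of `𝓕` agree on exactly the positions of `I`.
    Excluded : List X → Subset r → Set
    Excluded 𝓕 I = ∀ {f g} → f ∈ˡ 𝓕 → g ∈ˡ 𝓕 → Agree f g I → ∃ λ i → i ∉ I × e f i ≡ e g i

    agree? : ∀ f g I → Dec (Agree f g I)
    agree? f g I = 𝔽.all? λ i → (i 𝕊.∈? I) →-dec (e f i 𝔽.≟ e g i)

    hit? : ∀ W g I → Dec (Hit W g I)
    hit? W g I = 𝔽.any? λ i → ¬? (i 𝕊.∈? I) ×-dec (𝔽.any? λ m → 𝔽.any? λ j → e g i 𝔽.≟ e (lookup W m) j)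

    Obstructs : List X → X → Subset r → Vec X t → Set
    Obstructs 𝓕 f I W = All (λ g → Agree f g I → Hit W g I) 𝓕

    robust-or-obstructed : ∀ 𝓕 f I → Robust 𝓕 f I ⊎ ∃ (Obstructs 𝓕 f I)
    robust-or-obstructed 𝓕 f I
      with Any.any? (λ W → All.all? (λ g → agree? f g I →-dec hit? W g I) 𝓕) (vecs H t)
    ... | yes p = inj₂ (proj₁ (List∈.find p) , proj₂ (proj₂ (List∈.find p)))
    ... | no ¬p = inj₁ λ W W∈ → witness W (λ obs → ¬p (List∈.lose (vecs-complete W W∈) obs))
      where
      witness : ∀ W → ¬ Obstructs 𝓕 f I W → ∃ λ g → g ∈ˡ 𝓕 × Agree f g I × ¬ Hit W g I
      witness W ¬obs with Any.any? (λ g → agree? f g I ×-dec ¬? (hit? W g I)) 𝓕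
      ... | yes q = List∈.find q
      ... | no ¬q = ⊥-elim (¬obs (All.tabulate λ {g} g∈ ag → cover g g∈ ag))
        where
        cover : ∀ g → g ∈ˡ 𝓕 → Agree f g I → Hit W g I
        cover g g∈ ag with hit? W g I
        ... | yes h = h
        ... | no ¬h = ⊥-elim (¬q (List∈.lose g∈ (ag , ¬h)))

    -- A set `I` with the location of a hit: entry `i` of the coloured member equals entry `j` of
    -- the `m`-th obstructing member. Members of one colour that refer to the same obstruction share
    -- their entry at `i`.
    Colour : Set
    Colour = Subset r × Fin r × Fin t × Fin r

    _≟ᶜ_ : (c d : Colour) → Dec (c ≡ d)
    _≟ᶜ_ = Product.≡-dec (𝕍.≡-dec 𝔹._≟_) (Product.≡-dec 𝔽._≟_ (Product.≡-dec 𝔽._≟_ 𝔽._≟_))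

    Separating : List (X × Colour) → Set
    Separating cs = ∀ {f g c} → (f , c) ∈ˡ cs → (g , c) ∈ˡ cs → Agree f g (proj₁ c) →
      ∃ λ i → i ∉ proj₁ c × e f i ≡ e g i

    record Deletion (U : List (Subset r)) (𝓕 : List X) : Set where
      field
        rest       : List X
        deleted    : List (X × Colour)
        partition  : 𝓕 ↭ rest ++ map proj₁ deleted
        robust     : ∀ {f I} → f ∈ˡ rest → I ∈ˡ U → Robust rest f I
        separating : Separating deleted
        colours∈   : ∀ {f c} → (f , c) ∈ˡ deleted → proj₁ c ∈ˡ U

    -- Members deleted later on account of the same `I` were coloured through other obstructions.
    -- Those agreeing with `f` on `I` belonged to the family obstructed by `W`, so they hit `W` and
    -- can be recoloured through it. After this the whole agreement class of `f` on `I` refers to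
    -- one obstruction, as `Separating` requires.
    module Recolour (f : X) (I : Subset r) (W : Vec X t) where

      recolour : X × Colour → X × Colour
      recolour (g , c) with 𝕍.≡-dec 𝔹._≟_ (proj₁ c) I | agree? f g I | hit? W g I
      ... | yes _ | yes _ | yes (i , _ , m , j , _) = g , I , i , m , j
      ... | _ | _ | _ = g , c

      proj₁-recolour : ∀ x → proj₁ (recolour x) ≡ proj₁ x
      proj₁-recolour (g , c) with 𝕍.≡-dec 𝔹._≟_ (proj₁ c) I | agree? f g I | hit? W g I
      ... | yes _ | yes _ | yes _ = refl
      ... | yes _ | yes _ | no _ = refl
      ... | yes _ | no _ | _ = refl
      ... | no _ | _ | _ = refl

      data View (cs : List (X × Colour)) (g : X) (c : Colour) : Set where
        new : ∀ {i m j} → c ≡ (I , i , m , j) → i ∉ I → e g i ≡ e (lookup W m) j → Agree f g I → View cs g c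
        old : (g , c) ∈ˡ cs → (proj₁ c ≡ I → ¬ Agree f g I) → View cs g c

      view : ∀ cs → All (λ x → Agree f (proj₁ x) I → Hit W (proj₁ x) I) cs →
        ∀ {g c} → (g , c) ∈ˡ map recolour cs → View cs g c
      view cs obs x∈ with ∈-map⁻ recolour x∈
      ... | (g , c) , y∈ , eq with 𝕍.≡-dec 𝔹._≟_ (proj₁ c) I | agree? f g I | hit? W g I | eq
      ... | yes _ | yes ag | yes (i , i∉ , m , j , h) | refl = new refl i∉ h ag
      ... | yes _ | yes ag | no ¬h | refl = ⊥-elim (¬h (All.lookup obs y∈ ag))
      ... | yes _ | no ¬ag | _ | refl = old y∈ λ _ → ¬ag
      ... | no c≢ | _ | _ | refl = old y∈ λ c≡ _ → c≢ c≡

    -- Greedy pruning. Deleting a member can destroy the robustness of others, so the test is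
    -- repeated on the remaining family; `k` is its length and drives the recursion.
    deletion : ∀ U k 𝓕 → length 𝓕 ≡ k → Deletion U 𝓕
    deletion U k 𝓕 len with All.decide (λ f → All.decide (robust-or-obstructed 𝓕 f) U) 𝓕
    ... | inj₁ all = record
      { rest = 𝓕 ; deleted = [] ; partition = ↭-sym (Perm.++-identityʳ 𝓕)
      ; robust = λ f∈ I∈ → All.lookup (All.lookup all f∈) I∈ ; separating = λ () ; colours∈ = λ () }
    deletion U zero [] len | inj₂ ()
    deletion U (suc k) 𝓕 len | inj₂ some with List∈.find some
    ... | f , f∈ , some′ with List∈.find some′ | ∈-extract f∈
    ... | I , I∈ , W , obs | 𝓕′ , 𝓕↭ = record
      { rest = D.rest
      ; deleted = (f , I , proj₁ hitf , proj₁ (proj₂ (proj₂ hitf)) , proj₁ (proj₂ (proj₂ (proj₂ hitf)))) ∷ map recolour D.deleted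
      ; partition = _↭_.trans 𝓕↭ (_↭_.trans (prep f D.partition) (_↭_.trans (↭-sym (Perm.shift f D.rest _))
          (subst (λ zs → D.rest ++ f ∷ map proj₁ D.deleted ↭ D.rest ++ f ∷ zs) same refl)))
      ; robust = D.robust
      ; separating = λ p q → separate (split p) (split q)
      ; colours∈ = λ p → colour (split p)
      }
      where
      open Recolour f I W
      module D = Deletion (deletion U k 𝓕′ (ℕ.suc-injective (trans (sym (Perm.↭-length 𝓕↭)) len)))
      obs′ : All (λ g → Agree f g I → Hit W g I) (f ∷ 𝓕′)
      obs′ = Perm.All-resp-↭ 𝓕↭ obs
      hitf = All.head obs′ (λ _ _ → refl)
      same : map proj₁ D.deleted ≡ map proj₁ (map recolour D.deleted)
      same = trans (𝕃.map-cong (λ x → sym (proj₁-recolour x)) D.deleted) (𝕃.map-∘ D.deleted)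
      obs-deleted : All (λ x → Agree f (proj₁ x) I → Hit W (proj₁ x) I) D.deleted
      obs-deleted = All.map⁻ (All.++⁻ʳ D.rest (Perm.All-resp-↭ D.partition (All.tail obs′)))
      split : ∀ {g c} → (g , c) ∈ˡ _ ∷ map recolour D.deleted → View D.deleted g c
      split (here refl) = new refl (proj₁ (proj₂ hitf)) (proj₂ (proj₂ (proj₂ (proj₂ hitf)))) (λ _ _ → refl)
      split (there p) = view D.deleted obs-deleted p
      separate : ∀ {g h c} → View D.deleted g c → View D.deleted h c → Agree g h (proj₁ c) →
        ∃ λ i → i ∉ proj₁ c × e g i ≡ e h i
      separate (new refl i∉ p _) (new refl _ q _) _ = _ , i∉ , trans p (sym q)
      -- Agreement on `I` is transitive, so a member outside the class of `f` cannot agree with one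
      -- inside it.
      separate (new refl _ _ ag) (old _ ¬ag) ag′ = ⊥-elim (¬ag refl λ i i∈ → trans (ag i i∈) (ag′ i i∈))
      separate (old _ ¬ag) (new refl _ _ ag) ag′ = ⊥-elim (¬ag refl λ i i∈ → trans (ag i i∈) (sym (ag′ i i∈)))
      separate (old p _) (old q _) ag = D.separating p q ag
      colour : ∀ {g c} → View D.deleted g c → proj₁ c ∈ˡ U
      colour (new refl _ _ _) = I∈
      colour (old p _) = D.colours∈ p

    colours : List (Subset r) → List Colour
    colours U = cartesianProduct U (cartesianProduct (allFin r) (cartesianProduct (allFin t) (allFin r)))

    ∈-colours : ∀ {U} (c : Colour) → proj₁ c ∈ˡ U → c ∈ˡ colours U
    ∈-colours (I , i , m , j) I∈ =
      ∈-cartesianProduct⁺ I∈ (∈-cartesianProduct⁺ (∈-allFin i) (∈-cartesianProduct⁺ (∈-allFin m) (∈-allFin j)))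

    length-colours : ∀ U → length (colours U) ≡ length U * (r * (t * r))
    length-colours U = trans (length-product U _) (cong (length U *_)
      (trans (length-product (allFin r) _) (cong₂ _*_ (length-allFin r)
        (trans (length-product (allFin t) (allFin r)) (cong₂ _*_ (length-allFin t) (length-allFin r))))))
      where
      length-product : (xs : List A) (ys : List B) → length (cartesianProduct xs ys) ≡ length xs * length ys
      length-product = length-cartesianProductWith _,_
      length-allFin : ∀ k → length (allFin k) ≡ k
      length-allFin k = 𝕃.length-tabulate id

    -- The subfamily is the largest that pigeonhole offers, a single colour class of the deleted
    -- members; `separating` says that such a class excludes the set `I` of its colour.
    popular : ∀ {U 𝓕} (D : Deletion U 𝓕) k → ListU.Unique 𝓕 →
      length U * (r * (t * r)) * k < length (Deletion.deleted D) →
      ∃ λ I → I ∈ˡ U × ∃ λ 𝓖 → (∀ {f} → f ∈ˡ 𝓖 → f ∈ˡ 𝓕) × ListU.Unique 𝓖 × k < length 𝓖 × Excluded 𝓖 I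
    popular {U} {𝓕} D k uniq big with pigeonhole _≟ᶜ_ proj₂ (colours U) (Deletion.deleted D) k
      (λ x∈ → ∈-colours _ (Deletion.colours∈ D x∈)) (subst (λ l → l * k < _) (sym (length-colours U)) big)
    ... | c , c∈ , large = proj₁ c , c∈U , map proj₁ class , class⊆ , class-unique
        , subst (k <_) (sym (𝕃.length-map proj₁ class)) large , λ p q → excl p q
      where
      open Deletion D
      class = filter (λ x → proj₂ x ≟ᶜ c) deleted
      c∈U : proj₁ c ∈ˡ U
      c∈U = proj₁ (∈-cartesianProduct⁻ U _ c∈)
      class-unique : ListU.Unique (map proj₁ class)
      class-unique = AllPairs.map⁺ (AllPairs.filter⁺ (λ x → proj₂ x ≟ᶜ c)
        (AllPairs.map⁻ (proj₂ (unique-++⁻ rest (unique-↭ partition uniq)))))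
      member : ∀ {f} → f ∈ˡ map proj₁ class → (f , c) ∈ˡ deleted
      member f∈ with ∈-map⁻ proj₁ f∈
      ... | (f , d) , y∈ , refl with ∈-filter⁻ (λ x → proj₂ x ≟ᶜ c) y∈
      ... | z∈ , refl = z∈
      class⊆ : ∀ {f} → f ∈ˡ map proj₁ class → f ∈ˡ 𝓕
      class⊆ f∈ = Perm.∈-resp-↭ (↭-sym partition) (∈-++⁺ʳ rest (∈-map⁺ proj₁ (member f∈)))
      excl : Excluded (map proj₁ class) (proj₁ c)
      excl f∈ g∈ = separating (member f∈) (member g∈)

    length-deletion : ∀ {U 𝓕} (D : Deletion U 𝓕) →
      length 𝓕 ≡ length (Deletion.rest D) + length (Deletion.deleted D)
    length-deletion D = trans (Perm.↭-length partition) (trans (𝕃.length-++ rest) (cong (length rest +_) (𝕃.length-map proj₁ deleted)))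
      where open Deletion D

    -- Every undecided I either becomes robust or, on a positive proportion of 𝓕, excluded; each
    -- round that fails to terminate decides one more I for good, as exclusion passes to subfamilies.
    homogenise : ∀ B u U 𝓕 → length U ≡ u → ListU.Unique 𝓕 → (∀ I → I ∈ˡ U ⊎ Excluded 𝓕 I) →
      κ r t u * B < length 𝓕 →
      ∃ λ 𝓡 → (∀ {f} → f ∈ˡ 𝓡 → f ∈ˡ 𝓕) × ListU.Unique 𝓡 × B < length 𝓡 ×
        (∀ I → (∀ {f} → f ∈ˡ 𝓡 → Robust 𝓡 f I) ⊎ Excluded 𝓡 I)
    decided-step : ∀ {U U′ 𝓕 𝓖 I} → U ↭ I ∷ U′ → (∀ {f} → f ∈ˡ 𝓖 → f ∈ˡ 𝓕) → Excluded 𝓖 I →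
      (∀ J → J ∈ˡ U ⊎ Excluded 𝓕 J) → ∀ J → J ∈ˡ U′ ⊎ Excluded 𝓖 J
    decided-step U↭ 𝓖⊆ excl decided J with decided J
    ... | inj₂ ex = inj₂ λ f∈ g∈ → ex (𝓖⊆ f∈) (𝓖⊆ g∈)
    ... | inj₁ J∈ with Perm.∈-resp-↭ U↭ J∈
    ... | here refl = inj₂ excl
    ... | there J∈′ = inj₁ J∈′

    open ℕ.≤-Reasoning

    refine : ∀ B u U 𝓕 → length U ≡ u → ListU.Unique 𝓕 → (∀ I → I ∈ˡ U ⊎ Excluded 𝓕 I) →
      κ r t u * B < length 𝓕 → (D : Deletion U 𝓕) → length (Deletion.rest D) ≤ B →
      ∃ λ 𝓡 → (∀ {f} → f ∈ˡ 𝓡 → f ∈ˡ 𝓕) × ListU.Unique 𝓡 × B < length 𝓡 ×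
        (∀ I → (∀ {f} → f ∈ˡ 𝓡 → Robust 𝓡 f I) ⊎ Excluded 𝓡 I)

    homogenise B u U 𝓕 len uniq decided big with deletion U (length 𝓕) 𝓕 refl
    ... | D with suc B ℕ.≤? length (Deletion.rest D)
    ... | no small = refine B u U 𝓕 len uniq decided big D (ℕ.≮⇒≥ small)
    ... | yes large = rest , rest⊆ , proj₁ (unique-++⁻ rest (unique-↭ partition uniq)) , large , λ I → decide (decided I)
      where
      open Deletion D
      rest⊆ : ∀ {f} → f ∈ˡ rest → f ∈ˡ 𝓕
      rest⊆ f∈ = Perm.∈-resp-↭ (↭-sym partition) (∈-++⁺ˡ f∈)
      decide : ∀ {I} → I ∈ˡ U ⊎ Excluded 𝓕 I → (∀ {f} → f ∈ˡ rest → Robust rest f I) ⊎ Excluded rest I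
      decide (inj₁ I∈) = inj₁ λ f∈ → robust f∈ I∈
      decide (inj₂ ex) = inj₂ λ f∈ g∈ → ex (rest⊆ f∈) (rest⊆ g∈)

    -- Fewer members survive than there were, so something was deleted; but an empty `U` supplies no
    -- colours for it.
    refine B zero [] 𝓕 len uniq decided big D small with popular D 0 uniq
      (ℕ.+-cancelˡ-< B _ _ (begin-strict
        B + 0                                                  <⟨ big ⟩
        length 𝓕                                               ≡⟨ length-deletion D ⟩
        length (Deletion.rest D) + length (Deletion.deleted D) ≤⟨ ℕ.+-monoˡ-≤ _ small ⟩
        B + length (Deletion.deleted D)                        ∎))
    ... | _ , () , _
    refine B (suc u) U 𝓕 len uniq decided big D small with popular D (κ r t u * B) uniq
      (ℕ.+-cancelˡ-< B _ _ (begin-strict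
        B + length U * (r * (t * r)) * (κ r t u * B) ≡⟨ cong (λ l → B + l * (r * (t * r)) * (κ r t u * B)) len ⟩
        B + suc u * (r * (t * r)) * (κ r t u * B)    ≡⟨ cong (B +_) (ℕ.*-assoc (suc u * (r * (t * r))) (κ r t u) B) ⟨
        κ r t (suc u) * B                            <⟨ big ⟩
        length 𝓕                                 ≡⟨ length-deletion D ⟩
        length (Deletion.rest D) + length (Deletion.deleted D) ≤⟨ ℕ.+-monoˡ-≤ _ small ⟩
        B + length (Deletion.deleted D) ∎))
    ... | I , I∈ , 𝓖 , 𝓖⊆ , 𝓖-unique , 𝓖-big , excl with ∈-extract I∈
    ... | U′ , U↭ with homogenise B u U′ 𝓖 (ℕ.suc-injective (trans (sym (Perm.↭-length U↭)) len)) 𝓖-unique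
                         (decided-step U↭ 𝓖⊆ excl decided) 𝓖-big
    ... | 𝓡 , 𝓡⊆ , rest = 𝓡 , 𝓖⊆ ∘ 𝓡⊆ , rest

  -- Rank and closure of robust position sets

  module Flats {r : ℕ} (Flat : Subset r → Set) (flat? : Decidable Flat) (flat-⊤ : Flat Subset.⊤)
    (flat-∩ : ∀ {I J} → Flat I → Flat J → Flat (I ∩ J))
    (ℓ d s : ℕ) (r≡ : r ≡ ℓ + s * d) (2≤s : 2 ≤ s)
    (size : ∀ {I} → Flat I → ∃ λ k → ∣ I ∣ ≡ ℓ + k * d)
    (cover : ∀ {k} → k < s → (T : Vec (Fin r) k) → ∃ λ I → Flat I × (∀ j → lookup T j ∈ I) × ∣ I ∣ < r)
    where

    private
      over? : ∀ {k} (T : Vec (Fin r) k) I → Dec (Flat I × (∀ j → lookup T j ∈ I))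
      over? T I = flat? I ×-dec 𝔽.all? λ j → lookup T j 𝕊.∈? I

    closure : ∀ {k} → Vec (Fin r) k → Subset r
    closure T = ⋂ (filter (over? T) (subsets r))

    closure-flat : ∀ {k} (T : Vec (Fin r) k) → Flat (closure T)
    closure-flat T = flat-⋂ (filter (over? T) (subsets r)) λ I∈ → proj₁ (proj₂ (∈-filter⁻ (over? T) {xs = subsets r} I∈))
      where
      flat-⋂ : ∀ Is → (∀ {I} → I ∈ˡ Is → Flat I) → Flat (⋂ Is)
      flat-⋂ [] _ = flat-⊤
      flat-⋂ (I ∷ Is) h = flat-∩ (h (here refl)) (flat-⋂ Is (h ∘ there))

    ⊆-closure : ∀ {k} (T : Vec (Fin r) k) j → lookup T j ∈ closure T
    ⊆-closure T j = ∈⋂⁺ _ λ I∈ → proj₂ (proj₂ (∈-filter⁻ (over? T) {xs = subsets r} I∈)) j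

    closure-least : ∀ {k} (T : Vec (Fin r) k) {I} → Flat I → (∀ j → lookup T j ∈ I) → closure T ⊆ I
    closure-least T {I} fl T⊆I x∈ = ∈⋂⁻ _ x∈ (∈-filter⁺ (over? T) (subsets-complete I) (fl , T⊆I))

    closure-∷ : ∀ {k} x (T : Vec (Fin r) k) → closure T ⊆ closure (x ∷ T)
    closure-∷ x T = closure-least T (closure-flat (x ∷ T)) λ j → ⊆-closure (x ∷ T) (suc j)

    -- A strictly larger flat has at least the next size of the progression, so a point outside the
    -- closure costs a full step `d`.
    closure-grows : ∀ {k} x (T : Vec (Fin r) k) → x ∉ closure T → ∀ i →
      ℓ + i * d ≤ ∣ closure T ∣ → ℓ + suc i * d ≤ ∣ closure (x ∷ T) ∣
    closure-grows x T x∉ i big with size (closure-flat (x ∷ T))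
    ... | k , eq = subst (ℓ + suc i * d ≤_) (sym eq) (ℕ.+-monoʳ-≤ ℓ (ℕ.*-monoˡ-≤ d (ℕ.*-cancelʳ-< d i k
      (ℕ.+-cancelˡ-< ℓ _ _ (subst (ℓ + i * d <_) eq (ℕ.≤-<-trans big
        (𝕊.p⊂q⇒∣p∣<∣q∣ (closure-∷ x T , x , ⊆-closure (x ∷ T) zero , x∉))))))))

    -- If the closure of T were larger than its rank allows, adding points one at a time would reach the
    -- whole of r before s points are used, against the covering hypothesis.
    closure-small : ∀ j {c} (T : Vec (Fin r) c) i → i + j ≡ s → c < i → ¬ (ℓ + i * d ≤ ∣ closure T ∣)
    closure-small j {c} T i i+j≡s c<i big
      with cover (ℕ.<-≤-trans c<i (subst (i ≤_) i+j≡s (ℕ.m≤m+n i j))) T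
    ... | I , fl , T⊆I , I<r with ℕ.≤-<-trans (𝕊.p⊆q⇒∣p∣≤∣q∣ (closure-least T fl T⊆I)) I<r
    closure-small zero T i i+j≡s c<i big | _ | proper =
      ℕ.<⇒≱ proper (subst (_≤ ∣ closure T ∣) (sym (trans r≡ (cong (λ z → ℓ + z * d) (trans (sym i+j≡s) (ℕ.+-identityʳ i))))) big)
    closure-small (suc j) T i i+j≡s c<i big | _ | proper with 𝔽.all? (λ x → x 𝕊.∈? closure T)
    ... | yes all = ℕ.<⇒≱ proper (subst (_≤ ∣ closure T ∣) (𝕊.∣⊤∣≡n r) (𝕊.p⊆q⇒∣p∣≤∣q∣ {p = Subset.⊤} λ {x} _ → all x))
    ... | no ¬all with 𝔽.¬∀⟶∃¬ r _ (λ x → x 𝕊.∈? closure T) ¬all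
    ... | x , x∉ = closure-small j (x ∷ T) (suc i) (trans (sym (ℕ.+-suc i j)) i+j≡s) (s≤s c<i) (closure-grows x T x∉ i big)

    core : Subset r
    core = closure []

    private
      -- A larger admissible size would put the closure a full step ahead of its number of points,
      -- which `closure-small` forbids.
      rank-exact : ∀ {c} (T : Vec (Fin r) c) → c < s → ℓ + c * d ≤ ∣ closure T ∣ → ∣ closure T ∣ ≡ ℓ + c * d
      rank-exact {c} T c<s big with size (closure-flat T)
      ... | k , eq with k ℕ.≤? c
      ... | yes k≤c = ℕ.≤-antisym (subst (_≤ ℓ + c * d) (sym eq) (ℕ.+-monoʳ-≤ ℓ (ℕ.*-monoˡ-≤ d k≤c))) big
      ... | no k≰c = ⊥-elim (closure-small (s ∸ suc c) T (suc c) (ℕ.m+[n∸m]≡n c<s) ℕ.≤-refl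
        (subst (ℓ + suc c * d ≤_) (sym eq) (ℕ.+-monoʳ-≤ ℓ (ℕ.*-monoˡ-≤ d (ℕ.≰⇒> k≰c)))))

      ℓ≤closure : ∀ {c} (T : Vec (Fin r) c) → ℓ + 0 * d ≤ ∣ closure T ∣
      ℓ≤closure T with size (closure-flat T)
      ... | k , eq = subst (ℓ + 0 * d ≤_) (sym eq) (ℕ.+-monoʳ-≤ ℓ z≤n)

    ∣core∣ : ∣ core ∣ ≡ ℓ
    ∣core∣ = trans (rank-exact [] (ℕ.≤-trans (s≤s z≤n) 2≤s) (ℓ≤closure [])) (ℕ.+-identityʳ ℓ)

    ∣closure-singleton∣ : ∀ {x} → x ∉ core → ∣ closure (x ∷ []) ∣ ≡ ℓ + d
    ∣closure-singleton∣ {x} x∉ = trans (rank-exact (x ∷ []) 2≤s (closure-grows x [] x∉ 0 (ℓ≤closure [])))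
      (cong (ℓ +_) (ℕ.+-identityʳ d))

  -- Kernels and structured cliques

  -- Members are compared position by position along their increasing enumerations.
  RSubset : ℕ → ℕ → Set
  RSubset n r = ∃ λ (F : Subset n) → ∣ F ∣ ≡ r

  private variable
    r : ℕ

  lookup-injective : {xs : List A} → ListU.Unique xs → ∀ {i j} → List.lookup xs i ≡ List.lookup xs j → i ≡ j
  lookup-injective (x∉ ∷ u) {zero} {zero} eq = refl
  lookup-injective {xs = x ∷ xs} (x∉ ∷ u) {zero} {suc j} eq = ⊥-elim (All.lookup x∉ (∈-lookup {xs = xs} j) eq)
  lookup-injective {xs = x ∷ xs} (x∉ ∷ u) {suc i} {zero} eq = ⊥-elim (All.lookup x∉ (∈-lookup {xs = xs} i) (sym eq))
  lookup-injective (x∉ ∷ u) {suc i} {suc j} eq = cong suc (lookup-injective u eq)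

  abstract

    coord : RSubset n r → Fin r → Fin n
    coord (F , eq) i = List.lookup (elements F) (Fin.cast (sym (trans (length-elements F) eq)) i)

    coord-injective : (F : RSubset n r) → ∀ {i j} → coord F i ≡ coord F j → i ≡ j
    coord-injective (F , eq) p = cast-injective (sym (trans (length-elements F) eq)) (lookup-injective (elements-unique F) p)
      where
      cast-injective : ∀ {m n} (eq : m ≡ n) {i j : Fin m} → Fin.cast eq i ≡ Fin.cast eq j → i ≡ j
      cast-injective refl {i} {j} p = trans (sym (𝔽.cast-is-id refl i)) (trans p (𝔽.cast-is-id refl j))

    coord∈ : (F : RSubset n r) → ∀ i → coord F i ∈ proj₁ F
    coord∈ (F , eq) i = ∈-elements⁻ F (∈-lookup {xs = elements F} _)

    coord-onto : (F : RSubset n r) → ∀ {x} → x ∈ proj₁ F → ∃ λ i → coord F i ≡ x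
    coord-onto {r = r} (F , eq) x∈ = Fin.cast eq′ (Any.index (∈-elements⁺ x∈)) ,
      trans (cong (List.lookup (elements F)) (trans (𝔽.cast-trans eq′ (sym eq′) _) (𝔽.cast-is-id _ _)))
        (sym (Any.lookup-index (∈-elements⁺ x∈)))
      where
      eq′ : length (elements F) ≡ r
      eq′ = trans (length-elements F) eq

  coord-ext : (F G : RSubset n r) → (∀ i → coord F i ≡ coord G i) → F ≡ G
  coord-ext (F , p) (G , q) h with 𝕊.⊆-antisym {i = F} {j = G} (sub (F , p) (G , q) h) (sub (G , q) (F , p) (sym ∘ h))
    where
    sub : ∀ (F G : RSubset _ _) → (∀ i → coord F i ≡ coord G i) → proj₁ F ⊆ proj₁ G
    sub F G h x∈ with coord-onto F x∈
    ... | i , refl = subst (_∈ proj₁ G) (sym (h i)) (coord∈ G i)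
  ... | refl = cong (F ,_) (ℕ.≡-irrelevant p q)

  Image : RSubset n r → Subset r → Fin n → Set
  Image F I v = ∃ λ i → i ∈ I × coord F i ≡ v

  image? : (F : RSubset n r) (I : Subset r) → Decidable (Image F I)
  image? F I v = 𝔽.any? λ i → (i 𝕊.∈? I) ×-dec (coord F i 𝔽.≟ v)

  abstract

    image : RSubset n r → Subset r → Subset n
    image F I = ⟪ image? F I ⟫

    ∈-image⁺ : (F : RSubset n r) → ∀ {I i} → i ∈ I → coord F i ∈ image F I
    ∈-image⁺ F {I} i∈ = ∈⟪⟫⁺ (image? F I) (_ , i∈ , refl)

    ∈-image⁻ : (F : RSubset n r) → ∀ {I v} → v ∈ image F I → Image F I v
    ∈-image⁻ F {I} = ∈⟪⟫⁻ (image? F I)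

  ∣image∣ : (F : RSubset n r) (I : Subset r) → ∣ image F I ∣ ≡ ∣ I ∣
  ∣image∣ F I = ℕ.≤-antisym (card-≤-surj (coord F) (∈-image⁻ F)) (card-≤-inj (coord F) (coord-injective F) (∈-image⁺ F))

  image⊆ : (F : RSubset n r) (I : Subset r) → image F I ⊆ proj₁ F
  image⊆ F I v∈ with ∈-image⁻ F v∈
  ... | i , _ , refl = coord∈ F i

  module Structure {n r : ℕ} (t₀ : ℕ) (H : List (RSubset n r)) (ℓ d s : ℕ) (r≡ : r ≡ ℓ + s * d) (2≤s : 2 ≤ s)
    (intersecting : (Fs : Vec (Subset n) (suc (suc t₀))) → VecU.Unique Fs → VAll.All (_∈ˡ map proj₁ H) Fs →
      ∃ λ k → k < s × ∣ ⋂ (toList Fs) ∣ ≡ ℓ + k * d)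
    where

    t : ℕ
    t = suc (suc t₀)

    open Homogeneous coord t H

    Kernel : Subset n → Set
    Kernel K = ∀ W → length W ≤ t → All (_∈ˡ H) W → ∃ λ G → G ∈ˡ H × K ⊆ proj₁ G ×
      (∀ {F} → F ∈ˡ W → ∀ {x} → x ∈ proj₁ G → x ∈ proj₁ F → x ∈ K)

    Off : Subset n → RSubset n r → RSubset n r → Set
    Off K F G = ∀ x → x ∈ proj₁ F → x ∈ proj₁ G → x ∈ K

    -- A delta-system with kernel `K` whose members also avoid `F` outside `K`. `F` itself need not
    -- contain `K`, so that intersections of `K` with arbitrary members can be reached.
    record Star (F : RSubset n r) (K : Subset n) (k : ℕ) : Set where
      field
        members  : Vec (RSubset n r) k
        member∈  : VAll.All (_∈ˡ H) members
        contains : ∀ {x} → x ∈ K → VAll.All (λ G → x ∈ proj₁ G) members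
        off-F    : VAll.All (λ G → Off K F G) members
        off      : VAllPairs.AllPairs (Off K) members

    star : ∀ {F K} → F ∈ˡ H → Kernel K → ∀ k → k ≤ t → Star F K k
    star F∈ ker zero _ = record { members = [] ; member∈ = [] ; contains = λ _ → [] ; off-F = [] ; off = [] }
    star {F} {K} F∈ ker (suc k) k<t with star F∈ ker k (ℕ.<⇒≤ k<t)
    ... | S with ker (F ∷ toList (Star.members S))
        (subst (λ l → suc l ≤ t) (sym (𝕍.length-toList (Star.members S))) k<t) (F∈ ∷ VAll.toList⁺ (Star.member∈ S))
    ... | G , G∈ , K⊆G , avoid = record
      { members = G ∷ members ; member∈ = G∈ ∷ member∈ ; contains = λ x∈ → K⊆G x∈ ∷ contains x∈
      ; off-F = (λ x x∈F x∈G → avoid (here refl) x∈G x∈F) ∷ off-F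
      ; off = VAll.toList⁻ (All.tabulate λ F∈ x x∈G x∈F → avoid (there F∈) x∈G x∈F) ∷ off }
      where open Star S

    -- `F` and `suc t₀` members of a star are `t` sets with common intersection `F ∩ K`, because
    -- each star member contains `K` and meets `F` only inside it. Since `K` is smaller than a
    -- member, the `t` sets are distinct and the hypothesis on intersections applies.
    kernel-∩-member : ∀ {F K} → F ∈ˡ H → Kernel K → ∣ K ∣ < r → ∃ λ k → k < s × ∣ proj₁ F ∩ K ∣ ≡ ℓ + k * d
    kernel-∩-member {F} {K} F∈ ker K<r with star F∈ ker (suc t₀) (ℕ.n≤1+n _)
    ... | record { members = G ∷ Gs ; member∈ = G∈ ∷ Gs∈ ; contains = contains ; off-F = off-G ∷ off-Gs ; off = off } =
      subst (λ p → ∃ λ k → k < s × ∣ p ∣ ≡ ℓ + k * d) eq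
        (intersecting (proj₁ F ∷ Vec.map proj₁ members)
          (distinct-all members (off-G ∷ off-Gs) ∷ VAllPairs.map⁺ (VAllPairs.map (λ {F′} {G′} → distinct F′ G′) off))
          (∈-map⁺ proj₁ F∈ ∷ VAll.map⁺ (VAll.map (λ G∈ → ∈-map⁺ proj₁ G∈) (G∈ ∷ Gs∈))))
      where
      members = G ∷ Gs
      Fs = proj₁ F ∷ toList (Vec.map proj₁ members)
      distinct : ∀ F G → Off K F G → proj₁ F ≢ proj₁ G
      distinct F G h F≡G = ℕ.<⇒≱ K<r (subst (_≤ ∣ K ∣) (proj₂ F) (𝕊.p⊆q⇒∣p∣≤∣q∣ λ {x} x∈ → h x x∈ (subst (x ∈_) F≡G x∈)))
      distinct-all : ∀ {k} (Gs : Vec (RSubset n r) k) → VAll.All (Off K F) Gs → VAll.All (proj₁ F ≢_) (Vec.map proj₁ Gs)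
      distinct-all Gs all = VAll.map⁺ (VAll.map (λ {G} → distinct F G) all)
      eq : ⋂ (proj₁ F ∷ toList (Vec.map proj₁ members)) ≡ proj₁ F ∩ K
      eq = 𝕊.⊆-antisym
        (λ x∈ → let x∈F = ∈⋂⁻ Fs x∈ (here refl) in 𝕊.x∈p∩q⁺ (x∈F , off-G _ x∈F (∈⋂⁻ Fs x∈ (there (here refl)))))
        (λ x∈ → let x∈F , x∈K = 𝕊.x∈p∩q⁻ (proj₁ F) K x∈ in 𝕊.x∈p∩q⁺ (x∈F ,
          ∈⋂⁺ (toList (Vec.map proj₁ members)) (All.lookup (VAll.toList⁺ (VAll.map⁺ (contains x∈K))))))

    -- Take a member `F` containing `K`, and then `G` containing `J` and meeting `F` only inside
    -- `J`. As `K ⊆ F`, the sets `G ∩ K` and `J ∩ K` coincide, which reduces the claim to a member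
    -- and a kernel.
    kernel-∩-kernel : ∀ {J K} → Kernel J → Kernel K → ∣ K ∣ < r →
      ∃ λ k → k < s × ∣ J ∩ K ∣ ≡ ℓ + k * d
    kernel-∩-kernel {J} {K} kerJ kerK K<r with kerK [] z≤n []
    ... | F , F∈ , K⊆F , _ with kerJ (F ∷ []) (s≤s z≤n) (F∈ ∷ [])
    ... | G , G∈ , J⊆G , avoid = subst (λ p → ∃ λ k → k < s × ∣ p ∣ ≡ ℓ + k * d)
      (𝕊.⊆-antisym
        (λ x∈ → let x∈G , x∈K = 𝕊.x∈p∩q⁻ (proj₁ G) K x∈ in 𝕊.x∈p∩q⁺ (avoid (here refl) x∈G (K⊆F x∈K) , x∈K))
        (λ x∈ → let x∈J , x∈K = 𝕊.x∈p∩q⁻ J K x∈ in 𝕊.x∈p∩q⁺ (J⊆G x∈J , x∈K)))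
      (kernel-∩-member G∈ kerK K<r)

    kernel-size : ∀ {K} → Kernel K → ∣ K ∣ < r → ∃ λ k → k < s × ∣ K ∣ ≡ ℓ + k * d
    kernel-size {K} ker K<r = subst (λ p → ∃ λ k → k < s × ∣ p ∣ ≡ ℓ + k * d) (𝕊.∩-idem K) (kernel-∩-kernel ker ker K<r)

    Block : Subset n → Subset n → Fin n → Set
    Block A F x = ∃ λ K → x ∈ K × A ⊆ K × K ⊆ F × ∣ K ∣ ≡ ℓ + d × Kernel K

    record Structured (F : Subset n) : Set where
      field
        core        : Subset n
        core⊆       : core ⊆ F
        ∣core∣      : ∣ core ∣ ≡ ℓ
        core-kernel : Kernel core
        block       : ∀ {x} → x ∈ F → x ∉ core → Block core F x

    private
      -- Robustness speaks of exactly `t` members, kernels of at most `t`; repeating a member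
      -- bridges the two.
      pad : ∀ k → List (RSubset n r) → RSubset n r → Vec (RSubset n r) k
      pad zero W f = []
      pad (suc k) [] f = f ∷ pad k [] f
      pad (suc k) (F ∷ W) f = F ∷ pad k W f

      pad-all : ∀ {P : RSubset n r → Set} k {W f} → All P W → P f → VAll.All P (pad k W f)
      pad-all zero ps p = []
      pad-all (suc k) [] p = p ∷ pad-all k [] p
      pad-all (suc k) (q ∷ ps) p = q ∷ pad-all k ps p

      pad-lookup : ∀ k {W f F} → length W ≤ k → F ∈ˡ W → ∃ λ m → lookup (pad k W f) m ≡ F
      pad-lookup (suc k) (s≤s W≤k) (here refl) = zero , refl
      pad-lookup (suc k) (s≤s W≤k) (there F∈) with pad-lookup k W≤k F∈
      ... | m , eq = suc m , eq

    robust⇒kernel : ∀ {𝓡 f I} → (∀ {g} → g ∈ˡ 𝓡 → g ∈ˡ H) → f ∈ˡ 𝓡 → Robust 𝓡 f I → Kernel (image f I)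
    robust⇒kernel {𝓡} {f} {I} 𝓡⊆ f∈ rob W W≤t W∈ with rob (pad t W f) (pad-all t W∈ (𝓡⊆ f∈))
    ... | g , g∈ , agree , ¬hit = g , 𝓡⊆ g∈ , contains , avoid
      where
      contains : image f I ⊆ proj₁ g
      contains v∈ with ∈-image⁻ f v∈
      ... | i , i∈ , refl = subst (_∈ proj₁ g) (sym (agree i i∈)) (coord∈ g i)
      avoid : ∀ {F} → F ∈ˡ W → ∀ {x} → x ∈ proj₁ g → x ∈ proj₁ F → x ∈ image f I
      avoid {F} F∈ x∈g x∈F with coord-onto g x∈g
      ... | i , refl with i 𝕊.∈? I
      ... | yes i∈ = subst (_∈ image f I) (agree i i∈) (∈-image⁺ f i∈)
      ... | no i∉ with pad-lookup t W≤t F∈ | coord-onto F x∈F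
      ... | m , eqₘ | j , eqⱼ = ⊥-elim (¬hit (i , i∉ , m , j , trans (sym eqⱼ) (cong (λ G → coord G j) (sym eqₘ))))

    module Homogenised (𝓡 : List (RSubset n r)) (𝓡⊆ : ∀ {f} → f ∈ˡ 𝓡 → f ∈ˡ H) (uniq : ListU.Unique 𝓡)
      (1≤n : 1 ≤ n) (large : n ^ (s ∸ 1) < length 𝓡)
      (decided : ∀ I → (∀ {f} → f ∈ˡ 𝓡 → Robust 𝓡 f I) ⊎ Excluded 𝓡 I) where

      Flat : Subset r → Set
      Flat I = ∀ {f} → f ∈ˡ 𝓡 → Robust 𝓡 f I

      private
        member : ∃ (_∈ˡ 𝓡)
        member = nonempty-∈ 𝓡 (ℕ.≤-trans (s≤s z≤n) large)

        f₀ = proj₁ member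
        f₀∈ = proj₂ member

      flat? : Decidable Flat
      flat? I with decided I
      ... | inj₁ fl = yes fl
      -- Against `t` copies of `f₀`, robustness yields a member agreeing with `f₀` on exactly `I`,
      -- which exclusion rules out.
      ... | inj₂ ex = no λ fl → let g , g∈ , agree , ¬hit = fl f₀∈ (Vec.replicate t f₀) (replicate-all t)
                                    i , i∉ , eq = ex f₀∈ g∈ agree
                                in ¬hit (i , i∉ , zero , i , sym eq)
        where
        replicate-all : ∀ k → VAll.All (_∈ˡ H) (Vec.replicate k f₀)
        replicate-all zero = []
        replicate-all (suc k) = 𝓡⊆ f₀∈ ∷ replicate-all k

      flat-⊤ : Flat Subset.⊤
      flat-⊤ {f} f∈ W W∈ = f , f∈ , (λ _ _ → refl) , λ (i , i∉ , _) → i∉ 𝕊.∈⊤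

      -- Two moves: from `f` to some `g` agreeing with it on `I`, then from `g` to some `h` agreeing
      -- with `g` on `J`. A hit of `h` at a position of `J` outside `I` would already be a hit of
      -- `g`.
      flat-∩ : ∀ {I J} → Flat I → Flat J → Flat (I ∩ J)
      flat-∩ {I} {J} fI fJ f∈ W W∈ with fI f∈ W W∈
      ... | g , g∈ , agI , ¬hitI with fJ g∈ W W∈
      ... | h , h∈ , agJ , ¬hitJ = h , h∈ , agree , ¬hit
        where
        agree : Agree _ h (I ∩ J)
        agree i i∈ = let i∈I , i∈J = 𝕊.x∈p∩q⁻ I J i∈ in trans (agI i i∈I) (agJ i i∈J)
        ¬hit : ¬ Hit W h (I ∩ J)
        ¬hit (i , i∉ , m , j , eq) with i 𝕊.∈? J
        ... | no i∉J = ¬hitJ (i , i∉J , m , j , eq)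
        ... | yes i∈J = ¬hitI (i , (λ i∈I → i∉ (𝕊.x∈p∩q⁺ (i∈I , i∈J))) , m , j , trans (agJ i i∈J) eq)

      proper-size : ∀ {I} → Flat I → ∣ I ∣ < r → ∃ λ k → ∣ I ∣ ≡ ℓ + k * d
      proper-size {I} fl I<r =
        let k , _ , eq = kernel-size {image f₀ I} (robust⇒kernel {𝓡} {f₀} {I} 𝓡⊆ f₀∈ (fl {f₀} f₀∈))
                           (ℕ.≤-<-trans (ℕ.≤-reflexive (∣image∣ f₀ I)) I<r)
        in k , trans (sym (∣image∣ f₀ I)) eq

      size : ∀ {I} → Flat I → ∃ λ k → ∣ I ∣ ≡ ℓ + k * d
      size {I} fl = [ proper-size {I} fl , (λ r≤I → s , trans (ℕ.≤-antisym (𝕊.∣p∣≤n I) r≤I) r≡) ]′ (ℕ.<-≤-connex ∣ I ∣ r)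

      agreement : RSubset n r → RSubset n r → Subset r
      agreement f g = ⟪ (λ i → coord f i 𝔽.≟ coord g i) ⟫

      ∈-agreement⁺ : ∀ f g {i} → coord f i ≡ coord g i → i ∈ agreement f g
      ∈-agreement⁺ f g = ∈⟪⟫⁺ (λ i → coord f i 𝔽.≟ coord g i)

      ∈-agreement⁻ : ∀ f g {i} → i ∈ agreement f g → coord f i ≡ coord g i
      ∈-agreement⁻ f g = ∈⟪⟫⁻ (λ i → coord f i 𝔽.≟ coord g i)

      trace : ∀ {k} → Vec (Fin r) k → RSubset n r → Vec (Fin n) k
      trace T f = Vec.map (coord f) T

      ProperOver : ∀ {k} → Vec (Fin r) k → Subset r → Set
      ProperOver T I = Flat I × (∀ j → lookup T j ∈ I) × ∣ I ∣ < r

      properOver? : ∀ {k} (T : Vec (Fin r) k) → Decidable (ProperOver T)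
      properOver? T I = flat? I ×-dec (𝔽.all? λ j → lookup T j 𝕊.∈? I) ×-dec (suc ∣ I ∣ ℕ.≤? r)

      -- The agreement set of two members with equal traces contains the positions in `T`. It is
      -- realised exactly, so it cannot be excluded and must be flat; if no proper flat lies over
      -- `T`, it is everything.
      trace-injective : ∀ {k} (T : Vec (Fin r) k) → ¬ ∃ (ProperOver T) →
        ∀ {f g} → f ∈ˡ 𝓡 → g ∈ˡ 𝓡 → trace T f ≡ trace T g → f ≡ g
      trace-injective T none {f} {g} f∈ g∈ same = [ agree-everywhere , impossible ]′ (decided (agreement f g))
        where
        T⊆ : ∀ j → lookup T j ∈ agreement f g
        T⊆ j = ∈-agreement⁺ f g (trans (sym (𝕍.lookup-map j (coord f) T))
          (trans (cong (λ v → lookup v j) same) (𝕍.lookup-map j (coord g) T)))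
        impossible : Excluded 𝓡 (agreement f g) → f ≡ g
        impossible ex = let i , i∉ , eq = ex f∈ g∈ (λ i → ∈-agreement⁻ f g) in ⊥-elim (i∉ (∈-agreement⁺ f g eq))
        agree-everywhere : Flat (agreement f g) → f ≡ g
        agree-everywhere fl = coord-ext f g λ i → ∈-agreement⁻ f g (subst (i ∈_) (sym (𝕊.∣p∣≡n⇒p≡⊤ full)) 𝕊.∈⊤)
          where
          full : ∣ agreement f g ∣ ≡ r
          full = ℕ.≤-antisym (𝕊.∣p∣≤n (agreement f g)) (ℕ.≮⇒≥ λ E<r → none (agreement f g , fl , T⊆ , E<r))

      traces-unique : ∀ {k} (T : Vec (Fin r) k) → ¬ ∃ (ProperOver T) → ∀ xs → ListU.Unique xs →
        (∀ {f} → f ∈ˡ xs → f ∈ˡ 𝓡) → AllPairs.AllPairs (λ f g → trace T f ≢ trace T g) xs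
      traces-unique T none [] _ _ = []
      traces-unique T none (f ∷ xs) (f∉ ∷ u) sub =
        All.tabulate (λ g∈ eq → All.lookup f∉ g∈ (trace-injective T none (sub (here refl)) (sub (there g∈)) eq))
          ∷ traces-unique T none xs u (sub ∘ there)

      -- Otherwise a member would be determined by its vertices at `k < s` positions, and `𝓡` would
      -- have at most `n ^ (s ∸ 1)` members. The order of the exceptional term originates here.
      cover : ∀ {k} → k < s → (T : Vec (Fin r) k) → ∃ (ProperOver T)
      cover {k} k<s T = decidable-stable (𝕊.anySubset? (properOver? T)) λ none → ℕ.<⇒≱ large (begin
        length 𝓡                   ≡⟨ 𝕃.length-map (trace T) 𝓡 ⟨
        length (map (trace T) 𝓡)   ≤⟨ length-⊆ (AllPairs.map⁺ (traces-unique T none 𝓡 uniq λ f∈ → f∈))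
                                               (λ {v} _ → vecs-complete v (VAll.universal ∈-allFin v)) ⟩
        length (vecs (allFin n) k) ≡⟨ length-vecs (allFin n) k ⟩
        length (allFin n) ^ k      ≡⟨ cong (_^ k) (𝕃.length-tabulate {n = n} id) ⟩
        n ^ k                      ≤⟨ ℕ.^-monoʳ-≤ n {{Nat.>-nonZero 1≤n}} (ℕ.∸-monoˡ-≤ 1 k<s) ⟩
        n ^ (s ∸ 1)                ∎)
        where open ℕ.≤-Reasoning

      open Flats Flat flat? flat-⊤ flat-∩ ℓ d s r≡ 2≤s size cover

      image-mono : ∀ {I J} → I ⊆ J → image f₀ I ⊆ image f₀ J
      image-mono {I} {J} I⊆J v∈ = let i , i∈ , eq = ∈-image⁻ f₀ v∈ in subst (_∈ image f₀ J) eq (∈-image⁺ f₀ (I⊆J i∈))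

      block-at : ∀ i → i ∉ core → Block (image f₀ core) (proj₁ f₀) (coord f₀ i)
      block-at i i∉ = image f₀ (closure (i ∷ [])) , ∈-image⁺ f₀ (⊆-closure (i ∷ []) zero)
        , image-mono (closure-∷ i []) , image⊆ f₀ (closure (i ∷ []))
        , trans (∣image∣ f₀ (closure (i ∷ []))) (∣closure-singleton∣ i∉)
        , robust⇒kernel {𝓡} {f₀} {closure (i ∷ [])} 𝓡⊆ f₀∈ (closure-flat (i ∷ []) {f₀} f₀∈)

      structured : ∃ λ f → f ∈ˡ 𝓡 × Structured (proj₁ f)
      structured = f₀ , f₀∈ , record
        { core = image f₀ core ; core⊆ = image⊆ f₀ core ; ∣core∣ = trans (∣image∣ f₀ core) ∣core∣
        ; core-kernel = robust⇒kernel {𝓡} {f₀} {core} 𝓡⊆ f₀∈ (closure-flat [] {f₀} f₀∈)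
        ; block = λ x∈ x∉ → let i , eq = coord-onto f₀ x∈ in
            subst (Block (image f₀ core) (proj₁ f₀)) eq
              (block-at i λ i∈ → x∉ (subst (_∈ image f₀ core) eq (∈-image⁺ f₀ i∈))) }

    κₛ : ℕ
    κₛ = κ r t (length (subsets r))

    -- Homogenisation takes place inside `𝓑`, but kernels refer to all of `H`. Being structured
    -- therefore does not depend on `𝓑`, and structured members can be peeled off one at a time
    -- until few remain.
    large⇒structured : ∀ 𝓑 → (∀ {f} → f ∈ˡ 𝓑 → f ∈ˡ H) → ListU.Unique 𝓑 → 1 ≤ n →
      κₛ * n ^ (s ∸ 1) < length 𝓑 → ∃ λ f → f ∈ˡ 𝓑 × Structured (proj₁ f)
    large⇒structured 𝓑 𝓑⊆ uniq 1≤n big =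
      let 𝓡 , 𝓡⊆ , 𝓡-unique , large , decided =
            homogenise (n ^ (s ∸ 1)) (length (subsets r)) (subsets r) 𝓑 refl uniq (λ I → inj₁ (subsets-complete I)) big
          f , f∈ , st = Homogenised.structured 𝓡 (λ g∈ → 𝓑⊆ (𝓡⊆ g∈)) 𝓡-unique 1≤n large decided
      in f , 𝓡⊆ f∈ , st

    record Split (𝓑 : List (RSubset n r)) : Set where
      field
        regular     : List (RSubset n r)
        exceptional : List (RSubset n r)
        partition   : 𝓑 ↭ regular ++ exceptional
        structured  : All (Structured ∘ proj₁) regular
        few         : length exceptional ≤ κₛ * n ^ (s ∸ 1)

    split : 1 ≤ n → ∀ k 𝓑 → length 𝓑 ≡ k → (∀ {f} → f ∈ˡ 𝓑 → f ∈ˡ H) → ListU.Unique 𝓑 → Split 𝓑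
    peel : 1 ≤ n → ∀ k 𝓑 → length 𝓑 ≡ k → (∀ {f} → f ∈ˡ 𝓑 → f ∈ˡ H) → ListU.Unique 𝓑 →
      (∃ λ f → f ∈ˡ 𝓑 × Structured (proj₁ f)) → Split 𝓑

    split 1≤n k 𝓑 len 𝓑⊆ uniq =
      [ (λ big → peel 1≤n k 𝓑 len 𝓑⊆ uniq (large⇒structured 𝓑 𝓑⊆ uniq 1≤n big))
      , (λ small → record { regular = [] ; exceptional = 𝓑 ; partition = refl ; structured = [] ; few = small })
      ]′ (ℕ.<-≤-connex (κₛ * n ^ (s ∸ 1)) (length 𝓑))

    peel 1≤n zero [] len 𝓑⊆ uniq (f , () , st)
    peel 1≤n (suc k) 𝓑 len 𝓑⊆ uniq (f , f∈ , st) =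
      let 𝓑′ , 𝓑↭ = ∈-extract f∈
          open Split (split 1≤n k 𝓑′ (ℕ.suc-injective (trans (sym (Perm.↭-length 𝓑↭)) len))
            (λ g∈ → 𝓑⊆ (Perm.∈-resp-↭ (↭-sym 𝓑↭) (there g∈))) (AllPairs.tail (unique-↭ 𝓑↭ uniq)))
      in record { regular = f ∷ regular ; exceptional = exceptional
                ; partition = _↭_.trans 𝓑↭ (prep f partition) ; structured = st ∷ structured ; few = few }

  -- Counting unions of blocks

  2uv≤u²+v² : ∀ u v → 2 * (u * v) ≤ u * u + v * v
  2uv≤u²+v² u v = [ ordered u v , (λ v≤u → subst₂ _≤_ (cong (2 *_) (ℕ.*-comm v u)) (ℕ.+-comm (v * v) (u * u)) (ordered v u v≤u)) ]′ (ℕ.≤-total u v)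
    where
    expand : ∀ u k → 2 * (u * (u + k)) + k * k ≡ u * u + (u + k) * (u + k)
    expand = solve-∀
    ordered : ∀ u v → u ≤ v → 2 * (u * v) ≤ u * u + v * v
    ordered u v u≤v = subst (λ w → 2 * (u * w) ≤ u * u + w * w) (ℕ.m+[n∸m]≡n u≤v)
      (ℕ.≤-trans (ℕ.m≤m+n _ _) (ℕ.≤-reflexive (expand u (v ∸ u))))

  -- u^(j+1) lies above its tangent at v
  tangent : ∀ j u v → suc j * (v ^ j * u) ≤ u ^ suc j + j * v ^ suc j
  tangent zero u v = ℕ.≤-reflexive (lemma u)
    where
    lemma : ∀ u → 1 * (1 * u) ≡ u * 1 + 0
    lemma = solve-∀
  tangent (suc j) u v = ℕ.+-cancelʳ-≤ (j * (v * P * u)) _ _ (begin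
    suc (suc j) * (v * P * u) + j * (v * P * u) ≡⟨ eq₁ j P u v ⟩
    suc j * P * (2 * (u * v))                   ≤⟨ ℕ.*-monoʳ-≤ (suc j * P) (2uv≤u²+v² u v) ⟩
    suc j * P * (u * u + v * v)                 ≡⟨ eq₂ j P u v ⟩
    u * (suc j * (P * u)) + suc j * P * (v * v) ≤⟨ ℕ.+-monoˡ-≤ _ (ℕ.*-monoʳ-≤ u (tangent j u v)) ⟩
    u * (u ^ suc j + j * (v * P)) + suc j * P * (v * v) ≡⟨ eq₃ j P u v (u ^ suc j) ⟩
    u * u ^ suc j + suc j * (v * (v * P)) + j * (v * P * u) ∎)
    where
    open ℕ.≤-Reasoning
    P = v ^ j
    eq₁ : ∀ j P u v → suc (suc j) * (v * P * u) + j * (v * P * u) ≡ suc j * P * (2 * (u * v))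
    eq₁ = solve-∀
    eq₂ : ∀ j P u v → suc j * P * (u * u + v * v) ≡ u * (suc j * (P * u)) + suc j * P * (v * v)
    eq₂ = solve-∀
    eq₃ : ∀ j P u v Q → u * (Q + j * (v * P)) + suc j * P * (v * v) ≡ u * Q + suc j * (v * (v * P)) + j * (v * P * u)
    eq₃ = solve-∀

  ^-distribʳ-* : ∀ a b k → (a * b) ^ k ≡ a ^ k * b ^ k
  ^-distribʳ-* a b zero = refl
  ^-distribʳ-* a b (suc k) = trans (cong (a * b *_) (^-distribʳ-* a b k)) (lemma a b (a ^ k) (b ^ k))
    where
    lemma : ∀ a b c d → a * b * (c * d) ≡ a * c * (b * d)
    lemma = solve-∀

  -- Weighted AM-GM without denominators. It is the tangent inequality at `u = j * (x + y)` and
  -- `v = suc j * y`, where the term `j * v ^ suc j` cancels and a common factor `j` is divided out.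
  am-gm : ∀ j x y → suc j ^ suc j * (x * y ^ j) ≤ j ^ j * (x + y) ^ suc j
  am-gm zero x y = subst₂ _≤_ (lemma x) (lemma′ x y) (ℕ.m≤m+n x y)
    where
    lemma : ∀ x → x ≡ 1 * (x * 1)
    lemma = solve-∀
    lemma′ : ∀ x y → x + y ≡ 1 * ((x + y) * 1)
    lemma′ = solve-∀
  am-gm j@(suc _) x y = ℕ.*-cancelˡ-≤ j (ℕ.+-cancelʳ-≤ (j * (v * V)) _ _ (begin
    j * (suc j * suc j ^ j * (x * y ^ j)) + j * (v * V) ≡⟨ cong (λ z → j * (suc j * suc j ^ j * (x * y ^ j)) + j * (v * z)) (^-distribʳ-* (suc j) y j) ⟩
    j * (suc j * suc j ^ j * (x * y ^ j)) + j * (v * (suc j ^ j * y ^ j)) ≡⟨ eq₁ j (suc j ^ j) (y ^ j) x y ⟩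
    suc j * ((suc j ^ j * y ^ j) * u)                   ≡⟨ cong (λ z → suc j * (z * u)) (^-distribʳ-* (suc j) y j) ⟨
    suc j * (V * u)                                     ≤⟨ tangent j u v ⟩
    u ^ suc j + j * (v * V)                             ≡⟨ cong (_+ j * (v * V)) (^-distribʳ-* j (x + y) (suc j)) ⟩
    j * j ^ j * (x + y) ^ suc j + j * (v * V)           ≡⟨ cong (_+ j * (v * V)) (ℕ.*-assoc j (j ^ j) _) ⟩
    j * (j ^ j * (x + y) ^ suc j) + j * (v * V) ∎))
    where
    open ℕ.≤-Reasoning
    u = j * (x + y)
    v = suc j * y
    V = v ^ j
    eq₁ : ∀ j p q x y → j * (suc j * p * (x * q)) + j * (suc j * y * (p * q)) ≡ suc j * ((p * q) * (j * (x + y)))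
    eq₁ = solve-∀

  argmax : (f : A → ℕ) (xs : List A) → 0 < length xs → ∃ λ x → x ∈ˡ xs × (∀ {y} → y ∈ˡ xs → f y ≤ f x)
  argmax f (x ∷ []) _ = x , here refl , λ { (here refl) → ℕ.≤-refl }
  argmax f (x ∷ xs@(_ ∷ _)) _ with argmax f xs (s≤s z≤n)
  ... | z , z∈ , top with f x ℕ.≤? f z
  ... | yes x≤z = z , there z∈ , λ { (here refl) → x≤z ; (there y∈) → top y∈ }
  ... | no x≰z = x , here refl , λ { (here refl) → ℕ.≤-refl ; (there y∈) → ℕ.≤-trans (top y∈) (ℕ.<⇒≤ (ℕ.≰⇒> x≰z)) }

  module BlockTuran {n d : ℕ} (0<d : 0 < d) (B : Fin n → Subset n → Set)
    (B-self : ∀ {x b} → B x b → x ∈ b) (∣B∣ : ∀ {x b} → B x b → ∣ b ∣ ≡ d)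
    (B-eq : ∀ {x y z b c} → B x b → B y c → z ∈ b → z ∈ c → b ≡ c)
    (J : Fin n → Fin n → Set) where

    -- Each member is a union of `j` blocks inside `U` and has a fixed trace outside it; `free`
    -- plays the part of being K_(j+1)-free. The fixed trace allows the recursion to shrink `U`
    -- without losing track of members.
    record Config (j : ℕ) (U : Subset n) (𝒬 : List (Subset n)) : Set where
      field
        outside : ∀ {F G x} → F ∈ˡ 𝒬 → G ∈ˡ 𝒬 → x ∉ U → x ∈ F → x ∈ G
        rank    : ∀ {F} → F ∈ˡ 𝒬 → ∣ F ∩ U ∣ ≡ j * d
        block   : ∀ {F x} → F ∈ˡ 𝒬 → x ∈ F ∩ U → ∃ λ b → B x b × b ⊆ F ∩ U
        joined  : ∀ {F x y b} → F ∈ˡ 𝒬 → x ∈ F ∩ U → y ∈ F ∩ U → B x b → y ∉ b → J x y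
        free    : (xs : Vec (Fin n) (suc j)) → VAll.All (_∈ U) xs → ¬ VAllPairs.AllPairs J xs

    -- Blocks are removed from `S` one at a time. What remains is again a union of blocks, since
    -- blocks sharing a point are equal.
    representatives : ∀ {j U 𝒬 F} → Config j U 𝒬 → F ∈ˡ 𝒬 → ∀ k (S : Subset n) → ∣ S ∣ ≡ k * d → S ⊆ F ∩ U →
      (∀ {x} → x ∈ S → ∃ λ b → B x b × b ⊆ S) →
      ∃ λ (xs : Vec (Fin n) k) → VAll.All (_∈ S) xs × VAllPairs.AllPairs J xs
    representatives cfg F∈ zero S _ _ _ = [] , [] , []
    representatives {F = F} cfg F∈ (suc k) S ∣S∣ S⊆ blocks =
      let x , x∈ = card-pos⁻ S (subst (1 ≤_) (sym ∣S∣) (ℕ.≤-trans 0<d (ℕ.m≤m+n d (k * d))))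
          b , Bxb , b⊆S = blocks x∈
          xs , xs∈ , pairs = representatives cfg F∈ k (S ─ b) (size Bxb b⊆S) (λ y∈ → S⊆ (𝕊.p─q⊆p S b y∈)) (blocks′ Bxb)
      in x ∷ xs , x∈ ∷ VAll.map (𝕊.p─q⊆p S b) xs∈
        , VAll.map (λ y∈ → let y∈S , y∉b = x∈p─q⁻ S b y∈ in Config.joined cfg F∈ (S⊆ x∈) (S⊆ y∈S) Bxb y∉b) xs∈ ∷ pairs
      where
      size : ∀ {x b} → B x b → b ⊆ S → ∣ S ─ b ∣ ≡ k * d
      size {b = b} Bxb b⊆S = ℕ.+-cancelˡ-≡ d _ _ (trans (cong (_+ ∣ S ─ b ∣) (sym (∣B∣ Bxb))) (trans (sym (card-─ b⊆S)) ∣S∣))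
      blocks′ : ∀ {x b} → B x b → ∀ {y} → y ∈ S ─ b → ∃ λ c → B y c × c ⊆ S ─ b
      blocks′ {b = b} Bxb y∈ =
        let y∈S , y∉b = x∈p─q⁻ S b y∈
            c , Byc , c⊆S = blocks y∈S
        in c , Byc , λ z∈c → 𝕊.x∈p∧x∉q⇒x∈p─q (c⊆S z∈c) λ z∈b → y∉b (subst (_ ∈_) (B-eq Byc Bxb z∈c z∈b) (B-self Byc))

    degree : List (Subset n) → Fin n → ℕ
    degree 𝒬 v = length (filter (v 𝕊.∈?_) 𝒬)

    -- Each member of 𝒬 has a whole block outside the neighbourhood N of a vertex v, since otherwise
    -- v and representatives of its blocks would be pairwise joined. So with v of maximal degree
    -- d |𝒬| ≤ |U ∖ N| deg v, and the link of v is a configuration of rank one less on N.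
    module Link {j U 𝒬} (cfg : Config (suc j) U 𝒬) {v b F₀} (v∈U : v ∈ U) (v∈F₀ : v ∈ F₀) (F₀∈ : F₀ ∈ˡ 𝒬)
      (Bvb : B v b) where

      open Config cfg

      Near : Fin n → Set
      Near y = y ∈ U × y ∉ b × Any.Any (λ F → v ∈ F × y ∈ F) 𝒬

      near? : Decidable Near
      near? y = (y 𝕊.∈? U) ×-dec ¬? (y 𝕊.∈? b) ×-dec Any.any? (λ F → (v 𝕊.∈? F) ×-dec (y 𝕊.∈? F)) 𝒬

      N : Subset n
      N = ⟪ near? ⟫

      N⊆U : N ⊆ U
      N⊆U y∈ = proj₁ (∈⟪⟫⁻ near? y∈)

      near⁺ : ∀ {F y} → F ∈ˡ 𝒬 → v ∈ F → y ∈ F → y ∈ U → y ∉ b → y ∈ N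
      near⁺ F∈ v∈F y∈F y∈U y∉b = ∈⟪⟫⁺ near? (y∈U , y∉b , List∈.lose F∈ (v∈F , y∈F))

      near⁻ : ∀ {y} → y ∈ N → y ∉ b × ∃ λ F → F ∈ˡ 𝒬 × v ∈ F × y ∈ F
      near⁻ y∈ = let _ , y∉b , any = ∈⟪⟫⁻ near? y∈ in y∉b , List∈.find any

      near-joined : ∀ {y} → y ∈ N → J v y
      near-joined y∈ = let y∉b , F , F∈ , v∈F , y∈F = near⁻ y∈ in
        joined F∈ (𝕊.x∈p∩q⁺ (v∈F , v∈U)) (𝕊.x∈p∩q⁺ (y∈F , N⊆U y∈)) Bvb y∉b

      escapes : ∀ {F} → F ∈ˡ 𝒬 → ∃ λ x → x ∈ F ∩ U × x ∉ N
      escapes {F} F∈ = decidable-stable (𝔽.any? λ x → (x 𝕊.∈? F ∩ U) ×-dec ¬? (x 𝕊.∈? N)) λ none →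
        let xs , xs∈ , pairs = representatives cfg F∈ (suc j) (F ∩ U) (rank F∈) id (block F∈)
        in free (v ∷ xs) (v∈U ∷ VAll.map (𝕊.p∩q⊆q F U) xs∈)
          (VAll.map (λ x∈ → near-joined (decidable-stable (_ 𝕊.∈? N) λ x∉N → none (_ , x∈ , x∉N))) xs∈ ∷ pairs)

      -- `N` cuts no block: a near point `y` in the block of `x` lies with `v` in some `G`, and `G`
      -- contains the whole block of `y`, hence `x`, which would then be near too. So the block of
      -- an escaping point avoids `N` entirely.
      block-outside : ∀ {F} → F ∈ˡ 𝒬 → d ≤ ∣ F ∩ (U ─ N) ∣
      block-outside {F} F∈ =
        let x , x∈ , x∉N = escapes F∈
            c , Bxc , c⊆ = block F∈ x∈
        in subst (_≤ ∣ F ∩ (U ─ N) ∣) (∣B∣ Bxc) (𝕊.p⊆q⇒∣p∣≤∣q∣ λ {y} y∈c →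
          let y∈F , y∈U = 𝕊.x∈p∩q⁻ F U (c⊆ y∈c) in
          𝕊.x∈p∩q⁺ (y∈F , 𝕊.x∈p∧x∉q⇒x∈p─q y∈U λ y∈N →
            let y∉b , G , G∈ , v∈G , y∈G = near⁻ y∈N
                c′ , Byc′ , c′⊆ = block G∈ (𝕊.x∈p∩q⁺ (y∈G , y∈U))
                x∈G , x∈U = 𝕊.x∈p∩q⁻ G U (c′⊆ (subst (x ∈_) (B-eq Bxc Byc′ y∈c (B-self Byc′)) (B-self Bxc)))
            in x∉N (near⁺ G∈ v∈G x∈G x∈U λ x∈b → y∉b (subst (y ∈_) (B-eq Bxc Bvb (B-self Bxc) x∈b) y∈c))))

      d*∣𝒬∣≤ : (∀ {u} → u ∈ U → degree 𝒬 u ≤ degree 𝒬 v) → length 𝒬 * d ≤ ∣ U ─ N ∣ * degree 𝒬 v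
      d*∣𝒬∣≤ top = begin
        length 𝒬 * d
          ≤⟨ sum-≥ _ d 𝒬 (λ F∈ → ℕ.≤-trans (block-outside F∈) (hits _)) ⟩
        sum (map (λ F → length (filter (λ x → x 𝕊.∈? F) S)) 𝒬)
          ≡⟨ double-count (λ F x → x 𝕊.∈? F) 𝒬 S ⟩
        sum (map (degree 𝒬) S)
          ≤⟨ sum-≤ (degree 𝒬) (degree 𝒬 v) S (λ u∈ → top (𝕊.p─q⊆p U N (∈-elements⁻ (U ─ N) u∈))) ⟩
        length S * degree 𝒬 v
          ≡⟨ cong (_* degree 𝒬 v) (length-elements (U ─ N)) ⟩
        ∣ U ─ N ∣ * degree 𝒬 v ∎
        where
        open ℕ.≤-Reasoning
        S = elements (U ─ N)
        hits : ∀ F → ∣ F ∩ (U ─ N) ∣ ≤ length (filter (λ x → x 𝕊.∈? F) S)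
        hits F = subst (_≤ length (filter (λ x → x 𝕊.∈? F) S)) (length-elements (F ∩ (U ─ N)))
          (length-⊆ (elements-unique (F ∩ (U ─ N))) λ x∈ →
            let x∈F , x∈S = 𝕊.x∈p∩q⁻ F (U ─ N) (∈-elements⁻ _ x∈) in ∈-filter⁺ (λ x → x 𝕊.∈? F) (∈-elements⁺ x∈S) x∈F)

      link : List (Subset n)
      link = filter (v 𝕊.∈?_) 𝒬

      link⁻ : ∀ {F} → F ∈ˡ link → F ∈ˡ 𝒬 × v ∈ F
      link⁻ = ∈-filter⁻ (v 𝕊.∈?_) {xs = 𝒬}

      b⊆ : ∀ {F} → F ∈ˡ link → b ⊆ F ∩ U
      b⊆ {F} F∈ = let F∈𝒬 , v∈F = link⁻ F∈
                      c , Bvc , c⊆ = block F∈𝒬 (𝕊.x∈p∩q⁺ (v∈F , v∈U))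
                  in subst (_⊆ F ∩ U) (B-eq Bvc Bvb (B-self Bvc) (B-self Bvb)) (λ x∈ → c⊆ x∈)

      -- A member through `v` makes all its points of `U` outside `b` near, so passing to the link
      -- removes exactly one block.
      ∩N : ∀ {F} → F ∈ˡ link → F ∩ N ≡ (F ∩ U) ─ b
      ∩N {F} F∈ = 𝕊.⊆-antisym
        (λ x∈ → let x∈F , x∈N = 𝕊.x∈p∩q⁻ F N x∈ in
          𝕊.x∈p∧x∉q⇒x∈p─q (𝕊.x∈p∩q⁺ (x∈F , N⊆U x∈N)) (proj₁ (near⁻ x∈N)))
        (λ x∈ → let x∈FU , x∉b = x∈p─q⁻ (F ∩ U) b x∈
                    x∈F , x∈U = 𝕊.x∈p∩q⁻ F U x∈FU
                    F∈𝒬 , v∈F = link⁻ F∈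
                in 𝕊.x∈p∩q⁺ (x∈F , near⁺ F∈𝒬 v∈F x∈F x∈U x∉b))

      link-config : Config j N link
      link-config = record { outside = outside′ ; rank = rank′ ; block = block′ ; joined = joined′ ; free = free′ }
        where
        outside′ : ∀ {F G x} → F ∈ˡ link → G ∈ˡ link → x ∉ N → x ∈ F → x ∈ G
        outside′ {F} {G} {x} F∈ G∈ x∉N x∈F with x 𝕊.∈? U | x 𝕊.∈? b
        ... | no x∉U | _ = outside (proj₁ (link⁻ F∈)) (proj₁ (link⁻ G∈)) x∉U x∈F
        ... | yes _ | yes x∈b = 𝕊.p∩q⊆p G U (b⊆ G∈ x∈b)
        ... | yes x∈U | no x∉b = ⊥-elim (x∉N (near⁺ (proj₁ (link⁻ F∈)) (proj₂ (link⁻ F∈)) x∈F x∈U x∉b))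
        rank′ : ∀ {F} → F ∈ˡ link → ∣ F ∩ N ∣ ≡ j * d
        rank′ {F} F∈ = trans (cong ∣_∣ (∩N F∈)) (ℕ.+-cancelˡ-≡ d _ _
          (trans (cong (_+ ∣ (F ∩ U) ─ b ∣) (sym (∣B∣ Bvb))) (trans (sym (card-─ (b⊆ F∈))) (rank (proj₁ (link⁻ F∈))))))
        block′ : ∀ {F x} → F ∈ˡ link → x ∈ F ∩ N → ∃ λ c → B x c × c ⊆ F ∩ N
        block′ {F} {x} F∈ x∈ =
          let x∈′ = subst (x ∈_) (∩N F∈) x∈
              x∈FU , x∉b = x∈p─q⁻ (F ∩ U) b x∈′
              c , Bxc , c⊆ = block (proj₁ (link⁻ F∈)) x∈FU
          in c , Bxc , λ {y} y∈c → subst (y ∈_) (sym (∩N F∈)) (𝕊.x∈p∧x∉q⇒x∈p─q (c⊆ y∈c) λ y∈b →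
            x∉b (subst (x ∈_) (B-eq Bxc Bvb y∈c y∈b) (B-self Bxc)))
        ∩-mono : ∀ {F x} → x ∈ F ∩ N → x ∈ F ∩ U
        ∩-mono {F} x∈ = let x∈F , x∈N = 𝕊.x∈p∩q⁻ F N x∈ in 𝕊.x∈p∩q⁺ (x∈F , N⊆U x∈N)
        joined′ : ∀ {F x y c} → F ∈ˡ link → x ∈ F ∩ N → y ∈ F ∩ N → B x c → y ∉ c → J x y
        joined′ F∈ x∈ y∈ = joined (proj₁ (link⁻ F∈)) (∩-mono x∈) (∩-mono y∈)
        free′ : (xs : Vec (Fin n) (suc j)) → VAll.All (_∈ N) xs → ¬ VAllPairs.AllPairs J xs
        free′ xs xs∈ pairs = free (v ∷ xs) (v∈U ∷ VAll.map N⊆U xs∈) (VAll.map near-joined xs∈ ∷ pairs)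

    -- `m` and `u` are the sizes of `N` and of its complement in `U`, and `D` is the maximal degree.
    -- The degree bound and the induction hypothesis give a multiple of `u * m ^ j`, and `am-gm`
    -- optimises this over all splittings of `m + u`.
    turan-step : ∀ j q D m u → q * d ≤ u * D → j ^ j * (d ^ j * D) ≤ m ^ j →
      suc j ^ suc j * (d ^ suc j * q) ≤ (m + u) ^ suc j
    turan-step j q D m u dq≤ ih = ℕ.*-cancelˡ-≤ (j ^ j) {{j^j≢0 j}} (begin
      j ^ j * (suc j ^ suc j * (d * d ^ j * q))    ≡⟨ eq₁ (j ^ j) (suc j ^ suc j) d (d ^ j) q ⟩
      suc j ^ suc j * (j ^ j * d ^ j * (q * d))    ≤⟨ ℕ.*-monoʳ-≤ (suc j ^ suc j) (ℕ.*-monoʳ-≤ (j ^ j * d ^ j) dq≤) ⟩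
      suc j ^ suc j * (j ^ j * d ^ j * (u * D))    ≡⟨ eq₂ (j ^ j) (suc j ^ suc j) (d ^ j) u D ⟩
      suc j ^ suc j * (u * (j ^ j * (d ^ j * D)))  ≤⟨ ℕ.*-monoʳ-≤ (suc j ^ suc j) (ℕ.*-monoʳ-≤ u ih) ⟩
      suc j ^ suc j * (u * m ^ j)                  ≤⟨ am-gm j u m ⟩
      j ^ j * (u + m) ^ suc j                      ≡⟨ cong (λ z → j ^ j * z ^ suc j) (ℕ.+-comm u m) ⟩
      j ^ j * (m + u) ^ suc j                      ∎)
      where
      open ℕ.≤-Reasoning
      j^j≢0 : ∀ j → Nat.NonZero (j ^ j)
      j^j≢0 zero = _
      j^j≢0 j@(suc _) = ℕ.m^n≢0 j j
      eq₁ : ∀ a b d e q → a * (b * (d * e * q)) ≡ b * (a * e * (q * d))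
      eq₁ = solve-∀
      eq₂ : ∀ a b e u D → b * (a * e * (u * D)) ≡ b * (u * (a * (e * D)))
      eq₂ = solve-∀

    all-equal : (xs : List (Subset n)) → ListU.Unique xs → (∀ {x y} → x ∈ˡ xs → y ∈ˡ xs → x ≡ y) → length xs ≤ 1
    all-equal [] _ _ = z≤n
    all-equal (x ∷ []) _ _ = s≤s z≤n
    all-equal (x ∷ y ∷ _) ((x≢y ∷ _) ∷ _) eq = ⊥-elim (x≢y (eq (here refl) (there (here refl))))

    -- For `d = 1` this is the bound `(n / j) ^ j` on the number of j-cliques in a K_(j+1)-free
    -- graph on n vertices.
    turan : ∀ j U 𝒬 → ListU.Unique 𝒬 → Config j U 𝒬 → j ^ j * (d ^ j * length 𝒬) ≤ ∣ U ∣ ^ j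
    turan zero U 𝒬 uniq cfg = subst (_≤ 1) (sym (trans (ℕ.*-identityˡ _) (ℕ.*-identityˡ _))) (all-equal 𝒬 uniq λ F∈ G∈ →
      𝕊.⊆-antisym (sub F∈ G∈) (sub G∈ F∈))
      where
      open Config cfg
      sub : ∀ {F G} → F ∈ˡ 𝒬 → G ∈ˡ 𝒬 → F ⊆ G
      sub {F} F∈ G∈ {x} x∈F = outside F∈ G∈ (λ x∈U →
        ℕ.<⇒≱ (card-pos (𝕊.x∈p∩q⁺ (x∈F , x∈U))) (ℕ.≤-reflexive (rank F∈))) x∈F
    turan (suc j) U [] uniq cfg = subst (_≤ ∣ U ∣ ^ suc j) (sym (trans (cong (suc j ^ suc j *_) (ℕ.*-zeroʳ (d ^ suc j))) (ℕ.*-zeroʳ (suc j ^ suc j)))) z≤n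
    turan (suc j) U 𝒬@(F₁ ∷ _) uniq cfg =
      let open Config cfg
          -- A point of `U` covered by `F₁` makes the maximal degree positive, so that `v` lies in
          -- some member and has a block.
          w , w∈ = card-pos⁻ (F₁ ∩ U) (subst (1 ≤_) (sym (rank (here refl))) (ℕ.≤-trans 0<d (ℕ.m≤m+n d (j * d))))
          w∈F , w∈U = 𝕊.x∈p∩q⁻ F₁ U w∈
          v , v∈ , top = argmax (degree 𝒬) (elements U) (length-pos (∈-elements⁺ w∈U))
          v∈U = ∈-elements⁻ U v∈
          F₀ , F₀∈′ = nonempty-∈ (filter (v 𝕊.∈?_) 𝒬)
            (ℕ.≤-trans (length-pos (∈-filter⁺ (w 𝕊.∈?_) (here refl) w∈F)) (top (∈-elements⁺ w∈U)))
          F₀∈ , v∈F₀ = ∈-filter⁻ (v 𝕊.∈?_) {xs = 𝒬} F₀∈′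
          b , Bvb , _ = block F₀∈ (𝕊.x∈p∩q⁺ (v∈F₀ , v∈U))
          open Link cfg v∈U v∈F₀ F₀∈ Bvb
      in subst (λ z → suc j ^ suc j * (d ^ suc j * length 𝒬) ≤ z ^ suc j) (sym (card-─ N⊆U))
        (turan-step j (length 𝒬) (degree 𝒬 v) ∣ N ∣ ∣ U ─ N ∣ (d*∣𝒬∣≤ (λ u∈ → top (∈-elements⁺ u∈)))
          (turan j N link (ListU.filter⁺ (v 𝕊.∈?_) uniq) link-config))

  allPairs-lookup : {R : A → A → Set} → (∀ {x y} → R x y → R y x) → ∀ {k} {xs : Vec A k} →
    VAllPairs.AllPairs R xs → ∀ {i j} → i ≢ j → R (lookup xs i) (lookup xs j)
  allPairs-lookup R-sym (px ∷ pxs) {zero} {zero} i≢j = ⊥-elim (i≢j refl)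
  allPairs-lookup R-sym (px ∷ pxs) {zero} {suc j} i≢j = VAll.lookup⁺ px j
  allPairs-lookup R-sym (px ∷ pxs) {suc i} {zero} i≢j = R-sym (VAll.lookup⁺ px i)
  allPairs-lookup R-sym (px ∷ pxs) {suc i} {suc j} i≢j = allPairs-lookup R-sym pxs (i≢j ∘ cong suc)

  another : ∀ {k} → 1 ≤ k → (i : Fin (suc k)) → ∃ λ j → i ≢ j
  another (s≤s _) zero = suc zero , λ ()
  another (s≤s _) (suc i) = zero , λ ()

  -- Common core, disjoint blocks and the exchange argument

  module Regular {n r : ℕ} (t₀ : ℕ) (H : List (RSubset n r)) (ℓ d s : ℕ) (r≡ : r ≡ ℓ + s * d) (0<d : 0 < d) (2≤s : 2 ≤ s)
    (intersecting : (Fs : Vec (Subset n) (suc (suc t₀))) → VecU.Unique Fs → VAll.All (_∈ˡ map proj₁ H) Fs →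
      ∃ λ k → k < s × ∣ ⋂ (toList Fs) ∣ ≡ ℓ + k * d)
    (G : Graph n) (H-clique : ∀ {F} → F ∈ˡ H → IsClique G (proj₁ F)) (clique-H : ∀ F → IsClique G (proj₁ F) → F ∈ˡ H)
    (not-trivial : 2 ≤ d ⊎ 1 ≤ ℓ) where

    open Structure t₀ H ℓ d s r≡ 2≤s intersecting

    ℓ<r : ℓ < r
    ℓ<r = subst (ℓ <_) (sym r≡) (ℕ.m<m+n ℓ (ℕ.*-mono-≤ (ℕ.≤-trans (s≤s z≤n) 2≤s) 0<d))

    ℓ+d<r : ℓ + d < r
    ℓ+d<r = subst (ℓ + d <_) (sym r≡) (ℕ.+-monoʳ-< ℓ (ℕ.<-≤-trans (ℕ.m<m+n d 0<d)
      (ℕ.≤-trans (ℕ.≤-reflexive (cong (d +_) (sym (ℕ.+-identityʳ d)))) (ℕ.*-monoˡ-≤ d 2≤s))))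

    -- Every admissible intersection size is at least `ℓ`, the size of both kernels.
    cores-equal : ∀ {A A′} → ∣ A ∣ ≡ ℓ → ∣ A′ ∣ ≡ ℓ → Kernel A → Kernel A′ → A ≡ A′
    cores-equal {A} {A′} ∣A∣ ∣A′∣ kA kA′ = 𝕊.⊆-antisym
      (λ x∈ → 𝕊.p∩q⊆q A A′ (⊆-card-≥ (𝕊.p∩q⊆p A A′) (subst (_≤ ∣ A ∩ A′ ∣) (sym ∣A∣) big) x∈))
      (λ x∈ → 𝕊.p∩q⊆p A A′ (⊆-card-≥ (𝕊.p∩q⊆q A A′) (subst (_≤ ∣ A ∩ A′ ∣) (sym ∣A′∣) big) x∈))
      where
      big : ℓ ≤ ∣ A ∩ A′ ∣
      big = let k , _ , eq = kernel-∩-kernel kA kA′ (subst (_< r) (sym ∣A′∣) ℓ<r)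
            in subst (ℓ ≤_) (sym eq) (ℕ.m≤m+n ℓ (k * d))

    module _ (A : Subset n) (∣A∣ : ∣ A ∣ ≡ ℓ) (A-kernel : Kernel A) where

      IsBlock : Fin n → Subset n → Set
      IsBlock x b = ∃ λ K → x ∈ K × x ∉ A × A ⊆ K × ∣ K ∣ ≡ ℓ + d × Kernel K × b ≡ K ─ A

      block-self : ∀ {x b} → IsBlock x b → x ∈ b
      block-self (K , x∈K , x∉A , _ , _ , _ , refl) = 𝕊.x∈p∧x∉q⇒x∈p─q x∈K x∉A

      ∣block∣ : ∀ {x b} → IsBlock x b → ∣ b ∣ ≡ d
      ∣block∣ (K , _ , _ , A⊆K , ∣K∣ , _ , refl) = ℕ.+-cancelˡ-≡ ℓ _ _
        (trans (cong (_+ ∣ K ─ A ∣) (sym ∣A∣)) (trans (sym (card-─ A⊆K)) ∣K∣))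

      block∌ : ∀ {x b z} → IsBlock x b → z ∈ b → z ∉ A
      block∌ (K , _ , _ , _ , _ , _ , refl) z∈ = proj₂ (x∈p─q⁻ K A z∈)

      -- `K ∩ K′` contains `A` and also `z`, so it has more than `ℓ` vertices; the next admissible
      -- size `ℓ + d` is already that of `K` and `K′`.
      block-eq : ∀ {x y z b c} → IsBlock x b → IsBlock y c → z ∈ b → z ∈ c → b ≡ c
      block-eq {z = z} (K , _ , _ , A⊆K , ∣K∣ , kK , refl) (K′ , _ , _ , A⊆K′ , ∣K′∣ , kK′ , refl) z∈ z∈′ =
        cong (_─ A) (𝕊.⊆-antisym
          (λ x∈ → 𝕊.p∩q⊆q K K′ (⊆-card-≥ (𝕊.p∩q⊆p K K′) (subst (_≤ ∣ K ∩ K′ ∣) (sym ∣K∣) big) x∈))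
          (λ x∈ → 𝕊.p∩q⊆p K K′ (⊆-card-≥ (𝕊.p∩q⊆q K K′) (subst (_≤ ∣ K ∩ K′ ∣) (sym ∣K′∣) big) x∈)))
        where
        A⊂ : ∣ A ∣ < ∣ K ∩ K′ ∣
        A⊂ = 𝕊.p⊂q⇒∣p∣<∣q∣ ((λ x∈ → 𝕊.x∈p∩q⁺ (A⊆K x∈ , A⊆K′ x∈)) ,
          z , 𝕊.x∈p∩q⁺ (proj₁ (x∈p─q⁻ K A z∈) , proj₁ (x∈p─q⁻ K′ A z∈′)) , proj₂ (x∈p─q⁻ K A z∈))
        at-least : ∀ k → ℓ < ℓ + k * d → ℓ + d ≤ ℓ + k * d
        at-least zero lt = ⊥-elim (ℕ.<⇒≱ lt (ℕ.≤-reflexive (ℕ.+-identityʳ ℓ)))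
        at-least (suc k) _ = ℕ.+-monoʳ-≤ ℓ (ℕ.m≤m+n d (k * d))
        big : ℓ + d ≤ ∣ K ∩ K′ ∣
        big = let k , _ , eq = kernel-∩-kernel kK kK′ (subst (_< r) (sym ∣K′∣) ℓ+d<r)
              in subst (ℓ + d ≤_) (sym eq) (at-least k (subst₂ _<_ ∣A∣ eq A⊂))

      -- The member must contain `A` and both whole blocks, not merely `x` and `y`, because
      -- adjacency will be needed between all points of the sets spanned by them.
      Joined : Fin n → Fin n → Set
      Joined x y = ∃ λ F → F ∈ˡ H × A ⊆ proj₁ F × ∃₂ λ b c → IsBlock x b × IsBlock y c ×
        b ⊆ proj₁ F × c ⊆ proj₁ F × y ∉ b

      joined-sym : ∀ {x y} → Joined x y → Joined y x
      joined-sym (F , F∈ , A⊆ , b , c , Bxb , Byc , b⊆ , c⊆ , y∉b) = F , F∈ , A⊆ , c , b , Byc , Bxb , c⊆ , b⊆ ,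
        λ x∈c → y∉b (subst (_ ∈_) (block-eq Byc Bxb x∈c (block-self Bxb)) (block-self Byc))

      InSpan : ∀ {k} → Vec (Fin n) k → Fin n → Set
      InSpan xs u = u ∈ A ⊎ ∃₂ λ i b → IsBlock (lookup xs i) b × u ∈ b

      -- Points of two different blocks lie in the member joining these blocks. For points of `A` or
      -- of a single block any member involving a second index will do, hence the requirement of at
      -- least two entries.
      span-covered : ∀ {k} {xs : Vec (Fin n) (suc k)} → 1 ≤ k → VAllPairs.AllPairs Joined xs →
        ∀ {u v} → InSpan xs u → InSpan xs v → ∃ λ F → F ∈ˡ H × u ∈ proj₁ F × v ∈ proj₁ F
      span-covered 1≤k pairs (inj₁ u∈) (inj₁ v∈) =
        let j , i≢j = another 1≤k zero
            F , F∈ , A⊆ , _ = allPairs-lookup joined-sym pairs i≢j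
        in F , F∈ , A⊆ u∈ , A⊆ v∈
      span-covered 1≤k pairs (inj₁ u∈) (inj₂ (i , b , Bb , v∈)) =
        let j , i≢j = another 1≤k i
            F , F∈ , A⊆ , b′ , _ , Bb′ , _ , b⊆ , _ = allPairs-lookup joined-sym pairs i≢j
        in F , F∈ , A⊆ u∈ , b⊆ (subst (_ ∈_) (block-eq Bb Bb′ (block-self Bb) (block-self Bb′)) v∈)
      span-covered 1≤k pairs u∈@(inj₂ _) v∈@(inj₁ _) =
        let F , F∈ , v∈F , u∈F = span-covered 1≤k pairs v∈ u∈ in F , F∈ , u∈F , v∈F
      span-covered 1≤k pairs (inj₂ (i , b , Bb , u∈)) (inj₂ (j , c , Bc , v∈)) = [ same , different ]′ (toSum (i 𝔽.≟ j))
        where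
        same : i ≡ j → _
        same refl =
          let k , i≢k = another 1≤k i
              F , F∈ , _ , b′ , _ , Bb′ , _ , b⊆ , _ = allPairs-lookup joined-sym pairs i≢k
          in F , F∈ , b⊆ (subst (_ ∈_) (block-eq Bb Bb′ (block-self Bb) (block-self Bb′)) u∈)
                    , b⊆ (subst (_ ∈_) (block-eq Bc Bb′ (block-self Bc) (block-self Bb′)) v∈)
        different : i ≢ j → _
        different i≢j =
          let F , F∈ , _ , b′ , c′ , Bb′ , Bc′ , b⊆ , c⊆ , _ = allPairs-lookup joined-sym pairs i≢j
          in F , F∈ , b⊆ (subst (_ ∈_) (block-eq Bb Bb′ (block-self Bb) (block-self Bb′)) u∈)
                    , c⊆ (subst (_ ∈_) (block-eq Bc Bc′ (block-self Bc) (block-self Bc′)) v∈)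

      Apart : Fin n → Fin n → Set
      Apart x y = ∀ {b} → IsBlock x b → y ∉ b

      joined⇒apart : ∀ {x y} → Joined x y → Apart x y
      joined⇒apart (_ , _ , _ , b , _ , Bxb , _ , _ , _ , y∉b) Bxb′ y∈b′ =
        y∉b (subst (_ ∈_) (block-eq Bxb′ Bxb (block-self Bxb′) (block-self Bxb)) y∈b′)

      record Span {k} (xs : Vec (Fin n) k) : Set where
        field
          set     : Subset n
          A⊆      : A ⊆ set
          size    : ∣ set ∣ ≡ ℓ + k * d
          inside  : ∀ {u} → u ∈ set → InSpan xs u
          points  : ∀ i → lookup xs i ∈ set

      span : ∀ {k} (xs : Vec (Fin n) k) → VAll.All (λ x → ∃ (IsBlock x)) xs → VAllPairs.AllPairs Apart xs → Span xs
      span [] [] [] = record { set = A ; A⊆ = id ; size = trans ∣A∣ (sym (ℕ.+-identityʳ ℓ)) ; inside = inj₁ ; points = λ () }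
      span {suc k} (x ∷ xs) ((b , Bxb) ∷ blocks) (apart ∷ aparts) = record
        { set = b ∪ set
        ; A⊆ = λ x∈ → 𝕊.q⊆p∪q b set (A⊆ x∈)
        ; size = trans (card-disjoint-∪ b set disjoint) (trans (cong₂ _+_ (∣block∣ Bxb) size) (lemma d ℓ (k * d)))
        ; inside = λ u∈ → [ (λ u∈b → inj₂ (zero , b , Bxb , u∈b)) , shift ∘ inside ]′ (𝕊.x∈p∪q⁻ b set u∈)
        ; points = λ { zero → 𝕊.p⊆p∪q set (block-self Bxb) ; (suc i) → 𝕊.q⊆p∪q b set (points i) } }
        where
        open Span (span xs blocks aparts)
        lemma : ∀ d ℓ m → d + (ℓ + m) ≡ ℓ + (d + m)
        lemma = solve-∀
        shift : ∀ {u} → InSpan xs u → InSpan (x ∷ xs) u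
        shift (inj₁ u∈A) = inj₁ u∈A
        shift (inj₂ (i , c , Bc , u∈)) = inj₂ (suc i , c , Bc , u∈)
        disjoint : ∀ {u} → u ∈ b → u ∈ set → ⊥
        disjoint u∈b u∈ = [ block∌ Bxb u∈b
          , (λ (i , c , Bc , u∈c) → VAll.lookup⁺ apart i Bxb (subst (_ ∈_) (block-eq Bc Bxb u∈c u∈b) (block-self Bc))) ]′ (inside u∈)

      -- Exchanging a point y of the clique spanned by A and s of the blocks for the point x₀ of one
      -- more joined block gives a member of H, whose intersection with a suitable kernel has a forbidden size.
      module Exchange {x₀ : Fin n} {xs : Vec (Fin n) s} (pairs : VAllPairs.AllPairs Joined (x₀ ∷ xs)) where

        1≤s : 1 ≤ s
        1≤s = ℕ.≤-trans (s≤s z≤n) 2≤s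

        joined : ∀ {i j} → i ≢ j → Joined (lookup (x₀ ∷ xs) i) (lookup (x₀ ∷ xs) j)
        joined = allPairs-lookup joined-sym {xs = x₀ ∷ xs} pairs

        has-block : ∀ i → ∃ (IsBlock (lookup (x₀ ∷ xs) i))
        has-block i = let _ , i≢j = another 1≤s i
                          _ , _ , _ , b , _ , Bb , _ = joined i≢j
                      in b , Bb

        spanned : Span xs
        spanned = span xs (VAll.lookup⁻ (λ i → has-block (suc i)))
          (VAllPairs.map joined⇒apart (VAllPairs.tail pairs))

        open Span spanned renaming (set to V)

        x₀∉A : x₀ ∉ A
        x₀∉A = block∌ (proj₂ (has-block zero)) (block-self (proj₂ (has-block zero)))

        block-apart : ∀ {b} → IsBlock x₀ b → ∀ {i c u} → IsBlock (lookup xs i) c → u ∈ b → u ∈ c → ⊥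
        block-apart Bb {i} Bc u∈b u∈c =
          joined⇒apart (joined {zero} {suc i} (λ ())) Bb (subst (_ ∈_) (block-eq Bc Bb u∈c u∈b) (block-self Bc))

        x₀∉V : x₀ ∉ V
        x₀∉V x₀∈ = [ x₀∉A , (λ (i , c , Bc , u∈c) → let b , Bb = has-block zero in block-apart Bb {i} Bc (block-self Bb) u∈c) ]′ (inside x₀∈)

        swap-in : Fin n → Subset n
        swap-in y = (V ─ ⁅ y ⁆) ∪ ⁅ x₀ ⁆

        ∈-swap⁻ : ∀ {y u} → u ∈ swap-in y → (u ∈ V × u ≢ y) ⊎ u ≡ x₀
        ∈-swap⁻ {y} u∈ = [ (λ u∈′ → let u∈V , u∉y = x∈p─q⁻ V ⁅ y ⁆ u∈′ in inj₁ (u∈V , 𝕊.x∉⁅y⁆⇒x≢y u∉y))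
                         , (λ u∈′ → inj₂ (𝕊.x∈⁅y⁆⇒x≡y x₀ u∈′)) ]′ (𝕊.x∈p∪q⁻ (V ─ ⁅ y ⁆) ⁅ x₀ ⁆ u∈)

        ∣swap-in∣ : ∀ {y} → y ∈ V → ∣ swap-in y ∣ ≡ r
        ∣swap-in∣ {y} y∈V = begin
          ∣ swap-in y ∣             ≡⟨ card-disjoint-∪ (V ─ ⁅ y ⁆) ⁅ x₀ ⁆ (λ u∈ u∈′ → x₀∉V (subst (_∈ V) (𝕊.x∈⁅y⁆⇒x≡y x₀ u∈′) (𝕊.p─q⊆p V ⁅ y ⁆ u∈))) ⟩
          ∣ V ─ ⁅ y ⁆ ∣ + ∣ ⁅ x₀ ⁆ ∣ ≡⟨ cong (∣ V ─ ⁅ y ⁆ ∣ +_) (trans (𝕊.∣⁅x⁆∣≡1 x₀) (sym (𝕊.∣⁅x⁆∣≡1 y))) ⟩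
          ∣ V ─ ⁅ y ⁆ ∣ + ∣ ⁅ y ⁆ ∣  ≡⟨ ℕ.+-comm ∣ V ─ ⁅ y ⁆ ∣ ∣ ⁅ y ⁆ ∣ ⟩
          ∣ ⁅ y ⁆ ∣ + ∣ V ─ ⁅ y ⁆ ∣  ≡⟨ card-─ (λ u∈ → subst (_∈ V) (sym (𝕊.x∈⁅y⁆⇒x≡y y u∈)) y∈V) ⟨
          ∣ V ∣                     ≡⟨ trans size (sym r≡) ⟩
          r                         ∎
          where open ≡-Reasoning

        in-span : ∀ {y u} → u ∈ swap-in y → InSpan (x₀ ∷ xs) u
        in-span u∈ = [ (λ (u∈V , _) → shift (inside u∈V))
                     , (λ { refl → let b , Bb = has-block zero in inj₂ (zero , b , Bb , block-self Bb) }) ]′ (∈-swap⁻ u∈)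
          where
          shift : ∀ {u} → InSpan xs u → InSpan (x₀ ∷ xs) u
          shift (inj₁ u∈A) = inj₁ u∈A
          shift (inj₂ (i , c , Bc , u∈c)) = inj₂ (suc i , c , Bc , u∈c)

        swap-member : ∀ {y} (y∈V : y ∈ V) → (swap-in y , ∣swap-in∣ y∈V) ∈ˡ H
        swap-member y∈V = clique-H _ λ u v u∈ v∈ u≢v →
          let F , F∈ , u∈F , v∈F = span-covered 1≤s pairs (in-span u∈) (in-span v∈) in H-clique F∈ u v u∈F v∈F u≢v

        -- Here the vertex given up is some `a` of the core: the resulting member meets the kernel
        -- `A` in fewer than `ℓ` vertices.
        core-nonempty : 1 ≤ ℓ → ⊥
        core-nonempty 1≤ℓ =
          let a , a∈A = card-pos⁻ A (subst (1 ≤_) (sym ∣A∣) 1≤ℓ)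
              k , _ , eq = kernel-∩-member (swap-member (A⊆ a∈A)) A-kernel (subst (_< r) (sym ∣A∣) ℓ<r)
              a∉ = λ a∈ → [ (λ (_ , a≢a) → a≢a refl) , (λ a≡x₀ → x₀∉A (subst (_∈ A) a≡x₀ a∈A)) ]′ (∈-swap⁻ a∈)
          in ℕ.<⇒≱ (subst₂ _<_ eq ∣A∣ (𝕊.p⊂q⇒∣p∣<∣q∣ (𝕊.p∩q⊆q (swap-in a) A , a , a∈A , λ a∈ → a∉ (𝕊.p∩q⊆p (swap-in a) A a∈))))
               (ℕ.m≤m+n ℓ (k * d))

        -- Here the vertex given up lies outside `A`. As `V` is disjoint from the block of `x₀`, the
        -- resulting member meets the kernel `K` of that block in `A` and `x₀` alone, and `ℓ + 1` is
        -- not an admissible size.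
        blocks-large : 2 ≤ d → ⊥
        blocks-large 2≤d =
          let i₁ = Fin.fromℕ< {0} 1≤s
              x₁ = lookup xs i₁
              b₀ , B₀ = has-block zero
              b₁ , B₁ = has-block (suc i₁)
              K , x₀∈K , _ , A⊆K , ∣K∣ , kK , b₀≡ = B₀
              R = swap-in x₁
              k , _ , eq = kernel-∩-member (swap-member (points i₁)) kK (subst (_< r) (sym ∣K∣) ℓ+d<r)
              R∩K : R ∩ K ≡ A ∪ ⁅ x₀ ⁆
              R∩K = 𝕊.⊆-antisym
                (λ {u} u∈ → let u∈R , u∈K = 𝕊.x∈p∩q⁻ R K u∈ in 𝕊.x∈p∪q⁺
                  ([ (λ (u∈V , _) → inj₁ (decidable-stable (u 𝕊.∈? A) λ u∉A →
                       [ u∉A , (λ (i , c , Bc , u∈c) → block-apart B₀ {i} Bc (subst (u ∈_) (sym b₀≡) (𝕊.x∈p∧x∉q⇒x∈p─q u∈K u∉A)) u∈c) ]′ (inside u∈V)))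
                   , (λ { refl → inj₂ (𝕊.x∈⁅x⁆ x₀) }) ]′ (∈-swap⁻ u∈R)))
                (λ {u} u∈ → [ (λ u∈A → 𝕊.x∈p∩q⁺ (𝕊.x∈p∪q⁺ (inj₁ (𝕊.x∈p∧x∉q⇒x∈p─q (A⊆ u∈A)
                                  (λ u∈x₁ → block∌ B₁ (block-self B₁) (subst (_∈ A) (𝕊.x∈⁅y⁆⇒x≡y x₁ u∈x₁) u∈A)))) , A⊆K u∈A))
                            , (λ u∈x₀ → subst (_∈ R ∩ K) (sym (𝕊.x∈⁅y⁆⇒x≡y x₀ u∈x₀))
                                  (𝕊.x∈p∩q⁺ (𝕊.x∈p∪q⁺ (inj₂ (𝕊.x∈⁅x⁆ x₀)) , x₀∈K))) ]′ (𝕊.x∈p∪q⁻ A ⁅ x₀ ⁆ u∈))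
              size′ : ∣ A ∪ ⁅ x₀ ⁆ ∣ ≡ ℓ + 1
              size′ = trans (card-disjoint-∪ A ⁅ x₀ ⁆ (λ u∈A u∈x₀ → x₀∉A (subst (_∈ A) (𝕊.x∈⁅y⁆⇒x≡y x₀ u∈x₀) u∈A)))
                        (cong₂ _+_ ∣A∣ (𝕊.∣⁅x⁆∣≡1 x₀))
          in not-one k (ℕ.+-cancelˡ-≡ ℓ _ _ (trans (sym eq) (trans (cong ∣_∣ R∩K) size′)))
          where
          not-one : ∀ k → k * d ≡ 1 → ⊥
          not-one (suc k) eq = ℕ.<⇒≱ 2≤d (ℕ.≤-trans (ℕ.m≤m+n d (k * d)) (ℕ.≤-reflexive eq))

      free : (xs : Vec (Fin n) (suc s)) → ¬ VAllPairs.AllPairs Joined xs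
      free (x₀ ∷ xs) pairs = [ Exchange.blocks-large pairs , Exchange.core-nonempty pairs ]′ not-trivial

      open BlockTuran 0<d IsBlock block-self ∣block∣ block-eq Joined

      -- The ground set is the complement of the common core, which is why the count is in terms of
      -- `n ∸ ℓ` instead of `n`.
      config : (𝒬 : List (RSubset n r)) → (∀ {F} → F ∈ˡ 𝒬 → F ∈ˡ H) → All (Structured ∘ proj₁) 𝒬 →
        Config s (∁ A) (map proj₁ 𝒬)
      config 𝒬 𝒬⊆ structured = record
        { outside = λ F∈ G∈ x∉ x∈ → let G , G∈𝒬 , eq = ∈-map⁻ proj₁ G∈ in
            subst (_ ∈_) (sym eq) (A⊆F G∈𝒬 (𝕊.x∉∁p⇒x∈p x∉))
        ; rank = λ F∈ → let F , F∈𝒬 , eq = ∈-map⁻ proj₁ F∈ in subst (λ F → ∣ F ∩ ∁ A ∣ ≡ s * d) (sym eq) (rank F F∈𝒬)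
        ; block = λ {F′} {x} F∈ x∈ → let F , F∈𝒬 , eq = ∈-map⁻ proj₁ F∈ in
            subst (λ F → ∃ λ b → IsBlock x b × b ⊆ F ∩ ∁ A) (sym eq) (block F∈𝒬 (subst (λ F → x ∈ F ∩ ∁ A) eq x∈))
        ; joined = λ {F′} {x} {y} {b} F∈ x∈ y∈ → let F , F∈𝒬 , eq = ∈-map⁻ proj₁ F∈ in
            joined F∈𝒬 (subst (λ F → x ∈ F ∩ ∁ A) eq x∈) (subst (λ F → y ∈ F ∩ ∁ A) eq y∈)
        ; free = λ xs _ → free xs }
        where
        core≡A : ∀ {F} (F∈ : F ∈ˡ 𝒬) → Structured.core (All.lookup structured F∈) ≡ A
        core≡A F∈ = let open Structured (All.lookup structured F∈) in cores-equal ∣core∣ ∣A∣ core-kernel A-kernel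
        A⊆F : ∀ {F} → F ∈ˡ 𝒬 → A ⊆ proj₁ F
        A⊆F {F} F∈ = subst (_⊆ proj₁ F) (core≡A F∈) (λ x∈ → Structured.core⊆ (All.lookup structured F∈) x∈)
        rank : ∀ F → F ∈ˡ 𝒬 → ∣ proj₁ F ∩ ∁ A ∣ ≡ s * d
        rank (F , ∣F∣) F∈ = ℕ.+-cancelˡ-≡ ℓ _ _ (begin
          ℓ + ∣ F ∩ ∁ A ∣     ≡⟨ cong₂ _+_ (sym ∣A∣) (cong ∣_∣ (𝕊.⊆-antisym
                                   (λ x∈ → let x∈F , x∈∁ = 𝕊.x∈p∩q⁻ F (∁ A) x∈ in 𝕊.x∈p∧x∉q⇒x∈p─q x∈F (𝕊.x∈∁p⇒x∉p x∈∁))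
                                   (λ x∈ → let x∈F , x∉A = x∈p─q⁻ F A x∈ in 𝕊.x∈p∩q⁺ (x∈F , 𝕊.x∉p⇒x∈∁p x∉A)))) ⟩
          ∣ A ∣ + ∣ F ─ A ∣   ≡⟨ card-─ (A⊆F F∈) ⟨
          ∣ F ∣               ≡⟨ trans ∣F∣ r≡ ⟩
          ℓ + s * d           ∎)
          where open ≡-Reasoning
        block : ∀ {F x} → F ∈ˡ 𝒬 → x ∈ proj₁ F ∩ ∁ A → ∃ λ b → IsBlock x b × b ⊆ proj₁ F ∩ ∁ A
        block {F} {x} F∈ x∈ =
          let x∈F , x∈∁ = 𝕊.x∈p∩q⁻ (proj₁ F) (∁ A) x∈
              x∉A = 𝕊.x∈∁p⇒x∉p x∈∁
              K , x∈K , A⊆K , K⊆F , ∣K∣ , kK = subst (λ A → x ∉ A → Block A (proj₁ F) x) (core≡A F∈)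
                (Structured.block (All.lookup structured F∈) x∈F) x∉A
          in K ─ A , (K , x∈K , x∉A , A⊆K , ∣K∣ , kK , refl) ,
             λ y∈ → let y∈K , y∉A = x∈p─q⁻ K A y∈ in 𝕊.x∈p∩q⁺ (K⊆F y∈K , 𝕊.x∉p⇒x∈∁p y∉A)
        joined : ∀ {F x y b} → F ∈ˡ 𝒬 → x ∈ proj₁ F ∩ ∁ A → y ∈ proj₁ F ∩ ∁ A → IsBlock x b → y ∉ b → Joined x y
        joined {F} F∈ x∈ y∈ Bxb y∉b =
          let b′ , Bxb′ , b′⊆ = block F∈ x∈
              c , Byc , c⊆ = block F∈ y∈
          in F , 𝒬⊆ F∈ , A⊆F F∈ , b′ , c , Bxb′ , Byc , (λ z∈ → 𝕊.p∩q⊆p (proj₁ F) (∁ A) (b′⊆ z∈)) ,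
             (λ z∈ → 𝕊.p∩q⊆p (proj₁ F) (∁ A) (c⊆ z∈)) ,
             λ y∈b′ → y∉b (subst (_ ∈_) (block-eq Bxb′ Bxb (block-self Bxb′) (block-self Bxb)) y∈b′)

      regular-few′ : (𝒬 : List (RSubset n r)) → (∀ {F} → F ∈ˡ 𝒬 → F ∈ˡ H) → ListU.Unique 𝒬 → All (Structured ∘ proj₁) 𝒬 →
        s ^ s * (d ^ s * length 𝒬) ≤ (n ∸ ℓ) ^ s
      regular-few′ 𝒬 𝒬⊆ uniq structured = subst₂ (λ q u → s ^ s * (d ^ s * q) ≤ u ^ s)
        (𝕃.length-map proj₁ 𝒬) (trans (𝕊.∣∁p∣≡n∸∣p∣ A) (cong (n ∸_) ∣A∣))
        (turan s (∁ A) (map proj₁ 𝒬) (ListU.map⁺ proj₁-injective uniq) (config 𝒬 𝒬⊆ structured))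
        where
        proj₁-injective : {F F′ : RSubset n r} → proj₁ F ≡ proj₁ F′ → F ≡ F′
        proj₁-injective {F , p} {F , q} refl = cong (F ,_) (ℕ.≡-irrelevant p q)

    regular-few : (𝒬 : List (RSubset n r)) → (∀ {F} → F ∈ˡ 𝒬 → F ∈ˡ H) → ListU.Unique 𝒬 → All (Structured ∘ proj₁) 𝒬 →
      s ^ s * (d ^ s * length 𝒬) ≤ (n ∸ ℓ) ^ s
    regular-few [] _ _ _ = subst (_≤ (n ∸ ℓ) ^ s)
      (sym (trans (cong (s ^ s *_) (ℕ.*-zeroʳ (d ^ s))) (ℕ.*-zeroʳ (s ^ s)))) z≤n
    regular-few 𝒬@(_ ∷ _) 𝒬⊆ uniq structured@(st ∷ _) = regular-few′ core ∣core∣ core-kernel 𝒬 𝒬⊆ uniq structured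
      where open Structured st

    few-cliques : 1 ≤ n → ListU.Unique H → (s * d) ^ s * length H ≤ (n ∸ ℓ) ^ s + (s * d) ^ s * (κₛ * n ^ (s ∸ 1))
    few-cliques 1≤n uniq = begin
      (s * d) ^ s * length H
        ≡⟨ cong ((s * d) ^ s *_) (trans (Perm.↭-length partition) (𝕃.length-++ regular)) ⟩
      (s * d) ^ s * (length regular + length exceptional)
        ≡⟨ ℕ.*-distribˡ-+ ((s * d) ^ s) _ _ ⟩
      (s * d) ^ s * length regular + (s * d) ^ s * length exceptional
        ≡⟨ cong (_+ (s * d) ^ s * length exceptional) (trans (cong (_* length regular) (^-distribʳ-* s d s)) (ℕ.*-assoc (s ^ s) (d ^ s) _)) ⟩
      s ^ s * (d ^ s * length regular) + (s * d) ^ s * length exceptional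
        ≤⟨ ℕ.+-mono-≤ (regular-few regular (λ F∈ → Perm.∈-resp-↭ (↭-sym partition) (∈-++⁺ˡ F∈))
             (proj₁ (unique-++⁻ regular (unique-↭ partition uniq))) structured) (ℕ.*-monoʳ-≤ ((s * d) ^ s) few) ⟩
      (n ∸ ℓ) ^ s + (s * d) ^ s * (κₛ * n ^ (s ∸ 1)) ∎
      where
      open ℕ.≤-Reasoning
      open Split (split 1≤n (length H) H refl id uniq)

  -- The extremal graphs

  module _ {k : ℕ} (class : Fin n → Fin k) where

    fibre : Fin k → Subset n
    fibre p = ⟪ (λ x → class x 𝔽.≟ p) ⟫

    ∈-fibre⁺ : ∀ {x p} → class x ≡ p → x ∈ fibre p
    ∈-fibre⁺ {p = p} = ∈⟪⟫⁺ (λ x → class x 𝔽.≟ p)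

    ∈-fibre⁻ : ∀ {x p} → x ∈ fibre p → class x ≡ p
    ∈-fibre⁻ {p = p} = ∈⟪⟫⁻ (λ x → class x 𝔽.≟ p)

    private
      count≡ : ∀ F p → length (filter (λ x → class x 𝔽.≟ p) (elements F)) ≡ ∣ F ∩ fibre p ∣
      count≡ F p = trans (ℕ.≤-antisym
          (length-⊆ (ListU.filter⁺ _ (elements-unique F)) λ x∈ →
            let x∈F , eq = ∈-filter⁻ (λ x → class x 𝔽.≟ p) {xs = elements F} x∈
            in ∈-elements⁺ (𝕊.x∈p∩q⁺ (∈-elements⁻ F x∈F , ∈-fibre⁺ eq)))
          (length-⊆ (elements-unique (F ∩ fibre p)) λ x∈ →
            let x∈F , x∈p = 𝕊.x∈p∩q⁻ F (fibre p) (∈-elements⁻ _ x∈)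
            in ∈-filter⁺ (λ x → class x 𝔽.≟ p) (∈-elements⁺ x∈F) (∈-fibre⁻ x∈p)))
        (length-elements (F ∩ fibre p))

      one-class : ∀ x → length (filter (λ p → class x 𝔽.≟ p) (allFin k)) ≡ 1
      one-class x = ℕ.≤-antisym
        (length-⊆ {ys = class x ∷ []} (ListU.filter⁺ _ (ListU.allFin⁺ k)) λ p∈ →
          here (sym (proj₂ (∈-filter⁻ (λ p → class x 𝔽.≟ p) {xs = allFin k} p∈))))
        (length-pos (∈-filter⁺ (λ p → class x 𝔽.≟ p) (∈-allFin (class x)) refl))

    card-fibres : ∀ F → ∣ F ∣ ≡ sum (List.tabulate λ p → ∣ F ∩ fibre p ∣)
    card-fibres F = begin
      ∣ F ∣                        ≡⟨ trans (sym (length-elements F)) (sym (ℕ.*-identityʳ _)) ⟩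
      length (elements F) * 1      ≡⟨ ℕ.≤-antisym (sum-≥ _ 1 (elements F) λ {x} _ → ℕ.≤-reflexive (sym (one-class x)))
                                                 (sum-≤ _ 1 (elements F) λ {x} _ → ℕ.≤-reflexive (one-class x)) ⟩
      sum (map (λ x → length (filter (λ p → class x 𝔽.≟ p) (allFin k))) (elements F))
                                   ≡⟨ double-count (λ x p → class x 𝔽.≟ p) (elements F) (allFin k) ⟩
      sum (map (λ p → length (filter (λ x → class x 𝔽.≟ p) (elements F))) (allFin k))
                                   ≡⟨ cong sum (𝕃.map-cong (count≡ F) (allFin k)) ⟩
      sum (map (λ p → ∣ F ∩ fibre p ∣) (allFin k)) ≡⟨ cong sum (𝕃.map-tabulate id (λ p → ∣ F ∩ fibre p ∣)) ⟩
      sum (List.tabulate λ p → ∣ F ∩ fibre p ∣) ∎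
      where open ≡-Reasoning

  sum-mono : ∀ {k} {a m : Fin k → ℕ} → (∀ p → a p ≤ m p) → sum (List.tabulate a) ≤ sum (List.tabulate m)
  sum-mono {zero} h = z≤n
  sum-mono {suc k} h = ℕ.+-mono-≤ (h zero) (sum-mono (h ∘ suc))

  sum-tight : ∀ {k} {a m : Fin k → ℕ} → (∀ p → a p ≤ m p) → sum (List.tabulate m) ≤ sum (List.tabulate a) → ∀ p → a p ≡ m p
  sum-tight {suc k} {a} {m} h tight zero = ℕ.≤-antisym (h zero) (ℕ.+-cancelʳ-≤ (sum (List.tabulate (a ∘ suc))) _ _
    (ℕ.≤-trans (ℕ.+-monoʳ-≤ (m zero) (sum-mono (h ∘ suc))) tight))
  sum-tight {suc k} {a} {m} h tight (suc p) = sum-tight (h ∘ suc) (ℕ.+-cancelˡ-≤ (a zero) _ _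
    (ℕ.≤-trans (ℕ.+-monoˡ-≤ (sum (List.tabulate (m ∘ suc))) (h zero)) tight)) p

  sum-const : ∀ k d → sum (List.tabulate {n = k} (λ _ → d)) ≡ k * d
  sum-const zero d = refl
  sum-const (suc k) d = cong (d +_) (sum-const k d)

  sum-multiple : ∀ {k d} (a : Fin k → ℕ) → (∀ p → a p ≡ 0 ⊎ a p ≡ d) → ∃ λ j → j ≤ k × sum (List.tabulate a) ≡ j * d
  sum-multiple {zero} a h = 0 , z≤n , refl
  sum-multiple {suc k} a h with h zero | sum-multiple (a ∘ suc) (h ∘ suc)
  ... | inj₁ eq | j , j≤k , eq′ = j , ℕ.m≤n⇒m≤1+n j≤k , cong₂ _+_ eq eq′
  ... | inj₂ eq | j , j≤k , eq′ = suc j , s≤s j≤k , cong₂ _+_ eq eq′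

  card-≤-interval : ∀ a m (p : Subset n) → (∀ {x} → x ∈ p → a ≤ Fin.toℕ x × Fin.toℕ x < a + m) → ∣ p ∣ ≤ m
  card-≤-interval a m p h = subst₂ _≤_ (trans (𝕃.length-map Fin.toℕ (elements p)) (length-elements p))
    (trans (𝕃.length-map (a +_) (List.upTo m)) (𝕃.length-upTo m))
    (length-⊆ (ListU.map⁺ 𝔽.toℕ-injective (elements-unique p)) λ y∈ →
      let x , x∈ , eq = ∈-map⁻ Fin.toℕ y∈
          a≤x , x<a+m = h (∈-elements⁻ p x∈)
      in subst (_∈ˡ map (a +_) (List.upTo m)) (trans (ℕ.m+[n∸m]≡n a≤x) (sym eq))
        (∈-map⁺ (a +_) (∈-upTo⁺ (ℕ.+-cancelˡ-< a _ _ (subst (_< a + m) (sym (ℕ.m+[n∸m]≡n a≤x)) x<a+m)))))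

  card-≥-interval : ∀ a m (p : Subset n) → a + m ≤ n → (∀ {x} → a ≤ Fin.toℕ x → Fin.toℕ x < a + m → x ∈ p) → m ≤ ∣ p ∣
  card-≥-interval a m p a+m≤n h = subst₂ _≤_ (trans (𝕃.length-map (a +_) (List.upTo m)) (𝕃.length-upTo m))
    (trans (𝕃.length-map Fin.toℕ (elements p)) (length-elements p))
    (length-⊆ (ListU.map⁺ (ℕ.+-cancelˡ-≡ a _ _) (ListU.upTo⁺ m)) λ y∈ →
      let i , i∈ , eq = ∈-map⁻ (a +_) y∈
          a+i<a+m = ℕ.+-monoʳ-< a (∈-upTo⁻ i∈)
          x = Fin.fromℕ< (ℕ.<-≤-trans a+i<a+m a+m≤n)
          x≡ = 𝔽.toℕ-fromℕ< (ℕ.<-≤-trans a+i<a+m a+m≤n)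
      in subst (_∈ˡ map Fin.toℕ (elements p)) (trans x≡ (sym eq))
        (∈-map⁺ Fin.toℕ (∈-elements⁺ (h (subst (a ≤_) (sym x≡) (ℕ.m≤m+n a i)) (subst (_< a + m) (sym x≡) a+i<a+m)))))

  -- The join of K_ℓ with s disjoint unions of copies of K_d: the first ℓ vertices are universal, the
  -- others are cut into consecutive blocks of d, block κ belonging to part κ mod s.
  module Construction (n ℓ d s : ℕ) .{{_ : Nat.NonZero d}} .{{_ : Nat.NonZero s}} where

    Apex : Fin n → Set
    Apex v = Fin.toℕ v < ℓ

    apex? : Decidable Apex
    apex? v = suc (Fin.toℕ v) ℕ.≤? ℓ

    key : Fin n → ℕ
    key v = (Fin.toℕ v ∸ ℓ) / d

    part : Fin n → Fin s
    part v = key v mod s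

    Adjacent : Fin n → Fin n → Set
    Adjacent u v = u ≢ v × (Apex u ⊎ Apex v ⊎ key u ≡ key v ⊎ part u ≢ part v)

    adjacent? : ∀ u v → Dec (Adjacent u v)
    adjacent? u v = ¬? (u 𝔽.≟ v) ×-dec (apex? u ⊎-dec apex? v ⊎-dec (key u ℕ.≟ key v) ⊎-dec ¬? (part u 𝔽.≟ part v))

    adjacent-sym : ∀ {u v} → Adjacent u v → Adjacent v u
    adjacent-sym (u≢v , inj₁ a) = u≢v ∘ sym , inj₂ (inj₁ a)
    adjacent-sym (u≢v , inj₂ (inj₁ a)) = u≢v ∘ sym , inj₁ a
    adjacent-sym (u≢v , inj₂ (inj₂ (inj₁ eq))) = u≢v ∘ sym , inj₂ (inj₂ (inj₁ (sym eq)))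
    adjacent-sym (u≢v , inj₂ (inj₂ (inj₂ ne))) = u≢v ∘ sym , inj₂ (inj₂ (inj₂ (ne ∘ sym)))

    graph : Graph n
    graph = record
      { adj = λ u v → does (adjacent? u v)
      ; adj-sym = λ u v → does-⇔ (mk⇔ adjacent-sym adjacent-sym) (adjacent? u v) (adjacent? v u)
      ; adj-irrefl = λ v → dec-false (adjacent? v v) λ (v≢v , _) → v≢v refl }

    class : Fin n → Fin (suc s)
    class v = if does (apex? v) then zero else suc (part v)

    class-apex : ∀ {v} → Apex v → class v ≡ zero
    class-apex {v} a = cong (λ b → if b then zero else suc (part v)) (dec-true (apex? v) a)

    class-part : ∀ {v} → ¬ Apex v → class v ≡ suc (part v)
    class-part {v} ¬a = cong (λ b → if b then zero else suc (part v)) (dec-false (apex? v) ¬a)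

    class-zero : ∀ {v} → class v ≡ zero → Apex v
    class-zero {v} eq = [ id , (λ ¬a → ⊥-elim (𝔽.0≢1+n (trans (sym eq) (class-part ¬a)))) ]′ (toSum (apex? v))

    class-suc : ∀ {v p} → class v ≡ suc p → ¬ Apex v × part v ≡ p
    class-suc {v} {p} eq = [ (λ a → ⊥-elim (𝔽.0≢1+n (trans (sym (class-apex a)) eq)))
                       , (λ ¬a → ¬a , 𝔽.suc-injective (trans (sym (class-part ¬a)) eq)) ]′ (toSum (apex? v))

    capacity : Fin (suc s) → ℕ
    capacity zero = ℓ
    capacity (suc _) = d

    sum-capacity : sum (List.tabulate capacity) ≡ ℓ + s * d
    sum-capacity = cong (ℓ +_) (sum-const s d)

    SameBlock : Fin n → Fin n → Set
    SameBlock v w = ¬ Apex w × key w ≡ key v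

    sameBlock? : ∀ v → Decidable (SameBlock v)
    sameBlock? v w = ¬? (apex? w) ×-dec (key w ℕ.≟ key v)

    block : Fin n → Subset n
    block v = ⟪ sameBlock? v ⟫

    key-interval : ∀ {v} → ¬ Apex v → ℓ + key v * d ≤ Fin.toℕ v × Fin.toℕ v < ℓ + key v * d + d
    key-interval {v} ¬a = subst (ℓ + key v * d ≤_) (sym v≡) (ℕ.+-monoʳ-≤ ℓ (ℕ.m≤n+m _ _)) ,
      subst₂ _<_ (sym v≡) (sym (ℕ.+-assoc ℓ (key v * d) d)) (ℕ.+-monoʳ-< ℓ (subst ((Fin.toℕ v ∸ ℓ) % d + key v * d <_) (ℕ.+-comm d (key v * d))
        (ℕ.+-monoˡ-< (key v * d) (m%n<n (Fin.toℕ v ∸ ℓ) d))))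
      where
      v≡ : Fin.toℕ v ≡ ℓ + ((Fin.toℕ v ∸ ℓ) % d + key v * d)
      v≡ = trans (sym (ℕ.m+[n∸m]≡n (ℕ.≮⇒≥ ¬a))) (cong (ℓ +_) (m≡m%n+[m/n]*n (Fin.toℕ v ∸ ℓ) d))

    interval-key : ∀ {v} κ → ℓ + κ * d ≤ Fin.toℕ v → Fin.toℕ v < ℓ + κ * d + d → ¬ Apex v × key v ≡ κ
    interval-key {v} κ lo hi = ℕ.≤⇒≯ (ℕ.≤-trans (ℕ.m≤m+n ℓ (κ * d)) lo) , (begin
      (Fin.toℕ v ∸ ℓ) / d      ≡⟨ cong (λ z → (z ∸ ℓ) / d) (ℕ.m+[n∸m]≡n lo) ⟨
      (ℓ + κ * d + e ∸ ℓ) / d  ≡⟨ cong (_/ d) (trans (cong (_∸ ℓ) (ℕ.+-assoc ℓ (κ * d) e)) (ℕ.m+n∸m≡n ℓ (κ * d + e))) ⟩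
      (κ * d + e) / d          ≡⟨ divide κ e e<d ⟩
      κ                        ∎)
      where
      open ≡-Reasoning
      e = Fin.toℕ v ∸ (ℓ + κ * d)
      e<d : e < d
      e<d = ℕ.+-cancelˡ-< (ℓ + κ * d) _ _ (subst (_< ℓ + κ * d + d) (sym (ℕ.m+[n∸m]≡n lo)) hi)
      divide : ∀ κ e → e < d → (κ * d + e) / d ≡ κ
      divide κ e e<d = trans (+-distrib-/-∣ˡ {m = κ * d} e (divides-refl κ)) (trans (cong₂ _+_ (m*n/n≡m κ d) (m<n⇒m/n≡0 e<d)) (ℕ.+-identityʳ κ))

    ∣block∣≤d : ∀ v → ∣ block v ∣ ≤ d
    ∣block∣≤d v = card-≤-interval (ℓ + key v * d) d (block v) λ {w} w∈ →
      let ¬a , eq = ∈⟪⟫⁻ (sameBlock? v) w∈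
      in subst (λ κ → ℓ + κ * d ≤ Fin.toℕ w × Fin.toℕ w < ℓ + κ * d + d) eq (key-interval ¬a)

    ∣apexes∣≤ℓ : ∣ fibre class zero ∣ ≤ ℓ
    ∣apexes∣≤ℓ = card-≤-interval 0 ℓ (fibre class zero) λ v∈ → z≤n , class-zero (∈-fibre⁻ class v∈)

    clique-fibre⊆block : ∀ {F} → IsClique graph F → ∀ {p v} → v ∈ F ∩ fibre class (suc p) → F ∩ fibre class (suc p) ⊆ block v
    clique-fibre⊆block {F} clique {p} {v} v∈ {w} w∈ =
      let v∈F , v∈p = 𝕊.x∈p∩q⁻ F (fibre class (suc p)) v∈
          w∈F , w∈p = 𝕊.x∈p∩q⁻ F (fibre class (suc p)) w∈
          ¬av , v-part = class-suc (∈-fibre⁻ class v∈p)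
          ¬aw , w-part = class-suc (∈-fibre⁻ class w∈p)
      in ∈⟪⟫⁺ (sameBlock? v) (¬aw , [ cong key , (λ w≢v →
        same-key ¬aw ¬av (trans w-part (sym v-part)) (does-true (adjacent? w v) (clique w v w∈F v∈F w≢v))) ]′ (toSum (w 𝔽.≟ v)))
      where
      does-true : ∀ {P : Set} (P? : Dec P) → does P? ≡ true → P
      does-true (yes p) _ = p
      same-key : ∀ {w v} → ¬ Apex w → ¬ Apex v → part w ≡ part v → Adjacent w v → key w ≡ key v
      same-key ¬aw ¬av same (_ , inj₁ a) = ⊥-elim (¬aw a)
      same-key ¬aw ¬av same (_ , inj₂ (inj₁ a)) = ⊥-elim (¬av a)
      same-key ¬aw ¬av same (_ , inj₂ (inj₂ (inj₁ eq))) = eq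
      same-key ¬aw ¬av same (_ , inj₂ (inj₂ (inj₂ ne))) = ⊥-elim (ne same)

    clique-fibre≤ : ∀ {F} → IsClique graph F → ∀ p → ∣ F ∩ fibre class p ∣ ≤ capacity p
    clique-fibre≤ {F} clique zero = ℕ.≤-trans (𝕊.p⊆q⇒∣p∣≤∣q∣ (𝕊.p∩q⊆q F (fibre class zero))) ∣apexes∣≤ℓ
    clique-fibre≤ {F} clique (suc p) with 𝕊.nonempty? (F ∩ fibre class (suc p))
    ... | yes (v , v∈) = ℕ.≤-trans (𝕊.p⊆q⇒∣p∣≤∣q∣ (clique-fibre⊆block {F} clique v∈)) (∣block∣≤d v)
    ... | no empty = subst (_≤ d) (sym (trans (cong ∣_∣ (𝕊.Empty-unique empty)) (𝕊.∣⊥∣≡0 n))) z≤n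

    -- The capacities add up to exactly the size of `F`, so all of them are attained: `F` consists
    -- of all universal vertices and one block of full size `d` in each part. A truncated last block
    -- never takes part.
    module MaximalClique {F : Subset n} (clique : IsClique graph F) (∣F∣ : ∣ F ∣ ≡ ℓ + s * d) where

      full : ∀ p → ∣ F ∩ fibre class p ∣ ≡ capacity p
      full = sum-tight (clique-fibre≤ {F} clique)
        (ℕ.≤-reflexive (trans sum-capacity (trans (sym ∣F∣) (card-fibres class F))))

      apexes⊆ : fibre class zero ⊆ F
      apexes⊆ v∈ = 𝕊.p∩q⊆p F _ (⊆-card-≥ (𝕊.p∩q⊆q F (fibre class zero))
        (ℕ.≤-trans ∣apexes∣≤ℓ (ℕ.≤-reflexive (sym (full zero)))) v∈)

      block⊆ : ∀ {p v} → v ∈ F ∩ fibre class (suc p) → block v ⊆ F ∩ fibre class (suc p)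
      block⊆ {p} {v} v∈ = ⊆-card-≥ (clique-fibre⊆block {F} clique v∈) (ℕ.≤-trans (∣block∣≤d v) (ℕ.≤-reflexive (sym (full (suc p)))))

    -- In each part the cliques select whole blocks, so their intersection there is a whole block or
    -- empty; the universal vertices lie in all of them.
    ⋂-size : ∀ (F₀ : Subset n) Fs → (∀ {F} → F ∈ˡ F₀ ∷ Fs → IsKᵣ (ℓ + s * d) graph F) →
      ∃ λ k → k ≤ s × ∣ ⋂ (F₀ ∷ Fs) ∣ ≡ ℓ + k * d
    ⋂-size F₀ Fs cliques =
      let k , k≤s , eq = sum-multiple (λ p → ∣ I ∩ fibre class (suc p) ∣) part-size
      in k , k≤s , trans (card-fibres class I) (cong₂ _+_ apex-size eq)
      where
      I = ⋂ (F₀ ∷ Fs)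
      module M {F} (F∈ : F ∈ˡ F₀ ∷ Fs) = MaximalClique {F} (proj₂ (cliques F∈)) (proj₁ (cliques F∈))
      I⊆ : ∀ {F} → F ∈ˡ F₀ ∷ Fs → I ⊆ F
      I⊆ F∈ x∈ = ∈⋂⁻ (F₀ ∷ Fs) x∈ F∈
      restrict≤ : ∀ p → ∣ I ∩ fibre class p ∣ ≤ capacity p
      restrict≤ p = subst (∣ I ∩ fibre class p ∣ ≤_) (M.full (here refl) p) (𝕊.p⊆q⇒∣p∣≤∣q∣ λ x∈ →
        let x∈I , x∈p = 𝕊.x∈p∩q⁻ I (fibre class p) x∈ in 𝕊.x∈p∩q⁺ (I⊆ (here refl) x∈I , x∈p))
      apex-size : ∣ I ∩ fibre class zero ∣ ≡ ℓ
      apex-size = ℕ.≤-antisym (restrict≤ zero) (subst (_≤ ∣ I ∩ fibre class zero ∣) (M.full (here refl) zero)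
        (𝕊.p⊆q⇒∣p∣≤∣q∣ λ x∈ → let x∈p = 𝕊.p∩q⊆q F₀ (fibre class zero) x∈ in
          𝕊.x∈p∩q⁺ (∈⋂⁺ (F₀ ∷ Fs) (λ F∈ → M.apexes⊆ F∈ x∈p) , x∈p)))
      part-size : ∀ p → ∣ I ∩ fibre class (suc p) ∣ ≡ 0 ⊎ ∣ I ∩ fibre class (suc p) ∣ ≡ d
      part-size p with 𝕊.nonempty? (I ∩ fibre class (suc p))
      ... | no empty = inj₁ (trans (cong ∣_∣ (𝕊.Empty-unique empty)) (𝕊.∣⊥∣≡0 n))
      ... | yes (v , v∈) = inj₂ (ℕ.≤-antisym (restrict≤ (suc p)) (subst (_≤ ∣ I ∩ fibre class (suc p) ∣) (M.full (here refl) (suc p))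
        (𝕊.p⊆q⇒∣p∣≤∣q∣ λ {x} x∈ →
          let x∈b = clique-fibre⊆block {F₀} (proj₂ (cliques (here refl))) (v∈F (here refl)) x∈
          in 𝕊.x∈p∩q⁺ (∈⋂⁺ (F₀ ∷ Fs) (λ {F} F∈ → 𝕊.p∩q⊆p F _ (M.block⊆ F∈ (v∈F F∈) x∈b)) , 𝕊.p∩q⊆q F₀ (fibre class (suc p)) x∈))))
        where
        v∈F : ∀ {F} → F ∈ˡ F₀ ∷ Fs → v ∈ F ∩ fibre class (suc p)
        v∈F F∈ = let v∈I , v∈p = 𝕊.x∈p∩q⁻ I (fibre class (suc p)) v∈ in 𝕊.x∈p∩q⁺ (I⊆ F∈ v∈I , v∈p)

    ⋂-size-distinct : ∀ {F₀ F₁ : Subset n} Fs → F₀ ≢ F₁ → (∀ {F} → F ∈ˡ F₀ ∷ F₁ ∷ Fs → IsKᵣ (ℓ + s * d) graph F) →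
      ∃ λ k → k < s × ∣ ⋂ (F₀ ∷ F₁ ∷ Fs) ∣ ≡ ℓ + k * d
    ⋂-size-distinct {F₀} {F₁} Fs F₀≢F₁ cliques =
      let k , k≤s , eq = ⋂-size F₀ (F₁ ∷ Fs) cliques
      in k , ℕ.≤∧≢⇒< k≤s (λ k≡s → let eq′ = trans eq (cong (λ k → ℓ + k * d) k≡s) in
        F₀≢F₁ (trans (sym (I≡ eq′ (here refl))) (I≡ eq′ (there (here refl))))) , eq
      where
      I = ⋂ (F₀ ∷ F₁ ∷ Fs)
      I≡ : ∣ I ∣ ≡ ℓ + s * d → ∀ {F} → F ∈ˡ F₀ ∷ F₁ ∷ Fs → I ≡ F
      I≡ eq {F} F∈ = 𝕊.⊆-antisym (λ x∈ → ∈⋂⁻ (F₀ ∷ F₁ ∷ Fs) x∈ F∈)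
        (⊆-card-≥ (λ x∈ → ∈⋂⁻ (F₀ ∷ F₁ ∷ Fs) x∈ F∈) (ℕ.≤-reflexive (trans (proj₁ (cliques F∈)) (sym eq))))

    module Transversals (q : ℕ) (fits : ℓ + s * q * d ≤ n) where

      -- Blocks are dealt to the parts cyclically, so those of part `p` are numbered `p`, `p + s`,
      -- `p + 2 * s` and so on.
      chosen : Vec (Fin q) s → Fin s → ℕ
      chosen c p = Fin.toℕ p + Fin.toℕ (lookup c p) * s

      Selected : Vec (Fin q) s → Fin n → Set
      Selected c v = Apex v ⊎ key v ≡ chosen c (part v)

      selected? : ∀ c → Decidable (Selected c)
      selected? c v = apex? v ⊎-dec (key v ℕ.≟ chosen c (part v))

      transversal : Vec (Fin q) s → Subset n
      transversal c = ⟪ selected? c ⟫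

      chosen-part : ∀ c p → chosen c p mod s ≡ p
      chosen-part c p = 𝔽.toℕ-injective (trans (𝔽.toℕ-fromℕ< (m%n<n (chosen c p) s))
        (trans ([m+kn]%n≡m%n (Fin.toℕ p) (Fin.toℕ (lookup c p)) s) (m<n⇒m%n≡m (𝔽.toℕ<n p))))

      chosen-fits : ∀ c p → ℓ + chosen c p * d + d ≤ n
      chosen-fits c p = begin
        ℓ + chosen c p * d + d  ≡⟨ trans (ℕ.+-assoc ℓ _ d) (cong (ℓ +_) (ℕ.+-comm (chosen c p * d) d)) ⟩
        ℓ + suc (chosen c p) * d ≤⟨ ℕ.+-monoʳ-≤ ℓ (ℕ.*-monoˡ-≤ d (begin
          suc (Fin.toℕ p) + Fin.toℕ (lookup c p) * s ≤⟨ ℕ.+-monoˡ-≤ _ (𝔽.toℕ<n p) ⟩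
          suc (Fin.toℕ (lookup c p)) * s             ≤⟨ ℕ.*-monoˡ-≤ s (𝔽.toℕ<n (lookup c p)) ⟩
          q * s                                      ≡⟨ ℕ.*-comm q s ⟩
          s * q ∎)) ⟩
        ℓ + s * q * d           ≤⟨ fits ⟩
        n ∎
        where open ℕ.≤-Reasoning

      transversal-full : ∀ c p → capacity p ≤ ∣ transversal c ∩ fibre class p ∣
      transversal-full c zero = card-≥-interval 0 ℓ _ (ℕ.≤-trans (ℕ.m≤m+n ℓ _) fits) λ _ a →
        𝕊.x∈p∩q⁺ (∈⟪⟫⁺ (selected? c) (inj₁ a) , ∈-fibre⁺ class (class-apex a))
      transversal-full c (suc p) = card-≥-interval (ℓ + chosen c p * d) d _ (chosen-fits c p) λ {v} lo hi →
        let ¬a , eq = interval-key (chosen c p) lo hi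
            v-part = trans (cong (_mod s) eq) (chosen-part c p)
        in 𝕊.x∈p∩q⁺ (∈⟪⟫⁺ (selected? c) (inj₂ (trans eq (cong (chosen c) (sym v-part)))) ,
                     ∈-fibre⁺ class (trans (class-part ¬a) (cong suc v-part)))

      transversal-clique : ∀ c → IsClique graph (transversal c)
      transversal-clique c u v u∈ v∈ u≢v = dec-true (adjacent? u v)
        (u≢v , connect (∈⟪⟫⁻ (selected? c) u∈) (∈⟪⟫⁻ (selected? c) v∈))
        where
        connect : Selected c u → Selected c v → Apex u ⊎ Apex v ⊎ key u ≡ key v ⊎ part u ≢ part v
        connect (inj₁ a) _ = inj₁ a
        connect (inj₂ _) (inj₁ a) = inj₂ (inj₁ a)
        connect (inj₂ ku) (inj₂ kv) = inj₂ (inj₂ ([ (λ same → inj₁ (trans ku (trans (cong (chosen c) same) (sym kv)))) , inj₂ ]′ (toSum (part u 𝔽.≟ part v))))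

      ∣transversal∣ : ∀ c → ∣ transversal c ∣ ≡ ℓ + s * d
      ∣transversal∣ c = ℕ.≤-antisym
        (subst₂ _≤_ (sym (card-fibres class (transversal c))) sum-capacity (sum-mono (clique-fibre≤ {transversal c} (transversal-clique c))))
        (subst₂ _≤_ sum-capacity (sym (card-fibres class (transversal c))) (sum-mono (transversal-full c)))

      transversal-injective : ∀ {c c′} → transversal c ≡ transversal c′ → c ≡ c′
      transversal-injective {c} {c′} eq = trans (sym (𝕍.tabulate∘lookup c)) (trans (𝕍.tabulate-cong λ p →
        -- The first vertex of the chosen block in part `p` identifies that block, hence the entry
        -- of `c` at `p`.
        let base<n = ℕ.<-≤-trans (ℕ.m<m+n _ (Nat.>-nonZero⁻¹ d)) (chosen-fits c p)
            v = Fin.fromℕ< base<n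
            v≡ = 𝔽.toℕ-fromℕ< base<n
            ¬a , key≡ = interval-key {v} (chosen c p) (ℕ.≤-reflexive (sym v≡)) (subst (_< ℓ + chosen c p * d + d) (sym v≡) (ℕ.m<m+n _ (Nat.>-nonZero⁻¹ d)))
            v-part = trans (cong (_mod s) key≡) (chosen-part c p)
            v∈c = ∈⟪⟫⁺ (selected? c) {v} (inj₂ (trans key≡ (cong (chosen c) (sym v-part))))
            same = [ (λ a → ⊥-elim (¬a a)) , (λ kv → trans (sym key≡) (trans kv (cong (chosen c′) v-part))) ]′
                     (∈⟪⟫⁻ (selected? c′) (subst (v ∈_) eq v∈c))
        in 𝔽.toℕ-injective (ℕ.*-cancelʳ-≡ _ _ s (ℕ.+-cancelˡ-≡ (Fin.toℕ p) _ _ same))) (𝕍.tabulate∘lookup c′))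

      many-cliques : q ^ s ≤ #Kᵣ (ℓ + s * d) graph
      many-cliques = begin
        q ^ s ≡⟨ cong (_^ s) (𝕃.length-tabulate {n = q} id) ⟨
        length (allFin q) ^ s ≡⟨ length-vecs (allFin q) s ⟨
        length (vecs (allFin q) s) ≡⟨ 𝕃.length-map transversal (vecs (allFin q) s) ⟨
        length (map transversal (vecs (allFin q) s)) ≤⟨ length-⊆ (ListU.map⁺ transversal-injective (vecs-unique (ListU.allFin⁺ q) s)) sub ⟩
        #Kᵣ (ℓ + s * d) graph ∎
        where
        open ℕ.≤-Reasoning
        sub : ∀ {F} → F ∈ˡ map transversal (vecs (allFin q) s) → F ∈ˡ cliques (ℓ + s * d) graph
        sub F∈ with ∈-map⁻ transversal F∈
        ... | c , _ , refl = ∈-filter⁺ (isKᵣ? (ℓ + s * d) graph) (subsets-complete (transversal c)) (∣transversal∣ c , transversal-clique c)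

  -- Asymptotics of Ψ

  progression : ∀ d x xs r → Linked (λ a b → b ≡ a + d) ((x ∷ xs) List.∷ʳ r) →
    r ≡ x + suc (length xs) * d ×
    (∀ {z} → z ∈ˡ x ∷ xs → ∃ λ k → k < suc (length xs) × z ≡ x + k * d) ×
    (∀ k → k < suc (length xs) → x + k * d ∈ˡ x ∷ xs)
  progression d x [] r (eq ∷ _) = trans eq (cong (x +_) (sym (ℕ.+-identityʳ d))) ,
    (λ { (here refl) → 0 , s≤s z≤n , sym (ℕ.+-identityʳ x) }) , λ { zero _ → here (ℕ.+-identityʳ x) ; (suc k) (s≤s ()) }
  progression d x (y ∷ ys) r (refl ∷ link) with progression d (x + d) ys r link
  ... | r≡ , index , member = trans r≡ (ℕ.+-assoc x d _) ,
    (λ { (here refl) → 0 , s≤s z≤n , sym (ℕ.+-identityʳ x)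
       ; (there z∈) → let k , k< , eq = index z∈ in suc k , s≤s k< , trans eq (ℕ.+-assoc x d (k * d)) }) ,
    λ { zero _ → here (ℕ.+-identityʳ x)
      ; (suc k) (s≤s k<) → there (subst (_∈ˡ x + d ∷ ys) (ℕ.+-assoc x d (k * d)) (member k k<)) }

  attach : {P : A → Set} {xs : List A} → All P xs → List (∃ P)
  attach = All.reduce (_ ,_)

  map-attach : {P : A → Set} {xs : List A} (ps : All P xs) → map proj₁ (attach ps) ≡ xs
  map-attach [] = refl
  map-attach (p ∷ ps) = cong (_ ∷_) (map-attach ps)

  module Extremal (t₀ ℓ d s r : ℕ) (r≡ : r ≡ ℓ + s * d) (0<d : 0 < d) (2≤s : 2 ≤ s) (not-trivial : 2 ≤ d ⊎ 1 ≤ ℓ)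
    (L : List ℕ) (index : ∀ {z} → z ∈ˡ L → ∃ λ k → k < s × z ≡ ℓ + k * d) (member : ∀ k → k < s → ℓ + k * d ∈ˡ L) where

    t : ℕ
    t = suc (suc t₀)

    K : ℕ
    K = κ r t (length (subsets r))

    2≤r : 2 ≤ r
    2≤r = subst (2 ≤_) (sym r≡) (ℕ.≤-trans 2≤s (ℕ.≤-trans (ℕ.m≤m*n s d {{Nat.>-nonZero 0<d}}) (ℕ.m≤n+m (s * d) ℓ)))

    clique-count : ∀ {n} → 1 ≤ n → (G : Graph n) → IsKᵣIntersecting r L t G →
      (s * d) ^ s * #Kᵣ r G ≤ (n ∸ ℓ) ^ s + (s * d) ^ s * (K * n ^ (s ∸ 1))
    clique-count {n} 1≤n G int = subst (λ q → (s * d) ^ s * q ≤ (n ∸ ℓ) ^ s + (s * d) ^ s * (K * n ^ (s ∸ 1)))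
      (trans (sym (𝕃.length-map proj₁ H)) (cong length H≡))
      (Regular.few-cliques t₀ H ℓ d s r≡ 0<d 2≤s intersecting G H-clique clique-H not-trivial 1≤n H-unique)
      where
      isClique : ∀ {F} → F ∈ˡ cliques r G → IsKᵣ r G F
      isClique F∈ = proj₂ (∈-filter⁻ (isKᵣ? r G) {xs = subsets n} F∈)
      sizes : All (λ F → ∣ F ∣ ≡ r) (cliques r G)
      sizes = All.tabulate λ F∈ → proj₁ (isClique F∈)
      H : List (RSubset n r)
      H = attach sizes
      H≡ : map proj₁ H ≡ cliques r G
      H≡ = map-attach sizes
      H-unique : ListU.Unique H
      H-unique = ListU.map⁻ (subst ListU.Unique (sym H≡) (ListU.filter⁺ (isKᵣ? r G) (subsets-unique n)))
      intersecting : (Fs : Vec (Subset n) t) → VecU.Unique Fs → VAll.All (_∈ˡ map proj₁ H) Fs →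
        ∃ λ k → k < s × ∣ ⋂ (toList Fs) ∣ ≡ ℓ + k * d
      intersecting Fs uniq Fs∈ = index (int Fs uniq (subst (λ 𝓕 → VAll.All (_∈ˡ 𝓕) Fs) H≡ Fs∈))
      H-clique : ∀ {F} → F ∈ˡ H → IsClique G (proj₁ F)
      H-clique F∈ = proj₂ (isClique (subst (_ ∈ˡ_) H≡ (∈-map⁺ proj₁ F∈)))
      clique-H : ∀ F → IsClique G (proj₁ F) → F ∈ˡ H
      clique-H (F , ∣F∣) clique with ∈-map⁻ proj₁ (subst (F ∈ˡ_) (sym H≡) (∈-filter⁺ (isKᵣ? r G) (subsets-complete F) (∣F∣ , clique)))
      ... | (F , ∣F∣′) , F∈ , refl = subst (λ e → (F , e) ∈ˡ H) (ℕ.≡-irrelevant ∣F∣′ ∣F∣) F∈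

    Ψ-≤ : ∀ n → 1 ≤ n → (s * d) ^ s * Ψ r n L t ≤ (n ∸ ℓ) ^ s + (s * d) ^ s * (K * n ^ (s ∸ 1))
    Ψ-≤ n 1≤n = let G , int , eq = Ψ-attained {n} {r} {t} L 2≤r (s≤s z≤n)
                in subst (λ q → (s * d) ^ s * q ≤ (n ∸ ℓ) ^ s + (s * d) ^ s * (K * n ^ (s ∸ 1))) eq (clique-count 1≤n G int)

    -- A discrete mean value estimate. It bounds the loss from rounding `(n ∸ ℓ) / (s * d)` down to
    -- the integer number `q` of blocks per part.
    ^-≤-shift : ∀ x y D k → y ≤ x + D → x ≤ y → y ^ suc k ≤ x ^ suc k + suc k * D * y ^ k
    ^-≤-shift x y D zero y≤ x≤y = subst₂ _≤_ (sym (ℕ.*-identityʳ y)) (lemma x D) y≤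
      where
      lemma : ∀ x D → x + D ≡ x * 1 + 1 * D * 1
      lemma = solve-∀
    ^-≤-shift x y D (suc k) y≤ x≤y = begin
      y * y ^ suc k                                              ≤⟨ ℕ.*-monoʳ-≤ y (^-≤-shift x y D k y≤ x≤y) ⟩
      y * (x ^ suc k + suc k * D * y ^ k)                        ≡⟨ eq₁ y (x ^ suc k) (suc k * D) (y ^ k) ⟩
      y * x ^ suc k + suc k * D * y ^ suc k                      ≤⟨ ℕ.+-monoˡ-≤ _ (ℕ.*-monoˡ-≤ (x ^ suc k) y≤) ⟩
      (x + D) * x ^ suc k + suc k * D * y ^ suc k                ≡⟨ cong (_+ suc k * D * y ^ suc k) (ℕ.*-distribʳ-+ (x ^ suc k) x D) ⟩
      x ^ suc (suc k) + D * x ^ suc k + suc k * D * y ^ suc k    ≤⟨ ℕ.+-monoˡ-≤ _ (ℕ.+-monoʳ-≤ (x ^ suc (suc k)) (ℕ.*-monoʳ-≤ D (ℕ.^-monoˡ-≤ (suc k) x≤y))) ⟩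
      x ^ suc (suc k) + D * y ^ suc k + suc k * D * y ^ suc k    ≡⟨ eq₂ (x ^ suc (suc k)) D k (y ^ suc k) ⟩
      x ^ suc (suc k) + suc (suc k) * D * y ^ suc k              ∎
      where
      open ℕ.≤-Reasoning
      eq₁ : ∀ y a c b → y * (a + c * b) ≡ y * a + c * (y * b)
      eq₁ = solve-∀
      eq₂ : ∀ a D k b → a + D * b + suc k * D * b ≡ a + suc (suc k) * D * b
      eq₂ = solve-∀

    module _ (n : ℕ) (ℓ≤n : ℓ ≤ n) where

      private
        instance
          d≢0 : Nat.NonZero d
          d≢0 = Nat.>-nonZero 0<d
          s≢0 : Nat.NonZero s
          s≢0 = Nat.>-nonZero (ℕ.≤-trans (s≤s z≤n) 2≤s)
          sd≢0 : Nat.NonZero (s * d)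
          sd≢0 = ℕ.m*n≢0 s d

        q : ℕ
        q = (n ∸ ℓ) / (s * d)

        m≡ : n ∸ ℓ ≡ (n ∸ ℓ) % (s * d) + q * (s * d)
        m≡ = m≡m%n+[m/n]*n (n ∸ ℓ) (s * d)

        q*sd≤ : q * (s * d) ≤ n ∸ ℓ
        q*sd≤ = subst (q * (s * d) ≤_) (sym m≡) (ℕ.m≤n+m _ _)

        fits : ℓ + s * q * d ≤ n
        fits = subst₂ _≤_ (cong (ℓ +_) (lemma q s d)) (ℕ.m+[n∸m]≡n ℓ≤n) (ℕ.+-monoʳ-≤ ℓ q*sd≤)
          where
          lemma : ∀ q s d → q * (s * d) ≡ s * q * d
          lemma = solve-∀

        open Construction n ℓ d s

        intersecting : IsKᵣIntersecting (ℓ + s * d) L t graph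
        intersecting (F₀ ∷ F₁ ∷ Fs) ((F₀≢F₁ ∷ _) ∷ _) Fs∈ =
          let k , k<s , eq = ⋂-size-distinct (toList Fs) F₀≢F₁ λ F∈ →
                proj₂ (∈-filter⁻ (isKᵣ? (ℓ + s * d) graph) {xs = subsets n} (All.lookup (VAll.toList⁺ Fs∈) F∈))
          in subst (_∈ˡ L) (sym eq) (member k k<s)

        q^s≤Ψ : q ^ s ≤ Ψ r n L t
        q^s≤Ψ = subst (λ r → q ^ s ≤ Ψ r n L t) (sym r≡)
          (ℕ.≤-trans (Transversals.many-cliques q fits) (Ψ-upper (ℓ + s * d) L t graph intersecting))

      Ψ-≥ : (n ∸ ℓ) ^ s ≤ (s * d) ^ s * Ψ r n L t + s * (s * d) * (n ∸ ℓ) ^ (s ∸ 1)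
      Ψ-≥ = begin
        (n ∸ ℓ) ^ s                                              ≤⟨ shift s ⟩
        (q * (s * d)) ^ s + s * (s * d) * (n ∸ ℓ) ^ (s ∸ 1)      ≡⟨ cong (_+ s * (s * d) * (n ∸ ℓ) ^ (s ∸ 1)) (trans (^-distribʳ-* q (s * d) s) (ℕ.*-comm (q ^ s) _)) ⟩
        (s * d) ^ s * q ^ s + s * (s * d) * (n ∸ ℓ) ^ (s ∸ 1)    ≤⟨ ℕ.+-monoˡ-≤ _ (ℕ.*-monoʳ-≤ ((s * d) ^ s) q^s≤Ψ) ⟩
        (s * d) ^ s * Ψ r n L t + s * (s * d) * (n ∸ ℓ) ^ (s ∸ 1) ∎
        where
        open ℕ.≤-Reasoning
        shift : ∀ j .{{_ : Nat.NonZero j}} → (n ∸ ℓ) ^ j ≤ (q * (s * d)) ^ j + j * (s * d) * (n ∸ ℓ) ^ (j ∸ 1)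
        shift (suc k) = ^-≤-shift (q * (s * d)) (n ∸ ℓ) (s * d) k
          (subst₂ _≤_ (sym m≡) (ℕ.+-comm (s * d) _) (ℕ.+-monoˡ-≤ (q * (s * d)) (ℕ.<⇒≤ (m%n<n (n ∸ ℓ) (s * d))))) q*sd≤

    -- The first summand comes from the exceptional cliques, with `2 ^ (s ∸ 1)` due to
    -- `n ≤ 2 * (n ∸ ℓ)` beyond `2 * ℓ`; the second is the rounding loss of the construction.
    error : ℕ
    error = (s * d) ^ s * (K * 2 ^ (s ∸ 1)) + s * (s * d)

    Ψ-upper-estimate : ∀ n → suc (ℓ + ℓ) ≤ n → (s * d) ^ s * Ψ r n L t ≤ (n ∸ ℓ) ^ s + error * (n ∸ ℓ) ^ (s ∸ 1)
    Ψ-upper-estimate n big = begin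
      (s * d) ^ s * Ψ r n L t                                    ≤⟨ Ψ-≤ n (ℕ.≤-trans (s≤s z≤n) big) ⟩
      M ^ s + (s * d) ^ s * (K * n ^ (s ∸ 1))                    ≤⟨ ℕ.+-monoʳ-≤ (M ^ s) (ℕ.*-monoʳ-≤ ((s * d) ^ s) (ℕ.*-monoʳ-≤ K (ℕ.^-monoˡ-≤ (s ∸ 1) n≤2m))) ⟩
      M ^ s + (s * d) ^ s * (K * (2 * M) ^ (s ∸ 1))              ≡⟨ cong (λ z → M ^ s + (s * d) ^ s * (K * z)) (^-distribʳ-* 2 M (s ∸ 1)) ⟩
      M ^ s + (s * d) ^ s * (K * (2 ^ (s ∸ 1) * M ^ (s ∸ 1)))    ≡⟨ cong (M ^ s +_) (lemma ((s * d) ^ s) K (2 ^ (s ∸ 1)) (M ^ (s ∸ 1))) ⟩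
      M ^ s + (s * d) ^ s * (K * 2 ^ (s ∸ 1)) * M ^ (s ∸ 1)      ≤⟨ ℕ.+-monoʳ-≤ (M ^ s) (ℕ.*-monoˡ-≤ (M ^ (s ∸ 1)) (ℕ.m≤m+n ((s * d) ^ s * (K * 2 ^ (s ∸ 1))) (s * (s * d)))) ⟩
      M ^ s + error * M ^ (s ∸ 1)                                ∎
      where
      open ℕ.≤-Reasoning
      M : ℕ
      M = n ∸ ℓ
      lemma : ∀ a b c e → a * (b * (c * e)) ≡ a * (b * c) * e
      lemma = solve-∀
      ℓ≤m : ℓ ≤ M
      ℓ≤m = ℕ.m+n≤o⇒m≤o∸n ℓ (ℕ.<⇒≤ big)
      n≤2m : n ≤ 2 * M
      n≤2m = subst₂ _≤_ (ℕ.m+[n∸m]≡n (ℕ.≤-trans (ℕ.m≤m+n ℓ ℓ) (ℕ.<⇒≤ big))) (cong (M +_) (sym (ℕ.+-identityʳ M))) (ℕ.+-monoˡ-≤ M ℓ≤m)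

    Ψ-lower-estimate : ∀ n → suc (ℓ + ℓ) ≤ n → (n ∸ ℓ) ^ s ≤ (s * d) ^ s * Ψ r n L t + error * (n ∸ ℓ) ^ (s ∸ 1)
    Ψ-lower-estimate n big = ℕ.≤-trans (Ψ-≥ n (ℕ.≤-trans (ℕ.m≤m+n ℓ ℓ) (ℕ.<⇒≤ big)))
      (ℕ.+-monoʳ-≤ ((s * d) ^ s * Ψ r n L t) (ℕ.*-monoˡ-≤ ((n ∸ ℓ) ^ (s ∸ 1)) (ℕ.m≤n+m (s * (s * d)) ((s * d) ^ s * (K * 2 ^ (s ∸ 1))))))

  Ψ-asymptotic : (t r : ℕ) → 3 ≤ t →
    (ℓ₁ : ℕ) (ℓs : List ℕ) → Linked _<_ (ℓ₁ ∷ ℓs) → (ℓ₁<r : ℓ₁ < r) →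
    length (ℓ₁ ∷ ℓs) ≢ 1 → length (ℓ₁ ∷ ℓs) ≢ r → IsArithmeticProgression ((ℓ₁ ∷ ℓs) List.∷ʳ r) →
    (λ n → pos (Ψ r n (ℓ₁ ∷ ℓs) t) ℚ./ 1) ≡⟨1+o⟩
    (λ n → (ℚ._/_ (pos n ℤ.- pos ℓ₁) (r ∸ ℓ₁) {{∸-nonZero ℓ₁<r}}) ℚ^.^ length (ℓ₁ ∷ ℓs))
  Ψ-asymptotic t r _ ℓ₁ [] _ _ s≢1 = ⊥-elim (s≢1 refl)
  Ψ-asymptotic (suc (suc t₀)) r (s≤s (s≤s _)) ℓ₁ (ℓ₂ ∷ ℓs) (ℓ₁<ℓ₂ ∷ _) ℓ₁<r _ s≢r (δ , linked@(δ≡ ∷ _)) =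
    let r≡ , index , member = progression d ℓ₁ (ℓ₂ ∷ ℓs) r (Linked.map step linked)
        module E = Extremal t₀ ℓ₁ d s r r≡ (ℕ.m<n⇒0<n∸m ℓ₁<ℓ₂) (s≤s (s≤s z≤n)) (not-trivial r≡) L index member
        D≡ : s * d ≡ r ∸ ℓ₁
        D≡ = sym (trans (cong (_∸ ℓ₁) r≡) (ℕ.m+n∸m≡n ℓ₁ (s * d)))
    in asymptotic (λ n → Ψ r n L (suc (suc t₀))) ℓ₁ (r ∸ ℓ₁) (s ∸ 1) E.error (suc (ℓ₁ + ℓ₁)) {{∸-nonZero ℓ₁<r}}
      (λ n big → subst (λ D → D ^ s * Ψ r n L (suc (suc t₀)) ≤ (n ∸ ℓ₁) ^ s + E.error * (n ∸ ℓ₁) ^ (s ∸ 1)) D≡ (E.Ψ-upper-estimate n big))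
      (λ n big → subst (λ D → (n ∸ ℓ₁) ^ s ≤ D ^ s * Ψ r n L (suc (suc t₀)) + E.error * (n ∸ ℓ₁) ^ (s ∸ 1)) D≡ (E.Ψ-lower-estimate n big))
    where
    L = ℓ₁ ∷ ℓ₂ ∷ ℓs
    s = length L
    d = ℓ₂ ∸ ℓ₁
    -- The integer difference `δ` equals the first gap, which is positive because the list
    -- increases; the progression can then be read in natural numbers.
    step : ∀ {x y} → pos y ℤ.- pos x ≡ δ → y ≡ x + d
    step {x} {y} eq = ℤ.+-injective (begin
      pos y                        ≡⟨ cancel (pos y) (pos x) ⟨
      pos x ℤ.+ (pos y ℤ.- pos x)      ≡⟨ cong (λ z → pos x ℤ.+ z) (trans eq (trans (sym δ≡) (trans (ℤ.[+m]-[+n]≡m⊖n ℓ₂ ℓ₁) (ℤ.⊖-≥ (ℕ.<⇒≤ ℓ₁<ℓ₂))))) ⟩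
      pos x ℤ.+ pos d                ≡⟨ ℤ.pos-+ x d ⟨
      pos (x + d)                  ∎)
      where
      open ≡-Reasoning
      cancel : ∀ b a → a ℤ.+ (b ℤ.- a) ≡ b
      cancel = ℤ-Solver.solve-∀
    -- Failure of both alternatives means `d = 1` and `ℓ₁ = 0`, which turns `r ≡ ℓ₁ + s * d` into
    -- the forbidden `s ≡ r`.
    not-trivial : r ≡ ℓ₁ + s * d → 2 ≤ d ⊎ 1 ≤ ℓ₁
    not-trivial r≡ with 2 ℕ.≤? d | 1 ℕ.≤? ℓ₁
    ... | yes 2≤d | _ = inj₁ 2≤d
    ... | no _ | yes 1≤ℓ = inj₂ 1≤ℓ
    ... | no 2≰d | no 1≰ℓ = ⊥-elim (s≢r (sym (trans r≡ (trans (cong₂ (λ ℓ d → ℓ + s * d) (ℕ.n<1⇒n≡0 (ℕ.≰⇒> 1≰ℓ))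
      (ℕ.≤-antisym (ℕ.≤-pred (ℕ.≰⇒> 2≰d)) (ℕ.m<n⇒0<n∸m ℓ₁<ℓ₂))) (ℕ.*-identityʳ s)))))

open import Data.Nat using (ℕ; _≤_; _<_; _∸_)
open import Data.Integer using (+_; _-_)
open import Data.Rational using (_/_)
open import Data.Rational.Base using (+-*-rawSemiring)
open import Algebra.Definitions.RawSemiring +-*-rawSemiring using (_^_)
open import Data.List using (List; _∷_; _∷ʳ_; length)
open import Data.List.Relation.Unary.All as All using (All)
open import Data.List.Relation.Unary.Linked using (Linked)
open import Relation.Binary.PropositionalEquality using (_≡_; _≢_; refl)

theorem1p7 : (t r : ℕ) → 3 ≤ t → 3 ≤ r →
    (ℓ₁ : ℕ) (ℓs : List ℕ) →
    Linked _<_ (ℓ₁ ∷ ℓs) → (ℓ<r : All (_< r) (ℓ₁ ∷ ℓs)) →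
    (s : ℕ) → s ≡ length (ℓ₁ ∷ ℓs) → s ≢ 1 → s ≢ r →
    IsArithmeticProgression ((ℓ₁ ∷ ℓs) ∷ʳ r) →
    (λ n → + Ψ r n (ℓ₁ ∷ ℓs) t / 1) ≡⟨1+o⟩
    (λ n → (_/_ (+ n - + ℓ₁) (r ∸ ℓ₁) {{∸-nonZero (All.head ℓ<r)}}) ^ s)
theorem1p7 t r 3≤t _ ℓ₁ ℓs increasing ℓ<r _ refl s≢1 s≢r progression =
  CliqueCounting.Ψ-asymptotic t r 3≤t ℓ₁ ℓs increasing (All.head ℓ<r) s≢1 s≢r progression
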